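{- Let $n\ge 1$, $w\in \mathcal{BC}_n$ and $k\geq 0$. Then the $k$-truncated Schubert polynomial $\mathfrak C_w^{[k]}(\mathbf z,\mathbf x)$ of type $C$ equals the sum of monomials over all reduced $c$-signed pipe dreams in $\mathrm{PD}_{\mathcal C_n}^k(w)$: \[ \sum_{D\in\mathrm{PD}_{\mathcal C_n}^k(w)} \mathbf x^{\alpha(D)}\mathbf z^{\beta(D)}=\sum_{\substack{u v=w\\ \ell(u)+\ell(v)=\ell(w) \\ v \in \mathcal S_{n}}}\ \sum_{\substack{\mathbf a \in R(u)\\ \mathbf x^{\alpha} \in \mathscr A_{x}(\mathbf{a})\\\alpha_{k+1}=\alpha_{k+2}=\ldots=0}}\ \sum_{\substack{\mathbf b \in R(v)\\ \mathbf z^{\beta} \in \mathscr A_{z}(\mathbf b)}} 2^{i(\alpha)} \mathbf x^{\alpha} \mathbf z^{\beta}=\mathfrak C_w^{[k]}(\mathbf z,\mathbf x). \]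
   Context: **Groups.** $\mathcal{BC}_n$ is the group of permutations $w$ of $\{\pm1,\dots,\pm n\}$ with $w(-i)=-w(i)$, generated by $s_0=(1\leftrightarrow -1)$ and $s_i=(i\leftrightarrow i+1)$ (also exchanging $-i,-(i+1)$), $1\le i\le n-1$; products are compositions of maps, $(uv)(i)=u(v(i))$. $\mathcal S_n\subset\mathcal{BC}_n$ is the symmetric group generated by $s_1,\dots,s_{n-1}$. $\ell$ is the Coxeter length, $R(w)$ the set of reduced words of $w$; $\mathcal{BC}_\infty=\bigcup_n\mathcal{BC}_n$. **Schubert polynomials of type $C$.** Let $\mathbb Q[\mathbf z,p_1(\mathbf x),p_3(\mathbf x),\dots]$ be the ring of polynomials in $z_1,z_2,\dots$ and the odd power sums $p_k(\mathbf x)=\sum_{i\ge1}x_i^k$ (algebraically independent generators). $\mathcal{BC}_\infty$ acts on it by ring automorphisms: $s_i$ ($i\ge1$) exchanges $z_i$ and $z_{i+1}$ and fixes each $p_k(\mathbf x)$; $s_0$ sends $z_1\mapsto -z_1$, fixes $z_j$ ($j\ge 2$), and sends $p_k(\mathbf x)\mapsto p_k(\mathbf x)+z_1^k$. Put $\partial_if=\frac{f-s_if}{z_i-z_{i+1}}$ ($i\ge1$), $\partial_0f=\frac{f-s_0f}{ -2z_1}$. The polynomials $\mathfrak C_w$, $w\in\mathcal{BC}_\infty$, are the unique homogeneous elements ($\deg z_i=1$, $\deg p_k(\mathbf x)=k$) with $\mathfrak C_{\mathrm{id}}=1$ and, for all $i\ge0$, $\partial_i\mathfrak C_w=\mathfrak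 C_{ws_i}$ if $\ell(ws_i)<\ell(w)$ and $\partial_i\mathfrak C_w=0$ otherwise (existence and uniqueness are due to Billey and Haiman). The $k$-truncation is $\mathfrak C_w^{[k]}(\mathbf z,\mathbf x)=\mathfrak C_w(\mathbf z;x_1,\dots,x_k,0,0,\dots)$. **Admissible monomials.** Let $\mathbf a=s_{a_1}\cdots s_{a_l}$ be a reduced word. Its peak set is $P(\mathbf a)=\{i\in\{2,\dots,l-1\}: a_{i-1}<a_i>a_{i+1}\}$. A sequence of positive integers $j_1\ge\dots\ge j_l$ is $x$-admissible for $\mathbf a$ if $j_{i-1}=j_i=j_{i+1}$ implies $i\notin P(\mathbf a)$; $\mathscr A_x(\mathbf a)$ is the set of monomials $\mathbf x^\alpha=x_{j_1}\cdots x_{j_l}$ of such sequences. If $\mathbf a$ is a reduced word of an element of $\mathcal S_n$, a sequence of positive integers $j_1\le\dots\le j_l$ is $z$-admissible for $\mathbf a$ if $j_i\le a_i$ for all $i$ and $j_i=j_{i+1}$ implies $a_i>a_{i+1}$; $\mathscr A_z(\mathbf a)$ is the set of monomials $\mathbf z^\beta=z_{j_1}\cdots z_{j_l}$ of such sequences. $i(\alpha)$ is the number of distinct variables occurring in $\mathbf x^\alpha$ with nonzero exponent. **$c$-signed pipe dreams.** The base $B^k_{\mathcal C_n}$ consists of a staircase block and $k$ $\Gamma$-blocks numbered $1,\dots,k$ from bottom to top, all lying above the staircase block. The staircase block has boxes $(i,j)$, $1\le i\le n-1$, $1\le j\le n-i$ (row $i$ from the top, column $j$ from the left); the box $(i,j)$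 is indexed by $i+j-1$ and has variable $z_i$. Each $\Gamma$-block has a horizontal part, one row of $n$ boxes indexed $0,1,\dots,n-1$ from left to right, and, below that row, a vertical part, one column of $n$ boxes indexed $0,1,\dots,n-1$ from top to bottom; all boxes of the $m$-th $\Gamma$-block have variable $x_m$. A $c$-signed pipe dream $D$ is a filling of the base in which each box of index $0$ in a $\Gamma$-block contains either a single elbow or an elbow with a faucet, and every other box contains either a double elbow or a cross. Significant elements are crosses and elbows with a faucet. A cross in a box of index $i$ contributes the letter $s_i$, an elbow with a faucet the letter $s_0$, elbows without faucets contribute nothing. $\mathrm{word}(D)$ is obtained by reading the letters from top to bottom and in each row from right to left: i.e. the $\Gamma$-blocks $k,k-1,\dots,1$, in each of them first the horizontal part in the order of indices $n-1,\dots,0$, then the vertical part in the order $0,\dots,n-1$; then the staircase rows $1,\dots,n-1$, each from right to left. $\mathbf x^{\alpha(D)}\mathbf z^{\beta(D)}$ is the product of the variables of all boxes containing significant elements. $D$ is reduced of shape $w$ if $\mathrm{word}(D)$ is a reduced word of $w\in\mathcal{BC}_n$; $\mathrm{PD}^k_{\mathcal C_n}(w)$ is the set of reduced $c$-signed pipe dreams with $k$ $\Gamma$-blocks of shape $w$. -}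

module Defs where

open import Level using (0ℓ)
open import Algebra.Bundles using (CommutativeRing)
import Algebra.Properties.Semiring.Exp as Exp
open import Data.Nat.Base using (ℕ; zero; suc; _+_; _*_; _∸_; _≤_; _<_; _>_; _⊔_; s≤s)
open import Data.Nat.Properties using (_≟_; m≤m⊔n; m≤n⊔m; ≤-<-trans)
open import Data.Integer.Base as ℤ using (ℤ; +_; -[1+_]; +[1+_]; ∣_∣)
open import Data.Rational.Base as ℚ using (ℚ; 0ℚ; 1ℚ)
open import Data.List.Base using (List; []; _∷_; _++_; map; concatMap; foldr; length; zip; deduplicate; upTo; downFrom)
open import Data.Nat.ListAction using (sum)
open import Data.List.Relation.Unary.All using (All; []; _∷_)
open import Data.List.Relation.Unary.Linked using (Linked)
open import Data.List.Relation.Binary.Pointwise using (Pointwise)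
open import Data.List.Relation.Binary.Permutation.Propositional using (_↭_; ↭-setoid)
import Data.List.Membership.Setoid as Membership
import Data.List.Relation.Unary.Unique.Setoid as Uniqueness
open import Data.Product.Base using (_×_; _,_; ∃; proj₁; proj₂)
open import Data.Product.Relation.Binary.Pointwise.NonDependent using (×-setoid)
open import Function.Bundles using (_↔_; mk↔ₛ′; Inverse; _⇔_)
open import Function.Construct.Composition using (_↔-∘_)
open import Function.Construct.Identity using (↔-id)
open import Relation.Binary.Bundles using (Setoid)
open import Relation.Binary.PropositionalEquality using (_≡_; refl; sym; trans; cong; setoid)
open import Relation.Nullary.Negation using (¬_)

-- ℚ[V] as the free commutative ℚ-algebra on V: terms modulo the
-- congruence generated by the commutative ring axioms and by the
-- requirement that `con` be a ring homomorphism.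

infixl 6 _⊕_
infixl 7 _⊗_
infix  8 ⊖_
infix  4 _≈_

data Poly (V : Set) : Set where
  con : ℚ → Poly V
  var : V → Poly V
  _⊕_ : Poly V → Poly V → Poly V
  _⊗_ : Poly V → Poly V → Poly V
  ⊖_  : Poly V → Poly V

data _≈_ {V : Set} : Poly V → Poly V → Set where
  ≈-refl  : ∀ {f} → f ≈ f
  ≈-sym   : ∀ {f g} → f ≈ g → g ≈ f
  ≈-trans : ∀ {f g h} → f ≈ g → g ≈ h → f ≈ h
  ⊕-cong  : ∀ {f f′ g g′} → f ≈ f′ → g ≈ g′ → f ⊕ g ≈ f′ ⊕ g′
  ⊗-cong  : ∀ {f f′ g g′} → f ≈ f′ → g ≈ g′ → f ⊗ g ≈ f′ ⊗ g′
  ⊖-cong  : ∀ {f f′} → f ≈ f′ → ⊖ f ≈ ⊖ f′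
  ⊕-assoc : ∀ f g h → (f ⊕ g) ⊕ h ≈ f ⊕ (g ⊕ h)
  ⊕-comm  : ∀ f g → f ⊕ g ≈ g ⊕ f
  ⊕-idˡ   : ∀ f → con 0ℚ ⊕ f ≈ f
  ⊕-invˡ  : ∀ f → ⊖ f ⊕ f ≈ con 0ℚ
  ⊗-assoc : ∀ f g h → (f ⊗ g) ⊗ h ≈ f ⊗ (g ⊗ h)
  ⊗-comm  : ∀ f g → f ⊗ g ≈ g ⊗ f
  ⊗-idˡ   : ∀ f → con 1ℚ ⊗ f ≈ f
  distribˡ : ∀ f g h → f ⊗ (g ⊕ h) ≈ (f ⊗ g) ⊕ (f ⊗ h)
  con-+   : ∀ p q → con (p ℚ.+ q) ≈ con p ⊕ con q
  con-*   : ∀ p q → con (p ℚ.* q) ≈ con p ⊗ con q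

polyRing : Set → CommutativeRing 0ℓ 0ℓ
polyRing V = record
  { Carrier = Poly V
  ; _≈_ = _≈_
  ; _+_ = _⊕_
  ; _*_ = _⊗_
  ; -_  = ⊖_
  ; 0#  = con 0ℚ
  ; 1#  = con 1ℚ
  ; isCommutativeRing = record
    { isRing = record
      { +-isAbelianGroup = record
        { isGroup = record
          { isMonoid = record
            { isSemigroup = record
              { isMagma = record
                { isEquivalence = record { refl = ≈-refl ; sym = ≈-sym ; trans = ≈-trans }
                ; ∙-cong = ⊕-cong
                }
              ; assoc = ⊕-assoc
              }
            ; identity = ⊕-idˡ , λ f → ≈-trans (⊕-comm f _) (⊕-idˡ f)
            }
          ; inverse = ⊕-invˡ , λ f → ≈-trans (⊕-comm f _) (⊕-invˡ f)
          ; ⁻¹-cong = ⊖-cong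
          }
        ; comm = ⊕-comm
        }
      ; *-cong = ⊗-cong
      ; *-assoc = ⊗-assoc
      ; *-identity = ⊗-idˡ , λ f → ≈-trans (⊗-comm f _) (⊗-idˡ f)
      ; distrib = distribˡ
                , λ f g h → ≈-trans (⊗-comm (g ⊕ h) f)
                    (≈-trans (distribˡ f g h) (⊕-cong (⊗-comm f g) (⊗-comm f h)))
      }
    ; *-comm = ⊗-comm
    }
  }

module _ {V : Set} where
  open Exp (CommutativeRing.semiring (polyRing V)) public using () renaming (_^_ to _^ᵖ_)

infixl 6 _⊝_

_⊝_ : ∀ {V} → Poly V → Poly V → Poly V
f ⊝ g = f ⊕ (⊖ g)

∑ ∏ : ∀ {V} → List (Poly V) → Poly V
∑ = foldr _⊕_ (con 0ℚ)
∏ = foldr _⊗_ (con 1ℚ)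

-- The ℚ-algebra homomorphism extending an assignment of the variables.
substitute : ∀ {V W} → (V → Poly W) → Poly V → Poly W
substitute σ (con q) = con q
substitute σ (var v) = σ v
substitute σ (f ⊕ g) = substitute σ f ⊕ substitute σ g
substitute σ (f ⊗ g) = substitute σ f ⊗ substitute σ g
substitute σ (⊖ f)   = ⊖ substitute σ f

-- A ℚ-linear combination of monomials of degree d, where the variable
-- v has degree `deg v`.
Homogeneous : ∀ {V} → (V → ℕ) → ℕ → Poly V → Set
Homogeneous {V} deg d f =
  ∃ λ (ts : List (ℚ × List V)) →
    All (λ t → sum (map deg (proj₂ t)) ≡ d) ts ×
    f ≈ ∑ (map (λ t → con (proj₁ t) ⊗ ∏ (map var (proj₂ t))) ts)

-- SumsTo S P F t: the set { a ∈ S ∣ P a } is finite and t is the sum,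
-- over this set, of the values of F; F relates an element to the value
-- at that element, so that it may itself be an inner `SumsTo`.
SumsTo : ∀ {V} (S : Setoid 0ℓ 0ℓ) →
         (Setoid.Carrier S → Set) →
         (Setoid.Carrier S → Poly V → Set) →
         Poly V → Set
SumsTo {V} S P F t =
  ∃ λ (as : List (Setoid.Carrier S)) →
    Unique as × (∀ a → P a ⇔ a ∈ as) ×
    ∃ λ (fs : List (Poly V)) → Pointwise F as fs × t ≈ ∑ fs
  where
  open Uniqueness S using (Unique)
  open Membership S using (_∈_)

-- An odd bijection of ℤ fixes 0, so an element of the union of the
-- groups BC_n is encoded as an odd bijection of ℤ fixing every integer
-- of sufficiently large absolute value.

record BC∞ : Set where
  field
    perm    : ℤ ↔ ℤ
  open Inverse perm public using (to; from)
  field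
    odd     : ∀ i → to (ℤ.- i) ≡ ℤ.- to i
    bounded : ∃ λ n → ∀ i → n < ∣ i ∣ → to i ≡ i

open BC∞ public using (to)

BC-setoid : Setoid 0ℓ 0ℓ
BC-setoid = record
  { Carrier = BC∞
  ; _≈_ = λ u v → ∀ i → to u i ≡ to v i
  ; isEquivalence = record
    { refl  = λ i → refl
    ; sym   = λ p i → sym (p i)
    ; trans = λ p q i → trans (p i) (q i)
    }
  }

infix 4 _≋_
_≋_ : BC∞ → BC∞ → Set
_≋_ = Setoid._≈_ BC-setoid

infix 4 _∈BC_
_∈BC_ : BC∞ → ℕ → Set
w ∈BC n = ∀ i → n < ∣ i ∣ → to w i ≡ i

ι : BC∞
ι = record
  { perm    = ↔-id ℤ
  ; odd     = λ i → refl
  ; bounded = 0 , λ i _ → refl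
  }

infixl 7 _·_
_·_ : BC∞ → BC∞ → BC∞
u · v = record
  { perm    = BC∞.perm u ↔-∘ BC∞.perm v
  ; odd     = λ i → trans (cong (to u) (BC∞.odd v i)) (BC∞.odd u (to v i))
  ; bounded = m ⊔ n , λ i p →
      trans (cong (to u) (v-fix i (≤-<-trans (m≤n⊔m m n) p)))
            (u-fix i (≤-<-trans (m≤m⊔n m n) p))
  }
  where
  m = proj₁ (BC∞.bounded u)
  n = proj₁ (BC∞.bounded v)
  u-fix = proj₂ (BC∞.bounded u)
  v-fix = proj₂ (BC∞.bounded v)

swap : ℕ → ℕ → ℕ
swap zero    zero          = 1
swap zero    (suc zero)    = 0
swap zero    (suc (suc k)) = suc (suc k)
swap (suc i) zero          = zero
swap (suc i) (suc k)       = suc (swap i k)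

swap-involutive : ∀ i k → swap i (swap i k) ≡ k
swap-involutive zero    zero          = refl
swap-involutive zero    (suc zero)    = refl
swap-involutive zero    (suc (suc k)) = refl
swap-involutive (suc i) zero          = refl
swap-involutive (suc i) (suc k)       = cong suc (swap-involutive i k)

swap-fixes : ∀ i k → suc i < k → swap i k ≡ k
swap-fixes zero    (suc (suc k)) p = refl
swap-fixes zero    (suc zero) (s≤s ())
swap-fixes (suc i) (suc k) (s≤s p) = cong suc (swap-fixes i k p)

s-map : ℕ → ℤ → ℤ
s-map zero    +[1+ zero ]  = -[1+ zero ]
s-map zero    -[1+ zero ]  = +[1+ zero ]
s-map zero    i            = i
s-map (suc a) (+ zero)     = + zero
s-map (suc a) +[1+ k ]     = +[1+ swap a k ]
s-map (suc a) -[1+ k ]     = -[1+ swap a k ]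

s-involutive : ∀ a i → s-map a (s-map a i) ≡ i
s-involutive zero    (+ zero)       = refl
s-involutive zero    +[1+ zero ]    = refl
s-involutive zero    +[1+ suc k ]   = refl
s-involutive zero    -[1+ zero ]    = refl
s-involutive zero    -[1+ suc k ]   = refl
s-involutive (suc a) (+ zero)       = refl
s-involutive (suc a) +[1+ k ]       = cong +[1+_] (swap-involutive a k)
s-involutive (suc a) -[1+ k ]       = cong -[1+_] (swap-involutive a k)

s-odd : ∀ a i → s-map a (ℤ.- i) ≡ ℤ.- s-map a i
s-odd zero    (+ zero)       = refl
s-odd zero    +[1+ zero ]    = refl
s-odd zero    +[1+ suc k ]   = refl
s-odd zero    -[1+ zero ]    = refl
s-odd zero    -[1+ suc k ]   = refl
s-odd (suc a) (+ zero)       = refl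
s-odd (suc a) +[1+ k ]       = refl
s-odd (suc a) -[1+ k ]       = refl

s-fixes : ∀ a i → suc a < ∣ i ∣ → s-map a i ≡ i
s-fixes zero    +[1+ suc k ] p = refl
s-fixes zero    -[1+ suc k ] p = refl
s-fixes zero    +[1+ zero ]  (s≤s ())
s-fixes zero    -[1+ zero ]  (s≤s ())
s-fixes (suc a) +[1+ k ] (s≤s p) = cong +[1+_] (swap-fixes a k p)
s-fixes (suc a) -[1+ k ] (s≤s p) = cong -[1+_] (swap-fixes a k p)

s : ℕ → BC∞
s a = record
  { perm    = mk↔ₛ′ (s-map a) (s-map a) (s-involutive a) (s-involutive a)
  ; odd     = s-odd a
  ; bounded = suc a , s-fixes a
  }

-- The list a₁ ∷ … ∷ a_l ∷ [] stands for the word s_{a₁} ⋯ s_{a_l}.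
Word : Set
Word = List ℕ

⟦_⟧ : Word → BC∞
⟦_⟧ = foldr (λ a w → s a · w) ι

_∈S_ : BC∞ → ℕ → Set
w ∈S n = ∃ λ a → All (λ i → 1 ≤ i × i < n) a × ⟦ a ⟧ ≋ w

HasLength : BC∞ → ℕ → Set
HasLength w l =
  (∃ λ a → ⟦ a ⟧ ≋ w × length a ≡ l) × (∀ a → ⟦ a ⟧ ≋ w → l ≤ length a)

infix 4 _∈R_
_∈R_ : Word → BC∞ → Set
a ∈R w = ⟦ a ⟧ ≋ w × HasLength w (length a)

-- p m is the power sum of exponent 2m + 1; the variables z_1, z_2, …
-- and x_1, x_2, … are z 0, z 1, … and x 0, x 1, …
data PZ : Set where
  p : ℕ → PZ
  z : ℕ → PZ

data XZ : Set where
  x : ℕ → XZ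
  z : ℕ → XZ

deg : PZ → ℕ
deg (p m) = suc (2 * m)
deg (z j) = 1

act : ℕ → Poly PZ → Poly PZ
act a = substitute (σ a)
  where
  σ : ℕ → PZ → Poly PZ
  σ zero    (p m)       = var (p m) ⊕ var (z 0) ^ᵖ suc (2 * m)
  σ zero    (z zero)    = ⊖ var (z 0)
  σ zero    (z (suc j)) = var (z (suc j))
  σ (suc a) (p m)       = var (p m)
  σ (suc a) (z j)       = var (z (swap a j))

denominator : ℕ → Poly PZ
denominator zero    = ⊖ (con (ℤ.+ 2 ℚ./ 1) ⊗ var (z 0))
denominator (suc a) = var (z a) ⊝ var (z (suc a))

-- ∂_a f = g, with the division cleared: the polynomial ring is a
-- domain, so this determines g.
∂[_]_≈_ : ℕ → Poly PZ → Poly PZ → Set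
∂[ a ] f ≈ g = g ⊗ denominator a ≈ f ⊝ act a f

Descent : BC∞ → ℕ → Set
Descent w a = ∃ λ l → ∃ λ m → HasLength (w · s a) l × HasLength w m × l < m

record IsSchubertFamily (ℭ : BC∞ → Poly PZ) : Set where
  field
    well-defined : ∀ {u v} → u ≋ v → ℭ u ≈ ℭ v
    homogeneous  : ∀ w → ∃ λ d → Homogeneous deg d (ℭ w)
    identity     : ℭ ι ≈ con 1ℚ
    descent      : ∀ w a → Descent w a → ∂[ a ] ℭ w ≈ ℭ (w · s a)
    non-descent  : ∀ w a → ¬ Descent w a → ∂[ a ] ℭ w ≈ con 0ℚ

truncate : ℕ → Poly PZ → Poly XZ
truncate k = substitute λ where
  (p m) → ∑ (map (λ i → var (x i) ^ᵖ suc (2 * m)) (upTo k))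
  (z j) → var (z j)

-- A monomial in variables numbered from 0 is the list of the numbers
-- of its factors, up to permutation.
Monomial : Set
Monomial = List ℕ

-- Positions are counted from 1: Peak a i means i ∈ P(a), and Flat j i
-- means j_{i-1} = j_i = j_{i+1}.
data Peak : Word → ℕ → Set where
  here  : ∀ {a b c as} → a < b → b > c → Peak (a ∷ b ∷ c ∷ as) 2
  there : ∀ {a as i} → Peak as i → Peak (a ∷ as) (suc i)

data Flat : List ℕ → ℕ → Set where
  here  : ∀ {j js} → Flat (j ∷ j ∷ j ∷ js) 2
  there : ∀ {j js i} → Flat js i → Flat (j ∷ js) (suc i)

xAdmissible : Word → List ℕ → Set
xAdmissible a js =
  length js ≡ length a ×
  Linked (λ j j′ → j′ ≤ j) js ×
  (∀ i → Flat js i → ¬ Peak a i)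

-- The numbering of variables from 0 turns the condition j_i ≤ a_i into
-- j_i < a_i.
zAdmissible : Word → List ℕ → Set
zAdmissible b js =
  Pointwise _<_ js b ×
  Linked _≤_ js ×
  Linked (λ (j , a) (j′ , a′) → j ≡ j′ → a > a′) (zip js b)

_∈𝒜x_ : Monomial → Word → Set
α ∈𝒜x a = ∃ λ js → xAdmissible a js × α ↭ js

_∈𝒜z_ : Monomial → Word → Set
β ∈𝒜z b = ∃ λ js → zAdmissible b js × β ↭ js

x^ z^ : Monomial → Poly XZ
x^ α = ∏ (map (λ i → var (x i)) α)
z^ β = ∏ (map (λ j → var (z j)) β)

#variables : Monomial → ℕ
#variables α = length (deduplicate _≟_ α)

AdmissibleSum : ℕ → ℕ → BC∞ → Poly XZ → Set
AdmissibleSum n k w =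
  SumsTo (×-setoid BC-setoid BC-setoid)
    (λ (u , v) → u · v ≋ w
      × (∃ λ l → ∃ λ m → HasLength u l × HasLength v m × HasLength w (l + m))
      × v ∈S n)
    λ (u , v) →
  SumsTo (×-setoid (setoid Word) (↭-setoid {A = ℕ}))
    (λ (a , α) → a ∈R u × α ∈𝒜x a × All (_< k) α)
    λ (a , α) →
  SumsTo (×-setoid (setoid Word) (↭-setoid {A = ℕ}))
    (λ (b , β) → b ∈R v × β ∈𝒜z b)
    λ (b , β) → con (ℤ.+ 2 ℚ./ 1) ^ᵖ #variables α ⊗ x^ α ⊗ z^ β ≈_

-- Rows and columns of the staircase block and the Γ-blocks are numbered
-- from 0; a box of a Γ-block is given by the block and the index.
data Box : Set where
  staircase  : (row column : ℕ) → Box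
  horizontal : (block index : ℕ) → Box
  vertical   : (block index : ℕ) → Box

letter : Box → ℕ
letter (staircase i j)  = suc (i + j)
letter (horizontal _ i) = i
letter (vertical _ i)   = i

variableOf : Box → XZ
variableOf (staircase i _)  = z i
variableOf (horizontal m _) = x m
variableOf (vertical m _)   = x m

-- The order of the list is the reading order, so a filling, being an
-- `All Tile` over it, is traversed in the order defining its word.
base : ℕ → ℕ → List Box
base n k = concatMap Γ-block (downFrom k) ++ concatMap row (upTo (n ∸ 1))
  where
  Γ-block : ℕ → List Box
  Γ-block m = map (horizontal m) (downFrom n) ++ map (vertical m) (upTo n)
  row : ℕ → List Box
  row i = map (staircase i) (downFrom (n ∸ 1 ∸ i))

data SpecialTile : Set where
  singleElbow faucetElbow : SpecialTile

data OrdinaryTile : Set where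
  doubleElbow cross : OrdinaryTile

Tile : Box → Set
Tile (staircase _ _)        = OrdinaryTile
Tile (horizontal _ zero)    = SpecialTile
Tile (horizontal _ (suc _)) = OrdinaryTile
Tile (vertical _ zero)      = SpecialTile
Tile (vertical _ (suc _))   = OrdinaryTile

PipeDream : ℕ → ℕ → Set
PipeDream n k = All Tile (base n k)

data Significance : Set where
  significant insignificant : Significance

special : SpecialTile → Significance
special singleElbow = insignificant
special faucetElbow = significant

ordinary : OrdinaryTile → Significance
ordinary doubleElbow = insignificant
ordinary cross       = significant

significance : ∀ b → Tile b → Significance
significance (staircase _ _)        = ordinary
significance (horizontal _ zero)    = special
significance (horizontal _ (suc _)) = ordinary
significance (vertical _ zero)      = special
significance (vertical _ (suc _))   = ordinary

significantBoxes : ∀ {bs} → All Tile bs → List Box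
significantBoxes []                = []
significantBoxes (_∷_ {x = b} t D) with significance b t
... | significant   = b ∷ significantBoxes D
... | insignificant = significantBoxes D

word : ∀ {n k} → PipeDream n k → Word
word D = map letter (significantBoxes D)

monomial : ∀ {n k} → PipeDream n k → Poly XZ
monomial D = ∏ (map (λ b → var (variableOf b)) (significantBoxes D))

PipeDreamSum : ℕ → ℕ → BC∞ → Poly XZ → Set
PipeDreamSum n k w =
  SumsTo (setoid (PipeDream n k))
    (λ D → word {n} {k} D ∈R w)
    λ D → monomial {n} {k} D ≈_

{-# OPTIONS --safe #-}

-- Put C = ∑_w ℭ_w u_w, with coefficients ℭ_w and the generators u_a of the
-- nilCoxeter algebra of BC_n.  The defining divided difference equations
-- say that the simple reflection of index a ≥ 1 multiplies C on the right
-- by 1 + (z_{a+1} − z_a) u_a, and the one of index 0 by 1 + 2 z_1 u_0.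
-- The coefficients involve no z_j with j ≥ n, so z_n is a fresh variable y.
-- Moving y to position i ≥ 1 by simple reflections, where all the z_j with
-- j ≥ i vanish, multiplies C by the i-th row of the staircase block.
-- Moving y to position 1, changing its sign with s_0, which also adds y to
-- the variables of the power sums, and moving −y back multiplies C by a
-- Γ-block.  Hence C is its constant term times the product of the factors
-- 1 + (variable) u_(letter) over the boxes of the base, and homogeneity makes
-- the constant term 1.  Expanding the product gives the sum over pipe dreams.
--
-- Among reduced words, a Γ-block contributes those without a peak, each
-- nonempty one exactly twice and the empty one once, and a row of the
-- staircase the strictly decreasing ones; so the expansion over the base is
-- also the sum over admissible monomials.
module Submission where

open import Defs
open import Data.Nat.Base using (ℕ; _≥_)
open import Data.Product.Base using (∃; _×_)
open import Level using (0ℓ)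
open import Algebra.Bundles using (CommutativeRing)
import Algebra.Properties.Group as GroupProperties
import Algebra.Properties.Ring as RingProperties
import Algebra.Solver.Ring.NaturalCoefficients.Default as SemiringSolver
open import Data.Empty using (⊥-elim)
open import Data.Integer.Base as ℤ using (ℤ; -[1+_]; +[1+_]; ∣_∣; 0ℤ; +<+)
import Data.Integer.Properties as ℤ
open import Data.List.Base as List using (List; []; _∷_; _∷ʳ_; _++_; length; map; concatMap; foldl; filter; upTo; downFrom; applyUpTo; applyDownFrom; zip; replicate; deduplicate; cartesianProduct)
open import Data.List.Membership.Propositional using (_∈_; find)
open import Data.List.Membership.Propositional.Properties
import Data.List.Membership.Setoid as Membership
import Data.List.Membership.Setoid.Properties as MembershipP
import Data.List.Properties as List
open import Data.List.Relation.Binary.Permutation.Propositional using (_↭_; ↭-setoid; ↭⇒↭ₛ; ↭-sym)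
open import Data.List.Relation.Binary.Permutation.Propositional.Properties using (All-resp-↭)
open import Data.List.Relation.Binary.Pointwise as Pointwise using (Pointwise; []; _∷_)
open import Data.List.Relation.Unary.All as All using (All; []; _∷_)
import Data.List.Relation.Unary.All.Properties as All
open import Data.List.Relation.Unary.AllPairs as AllPairs using (AllPairs; []; _∷_)
import Data.List.Relation.Unary.AllPairs.Properties as AllPairs
open import Data.List.Relation.Unary.Any as Any using (Any; here; there)
import Data.List.Relation.Unary.Any.Properties as Any
open import Data.List.Relation.Unary.Linked as Linked using (Linked; []; [-]; _∷_)
import Data.List.Relation.Unary.Linked.Properties as Linked
open import Data.List.Relation.Unary.Sorted.TotalOrder.Properties using (↗↭↗⇒≋)
import Data.List.Relation.Unary.Unique.DecSetoid.Properties as UniqueDecSetoid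
open import Data.List.Relation.Unary.Unique.Propositional using (Unique)
import Data.List.Relation.Unary.Unique.Propositional.Properties as Unique
import Data.List.Relation.Unary.Unique.Setoid as UniqueSetoid
open import Data.List.Reverse using (Reverse; reverseView; []; _∶_∶ʳ_)
open import Data.Nat.Base as ℕ using (zero; suc; _+_; _*_; _∸_; _≤_; _<_; _>_; _⊔_; z≤n; s≤s)
import Data.Nat.Coprimality as Coprime
open import Data.Nat.ListAction using (sum)
import Data.Nat.Properties as ℕ
open import Data.Nat.Solver using (module +-*-Solver)
open import Data.Product.Base using (∃₂; _,_; proj₁; proj₂)
open import Data.Product.Relation.Binary.Pointwise.NonDependent using (×-setoid; ×-decSetoid)
open import Data.Rational.Base as ℚ using (ℚ; 0ℚ; 1ℚ; mkℚ)
import Data.Rational.Properties as ℚ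
open import Data.Sum.Base using (_⊎_; inj₁; inj₂)
open import Function.Base using (_∘_; case_of_; flip)
open import Function.Bundles using (_⇔_; mk⇔; Equivalence; Inverse)
open import Relation.Binary.Bundles using (Setoid; DecSetoid)
import Relation.Binary.Construct.Flip.EqAndOrd as Flip
open import Relation.Binary.Definitions using (tri<; tri≈; tri>)
open import Relation.Binary.PropositionalEquality using (_≡_; _≢_; _≗_; refl; sym; trans; cong; cong₂; subst; subst₂; setoid)
import Relation.Binary.Reasoning.Setoid as SetoidReasoning
open import Relation.Nullary using (Dec; yes; no; ¬_; ¬?; contradiction)
import Relation.Nullary.Decidable as Dec

-- Length, descents and reduced words

-- Homogeneity enters as follows. If `ℭ w` with w ≠ id had degree 0, it would be a constant, so for
-- a descent a its divided difference `ℭ (w · s a)` would vanish, and stripping a reduced word down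
-- to the identity would give 1 = 0. Hence the degree is positive and `ℭ w` vanishes at the origin.
-- Each stripped letter requires cancelling a denominator. Polynomials are terms modulo a
-- congruence, so the cancellation is carried out in ℚ, after evaluation at points where the linear
-- form is nonzero. The two boxes of index 0 in a Γ-block come from u_0^2 = 0: the factor 1 + 2 y
-- u_0 of a sign change is (1 + y u_0)^2. Length is defined as a minimum over all words; the count
-- of inversions, which a simple reflection changes by exactly one, makes it computable and descents
-- decidable. The common value of both sums is `reducedSum`, which does not mention ℭ, so the
-- combinatorial identity is proved without assuming that a Schubert family exists.

count : ∀ {P : Set} → Dec P → ℕ
count (yes _) = 1
count (no _)  = 0

count-yes : ∀ {P : Set} (P? : Dec P) → P → count P? ≡ 1
count-yes (yes _) _ = refl
count-yes (no ¬q) q = contradiction q ¬q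

count-no : ∀ {P : Set} (P? : Dec P) → ¬ P → count P? ≡ 0
count-no (yes q) ¬q = contradiction q ¬q
count-no (no _)  _  = refl

count-⇔ : ∀ {P Q : Set} (P? : Dec P) (Q? : Dec Q) → (P → Q) → (Q → P) → count P? ≡ count Q?
count-⇔ (yes q) Q? f g = sym (count-yes Q? (f q))
count-⇔ (no ¬q) Q? f g = sym (count-no Q? (¬q ∘ g))

-- A pair of positions carries two positive roots, the difference and the sum of the coordinates;
-- each summand tests one of them.
pairInversions : ℤ → ℤ → ℕ
pairInversions i j = count (j ℤ.<? i) + count (i ℤ.+ j ℤ.<? 0ℤ)

inversionsWith : ℤ → (ℕ → ℤ) → ℕ → ℕ
inversionsWith i f zero    = 0
inversionsWith i f (suc N) = pairInversions i (f 0) + inversionsWith i (f ∘ suc) N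

-- The number of positive roots of type C_N made negative by the signed
-- permutation with window f 0, …, f (N - 1).
inversions : (ℕ → ℤ) → ℕ → ℕ
inversions f zero    = 0
inversions f (suc N) = count (f 0 ℤ.<? 0ℤ) + inversionsWith (f 0) (f ∘ suc) N + inversions (f ∘ suc) N

inversionsWith-cong : ∀ i {f g} → f ≗ g → ∀ N → inversionsWith i f N ≡ inversionsWith i g N
inversionsWith-cong i f≗g zero    = refl
inversionsWith-cong i f≗g (suc N) =
  cong₂ _+_ (cong (pairInversions i) (f≗g 0)) (inversionsWith-cong i (f≗g ∘ suc) N)

inversions-cong : ∀ {f g} → f ≗ g → ∀ N → inversions f N ≡ inversions g N
inversions-cong f≗g zero = refl
inversions-cong {f} {g} f≗g (suc N) = cong₂ _+_
  (cong₂ _+_ (cong (λ i → count (i ℤ.<? 0ℤ)) (f≗g 0))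
    (trans (cong (λ i → inversionsWith i (f ∘ suc) N) (f≗g 0))
           (inversionsWith-cong (g 0) (f≗g ∘ suc) N)))
  (inversions-cong (f≗g ∘ suc) N)

inversionsWith-swap : ∀ i f a N → suc a < N → inversionsWith i (f ∘ swap a) N ≡ inversionsWith i f N
inversionsWith-swap i f zero    (suc (suc N)) _ =
  solve 3 (λ a b c → a :+ (b :+ c) := b :+ (a :+ c)) refl
    (pairInversions i (f 1)) (pairInversions i (f 0)) (inversionsWith i (f ∘ suc ∘ suc) N)
  where open +-*-Solver
inversionsWith-swap i f (suc a) (suc N) (s≤s q) =
  cong (_+_ (pairInversions i (f 0))) (inversionsWith-swap i (f ∘ suc) a N q)
inversionsWith-swap i f zero (suc zero) (s≤s ())

pairInversions-swap : ∀ {i j} → i ℤ.< j → pairInversions j i ≡ suc (pairInversions i j)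
pairInversions-swap {i} {j} i<j = cong₂ _+_
  (trans (count-yes (i ℤ.<? j) i<j) (cong suc (sym (count-no (j ℤ.<? i) (ℤ.<-asym i<j)))))
  (cong (λ e → count (e ℤ.<? 0ℤ)) (ℤ.+-comm j i))

-- The swap permutes all roots except the difference root of the two adjacent positions, and only
-- that one changes sign.
inversions-swap : ∀ f a N → suc a < N → f a ℤ.< f (suc a) →
                  inversions (f ∘ swap a) N ≡ suc (inversions f N)
inversions-swap f zero (suc (suc N)) _ f0<f1 =
  trans (cong (λ e → n₁ + (e + W₁) + (n₀ + W₀ + R)) (pairInversions-swap f0<f1))
    (solve 6 (λ n₁ n₀ e w₁ w₀ r → n₁ :+ (con 1 :+ e :+ w₁) :+ (n₀ :+ w₀ :+ r)
                := con 1 :+ (n₀ :+ (e :+ w₀) :+ (n₁ :+ w₁ :+ r))) refl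
      n₁ n₀ (pairInversions (f 0) (f 1)) W₁ W₀ R)
  where
  open +-*-Solver
  n₀ = count (f 0 ℤ.<? 0ℤ)
  n₁ = count (f 1 ℤ.<? 0ℤ)
  W₀ = inversionsWith (f 0) (f ∘ suc ∘ suc) N
  W₁ = inversionsWith (f 1) (f ∘ suc ∘ suc) N
  R  = inversions (f ∘ suc ∘ suc) N
inversions-swap f (suc a) (suc N) (s≤s q) fa<fa′ =
  trans (cong₂ (λ u v → count (f 0 ℤ.<? 0ℤ) + u + v)
          (inversionsWith-swap (f 0) (f ∘ suc) a N q)
          (inversions-swap (f ∘ suc) a N q fa<fa′))
        (ℕ.+-suc _ _)
inversions-swap f zero (suc zero) (s≤s ())

negateHead : (ℕ → ℤ) → ℕ → ℤ
negateHead f zero    = ℤ.- f 0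
negateHead f (suc k) = f (suc k)

-- Negating i exchanges the two summands.
pairInversions-neg : ∀ i j → pairInversions (ℤ.- i) j ≡ pairInversions i j
pairInversions-neg i j = trans (cong₂ _+_
    (count-⇔ (j ℤ.<? ℤ.- i) (i ℤ.+ j ℤ.<? 0ℤ)
      (λ j<-i → subst (i ℤ.+ j ℤ.<_) (ℤ.+-inverseʳ i) (ℤ.+-monoʳ-< i j<-i))
      (λ i+j<0 → cancel i (subst (i ℤ.+ j ℤ.<_) (sym (ℤ.+-inverseʳ i)) i+j<0)))
    (count-⇔ (ℤ.- i ℤ.+ j ℤ.<? 0ℤ) (j ℤ.<? i)
      (λ -i+j<0 → cancel (ℤ.- i) (subst (ℤ.- i ℤ.+ j ℤ.<_) (sym (ℤ.+-inverseˡ i)) -i+j<0))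
      (λ j<i → subst (ℤ.- i ℤ.+ j ℤ.<_) (ℤ.+-inverseˡ i) (ℤ.+-monoʳ-< (ℤ.- i) j<i))))
  (ℕ.+-comm (count (i ℤ.+ j ℤ.<? 0ℤ)) _)
  where
  cancel : ∀ i {j k} → i ℤ.+ j ℤ.< i ℤ.+ k → j ℤ.< k
  cancel i {j} {k} q with ℤ.<-cmp j k
  ... | tri< j<k _ _ = j<k
  ... | tri≈ _ refl _ = contradiction q (ℤ.<-irrefl refl)
  ... | tri> _ _ k<j = contradiction q (ℤ.<-asym (ℤ.+-monoʳ-< i k<j))

inversionsWith-neg : ∀ i f N → inversionsWith (ℤ.- i) f N ≡ inversionsWith i f N
inversionsWith-neg i f zero    = refl
inversionsWith-neg i f (suc N) = cong₂ _+_ (pairInversions-neg i (f 0)) (inversionsWith-neg i (f ∘ suc) N)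

-- The sum and the difference root of each pair containing the first position trade places, so only
-- the root of the first position alone changes sign.
inversions-negateHead : ∀ f N → 0 < N → f 0 ℤ.< 0ℤ → inversions f N ≡ suc (inversions (negateHead f) N)
inversions-negateHead f (suc N) _ f0<0 = cong (_+ inversions (f ∘ suc) N) (cong₂ _+_
  (trans (count-yes (f 0 ℤ.<? 0ℤ) f0<0)
    (cong suc (sym (count-no (ℤ.- f 0 ℤ.<? 0ℤ) (ℤ.<-asym (ℤ.neg-mono-< f0<0))))))
  (sym (inversionsWith-neg (f 0) (f ∘ suc) N)))

window : BC∞ → ℕ → ℤ
window w k = to w +[1+ k ]

-- The simple root of index a is sent to a negative root. This is the decidable form of `Descent`,
-- by `Desc⇒Descent` and `Descent⇒Desc`.
Desc : BC∞ → ℕ → Set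
Desc w zero    = window w 0 ℤ.< 0ℤ
Desc w (suc a) = window w (suc a) ℤ.< window w a

desc? : ∀ w a → Dec (Desc w a)
desc? w zero    = window w 0 ℤ.<? 0ℤ
desc? w (suc a) = window w (suc a) ℤ.<? window w a

to-injective : ∀ w {i j} → to w i ≡ to w j → i ≡ j
to-injective w {i} {j} e = trans (sym (inverseʳ i)) (trans (cong (BC∞.from w) e) (inverseʳ j))
  where inverseʳ = Inverse.strictlyInverseʳ (BC∞.perm w)

neg-fixed : ∀ {i} → i ≡ ℤ.- i → i ≡ 0ℤ
neg-fixed {ℤ.+ zero}   _ = refl
neg-fixed {+[1+ _ ]} ()
neg-fixed { -[1+ _ ]} ()

to-0 : ∀ w → to w 0ℤ ≡ 0ℤ
to-0 w = neg-fixed (BC∞.odd w 0ℤ)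

window-≢0 : ∀ w k → window w k ≢ 0ℤ
window-≢0 w k e with to-injective w (trans e (sym (to-0 w)))
... | ()

window-injective : ∀ w {j k} → window w j ≡ window w k → j ≡ k
window-injective w e = ℤ.+[1+-injective (to-injective w e)

swap-suc : ∀ a → swap a a ≡ suc a
swap-suc zero    = refl
swap-suc (suc a) = cong suc (swap-suc a)

swap-pred : ∀ a → swap a (suc a) ≡ a
swap-pred zero    = refl
swap-pred (suc a) = cong suc (swap-pred a)

·s-involutive : ∀ w a → (w · s a) · s a ≋ w
·s-involutive w a i = cong (to w) (s-involutive a i)

desc-·s : ∀ w a → Desc w a → ¬ Desc (w · s a) a
desc-·s w zero d d′ =
  ℤ.<-asym d (ℤ.neg-cancel-< (subst (ℤ._< 0ℤ) (BC∞.odd w +[1+ 0 ]) d′))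
desc-·s w (suc a) d d′
  rewrite swap-suc a | swap-pred a = ℤ.<-asym d d′

¬desc-·s : ∀ w a → ¬ Desc w a → Desc (w · s a) a
¬desc-·s w zero ¬d with ℤ.<-cmp (window w 0) 0ℤ
... | tri< d _ _ = contradiction d ¬d
... | tri≈ _ e _ = contradiction e (window-≢0 w 0)
... | tri> _ _ q = subst (ℤ._< 0ℤ) (sym (BC∞.odd w +[1+ 0 ])) (ℤ.neg-mono-< q)
¬desc-·s w (suc a) ¬d rewrite swap-suc a | swap-pred a with ℤ.<-cmp (window w (suc a)) (window w a)
... | tri< d _ _ = contradiction d ¬d
... | tri≈ _ e _ = contradiction (window-injective w e) (ℕ.1+n≢n)
... | tri> _ _ q = q

-- An element of the union of the groups has no preferred n, hence the cutoff `N`; by `reducedWord`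
-- every cutoff beyond the support gives the same number.
ℓ : ℕ → BC∞ → ℕ
ℓ N w = inversions (window w) N

ℓ-cong : ∀ N u v → u ≋ v → ℓ N u ≡ ℓ N v
ℓ-cong N u v u≋v = inversions-cong (λ k → u≋v _) N

ℓ-desc : ∀ {N a} → a < N → ∀ w → Desc w a → ℓ N w ≡ suc (ℓ N (w · s a))
ℓ-desc {N} {zero} a<N w d = trans (inversions-negateHead (window w) N a<N d)
  (cong suc (inversions-cong (λ { zero → sym (BC∞.odd w +[1+ 0 ]) ; (suc k) → refl }) N))
ℓ-desc {N} {suc a} a<N w d =
  trans (inversions-cong (λ k → cong (window w) (sym (swap-involutive a k))) N)
    (inversions-swap (window w ∘ swap a) a N a<N
      (subst₂ ℤ._<_ (cong (window w) (sym (swap-suc a))) (cong (window w) (sym (swap-pred a))) d))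

ℓ-asc : ∀ {N a} → a < N → ∀ w → ¬ Desc w a → ℓ N (w · s a) ≡ suc (ℓ N w)
ℓ-asc {N} {a} a<N w ¬d = trans (ℓ-desc a<N (w · s a) (¬desc-·s w a ¬d))
  (cong suc (ℓ-cong N ((w · s a) · s a) w (·s-involutive w a)))

ℓ-·s-≤ : ∀ {N a} → a < N → ∀ w → ℓ N (w · s a) ≤ suc (ℓ N w)
ℓ-·s-≤ {N} {a} a<N w with desc? w a
... | yes d = ℕ.≤-trans (ℕ.n≤1+n _) (ℕ.≤-trans (ℕ.≤-reflexive (sym (ℓ-desc a<N w d))) (ℕ.n≤1+n _))
... | no ¬d = ℕ.≤-reflexive (ℓ-asc a<N w ¬d)

ℓ-·⟦⟧-≤ : ∀ {N} c → All (_< N) c → ∀ w → ℓ N (w · ⟦ c ⟧) ≤ ℓ N w + length c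
ℓ-·⟦⟧-≤ {N} [] [] w = ℕ.≤-reflexive (sym (ℕ.+-identityʳ _))
ℓ-·⟦⟧-≤ {N} (a ∷ c) (a<N ∷ c<N) w = ℕ.≤-trans (ℓ-·⟦⟧-≤ c c<N (w · s a))
  (ℕ.≤-trans (ℕ.+-monoˡ-≤ (length c) (ℓ-·s-≤ a<N w)) (ℕ.≤-reflexive (sym (ℕ.+-suc _ _))))

inversionsWith-positive : ∀ N k m → k ≤ m → inversionsWith +[1+ k ] (λ j → +[1+ suc (m + j) ]) N ≡ 0
inversionsWith-positive zero k m _ = refl
inversionsWith-positive (suc N) k m k≤m = cong₂ _+_
  (cong₂ _+_ (count-no (+[1+ suc (m + 0) ] ℤ.<? +[1+ k ]) λ { (+<+ (s≤s q)) → ℕ.<⇒≱ q (ℕ.≤-trans k≤m (ℕ.≤-trans (ℕ.m≤m+n m 0) (ℕ.n≤1+n _))) })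
    (count-no (+[1+ k ] ℤ.+ +[1+ suc (m + 0) ] ℤ.<? 0ℤ) λ { (+<+ ()) }))
  (trans (inversionsWith-cong +[1+ k ] (λ j → cong (λ e → +[1+ suc e ]) (ℕ.+-suc m j)) N)
    (inversionsWith-positive N k (suc m) (ℕ.m≤n⇒m≤1+n k≤m)))

inversions-id : ∀ N m → inversions (λ k → +[1+ m + k ]) N ≡ 0
inversions-id zero m = refl
inversions-id (suc N) m = cong₂ _+_
  (cong₂ _+_ (count-no (+[1+ m + 0 ] ℤ.<? 0ℤ) λ { (+<+ ()) })
    (trans (inversionsWith-cong +[1+ m + 0 ] (λ j → cong +[1+_] (ℕ.+-suc m j)) N)
      (inversionsWith-positive N (m + 0) m (ℕ.≤-reflexive (ℕ.+-identityʳ m)))))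
  (trans (inversions-cong (λ j → cong +[1+_] (ℕ.+-suc m j)) N) (inversions-id N (suc m)))

ℓ-ι : ∀ N → ℓ N ι ≡ 0
ℓ-ι N = inversions-id N 0

ℓ-⟦⟧-≤ : ∀ {N} c → All (_< N) c → ℓ N ⟦ c ⟧ ≤ length c
ℓ-⟦⟧-≤ {N} c c<N = subst (λ e → ℓ N ⟦ c ⟧ ≤ e + length c) (ℓ-ι N) (ℓ-·⟦⟧-≤ c c<N ι)

-- A point moved beyond the support of w would be fixed by w.
window-bound : ∀ {n w} → w ∈BC n → ∀ {k} → k < n → ∣ window w k ∣ ≤ n
window-bound {n} {w} w∈ {k} k<n with ∣ window w k ∣ ℕ.≤? n
... | yes q = q
... | no ¬q = contradiction (subst (λ i → n < ∣ i ∣) (to-injective w (w∈ _ (ℕ.≰⇒> ¬q))) (ℕ.≰⇒> ¬q))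
                            (ℕ.≤⇒≯ k<n)

-- Beyond n the window is the identity, and the entries before are at most n in absolute value, so
-- no descent straddles n or lies beyond it.
desc⇒< : ∀ {n w a} → w ∈BC n → n ≥ 1 → Desc w a → a < n
desc⇒< {n} {w} {zero} w∈ n≥1 d = n≥1
desc⇒< {n} {w} {suc a} w∈ n≥1 d with suc a ℕ.<? n
... | yes q = q
... | no ¬q = contradiction d (ℤ.≤⇒≯ (subst (window w a ℤ.≤_) (sym (w∈ _ (s≤s (ℕ.≮⇒≥ ¬q)))) bound))
  where
  ∣≤∣⇒≤ : ∀ i {m} → ∣ i ∣ ≤ m → i ℤ.≤ ℤ.+ m
  ∣≤∣⇒≤ (ℤ.+ _)  q = ℤ.+≤+ q
  ∣≤∣⇒≤ -[1+ _ ] q = ℤ.-≤+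
  bound : window w a ℤ.≤ +[1+ suc a ]
  bound with a ℕ.<? n
  ... | yes a<n = ∣≤∣⇒≤ (window w a) (ℕ.≤-trans (window-bound {w = w} w∈ a<n) (ℕ.m≤n⇒m≤1+n (ℕ.≮⇒≥ ¬q)))
  ... | no a≮n  = subst (ℤ._≤ _) (sym (w∈ _ (s≤s (ℕ.≮⇒≥ a≮n)))) (ℤ.+≤+ (s≤s (ℕ.n≤1+n a)))

∈BC-mono : ∀ {m n w} → m ≤ n → w ∈BC m → w ∈BC n
∈BC-mono m≤n w∈ i q = w∈ i (ℕ.≤-<-trans m≤n q)

∈BC-·s : ∀ {n w a} → w ∈BC n → a < n → (w · s a) ∈BC n
∈BC-·s {w = w} {a} w∈ a<n i q = trans (cong (to w) (s-fixes a i (ℕ.≤-<-trans a<n q))) (w∈ i q)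

module _ (w : BC∞) (¬d : ∀ a → ¬ Desc w a) where

  private
    increasing : ∀ a → window w a ℤ.< window w (suc a)
    increasing a with ℤ.<-cmp (window w (suc a)) (window w a)
    ... | tri< d _ _ = contradiction d (¬d (suc a))
    ... | tri≈ _ e _ = contradiction (window-injective w e) ℕ.1+n≢n
    ... | tri> _ _ q = q

    positive : 0ℤ ℤ.< window w 0
    positive with ℤ.<-cmp (window w 0) 0ℤ
    ... | tri< d _ _ = contradiction d (¬d 0)
    ... | tri≈ _ e _ = contradiction e (window-≢0 w 0)
    ... | tri> _ _ q = q

    lower : ∀ k → +[1+ k ] ℤ.≤ window w k
    lower zero    = ℤ.i<j⇒suc[i]≤j positive
    lower (suc k) = ℤ.≤-trans (ℤ.suc-mono (lower k)) (ℤ.i<j⇒suc[i]≤j (increasing k))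

    upper : ∀ j k → proj₁ (BC∞.bounded w) ≤ k + j → window w k ℤ.≤ +[1+ k ]
    upper zero    k q = ℤ.≤-reflexive
      (proj₂ (BC∞.bounded w) _ (s≤s (subst (proj₁ (BC∞.bounded w) ≤_) (ℕ.+-identityʳ k) q)))
    upper (suc j) k q = suc-cancel (ℤ.≤-trans (ℤ.i<j⇒suc[i]≤j (increasing k))
      (upper j (suc k) (subst (proj₁ (BC∞.bounded w) ≤_) (ℕ.+-suc k j) q)))
      where
      suc-cancel : ∀ {i j} → ℤ.suc i ℤ.≤ ℤ.suc j → i ℤ.≤ j
      suc-cancel {i} {j} r = subst₂ ℤ._≤_ (ℤ.pred-suc i) (ℤ.pred-suc j) (ℤ.pred-mono r)

    window-id : ∀ k → window w k ≡ +[1+ k ]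
    window-id k = ℤ.≤-antisym (upper _ k (ℕ.m≤n+m _ k)) (lower k)

  -- The window starts positive and increases strictly, which bounds each entry from below by its
  -- position. Beyond the support this is an equality, and descending from there gives the upper
  -- bound.
  ¬desc⇒ι : w ≋ ι
  ¬desc⇒ι (ℤ.+ zero)   = to-0 w
  ¬desc⇒ι +[1+ k ]     = window-id k
  ¬desc⇒ι -[1+ k ]     = trans (BC∞.odd w +[1+ k ]) (cong ℤ.-_ (window-id k))

⟦⟧-++ : ∀ a b → ⟦ a ++ b ⟧ ≋ ⟦ a ⟧ · ⟦ b ⟧
⟦⟧-++ []      b i = refl
⟦⟧-++ (e ∷ a) b i = cong (to (s e)) (⟦⟧-++ a b i)

-- Bounding the letters by N makes the length ℓ M w independent of M ≥ N.
reducedWord : ∀ {N} → N ≥ 1 → ∀ l w → w ∈BC N → ℓ N w ≡ l →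
              ∃ λ c → ⟦ c ⟧ ≋ w × All (_< N) c × length c ≡ l × (∀ {M} → N ≤ M → ℓ M w ≡ l)
reducedWord {N} N≥1 l w w∈ ℓ≡l with ℕ.anyUpTo? (desc? w) N
reducedWord {N} N≥1 l w w∈ ℓ≡l | no ¬d = [] , (λ i → sym (w≋ι i)) , [] , 0≡l , λ {M} _ → trans (trans (ℓ-cong M w ι w≋ι) (ℓ-ι M)) 0≡l
  where
  w≋ι : w ≋ ι
  w≋ι = ¬desc⇒ι w λ a d → ¬d (a , desc⇒< {w = w} w∈ N≥1 d , d)
  0≡l : 0 ≡ l
  0≡l = trans (sym (trans (ℓ-cong N w ι w≋ι) (ℓ-ι N))) ℓ≡l
reducedWord {N} N≥1 zero w w∈ ℓ≡l | yes (a , a<N , d) = case trans (sym (ℓ-desc a<N w d)) ℓ≡l of λ ()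
reducedWord {N} N≥1 (suc l) w w∈ ℓ≡l | yes (a , a<N , d)
  with c , c≋ , c<N , ∣c∣ , ℓM ← reducedWord N≥1 l (w · s a) (∈BC-·s {w = w} w∈ a<N)
         (ℕ.suc-injective (trans (sym (ℓ-desc a<N w d)) ℓ≡l))
  = c ∷ʳ a
  , (λ i → trans (⟦⟧-++ c (a ∷ []) i) (trans (c≋ (s-map a i)) (·s-involutive w a i)))
  , All.++⁺ c<N (a<N ∷ [])
  , trans (List.length-++ c) (trans (ℕ.+-comm _ 1) (cong suc ∣c∣))
  , λ N≤M → trans (ℓ-desc (ℕ.<-≤-trans a<N N≤M) w d) (cong suc (ℓM N≤M))

bound : Word → ℕ
bound []      = 1
bound (a ∷ c) = suc a ⊔ bound c

<bound : ∀ c → All (_< bound c) c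
<bound []      = []
<bound (a ∷ c) = ℕ.m≤m⊔n (suc a) (bound c) ∷ All.map (λ q → ℕ.≤-trans q (ℕ.m≤n⊔m (suc a) (bound c))) (<bound c)

hasLength : ∀ {N} → N ≥ 1 → ∀ w → w ∈BC N → HasLength w (ℓ N w)
hasLength {N} N≥1 w w∈ with c , c≋ , c<N , ∣c∣ , ℓM ← reducedWord N≥1 (ℓ N w) w w∈ refl =
  (c , c≋ , ∣c∣) , λ b b≋ →
    -- The competing word may use letters beyond N, so inversions are counted up to a cutoff that
    -- covers them too.
    let M = N ⊔ bound b in
    ℕ.≤-trans (ℕ.≤-reflexive (trans (sym (ℓM (ℕ.m≤m⊔n N (bound b)))) (ℓ-cong M w ⟦ b ⟧ (λ i → sym (b≋ i)))))
      (ℓ-⟦⟧-≤ b (All.map (λ q → ℕ.≤-trans q (ℕ.m≤n⊔m N (bound b))) (<bound b)))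

HasLength-unique : ∀ {w l m} → HasLength w l → HasLength w m → l ≡ m
HasLength-unique ((a , a≋ , ∣a∣) , l≤) ((b , b≋ , ∣b∣) , m≤) =
  ℕ.≤-antisym (subst (_ ≤_) ∣b∣ (l≤ b b≋)) (subst (_ ≤_) ∣a∣ (m≤ a a≋))

HasLength-resp : ∀ {u v l} → u ≋ v → HasLength u l → HasLength v l
HasLength-resp u≋v ((a , a≋ , ∣a∣) , l≤) =
  (a , (λ i → trans (a≋ i) (u≋v i)) , ∣a∣) , λ b b≋ → l≤ b (λ i → trans (b≋ i) (sym (u≋v i)))

-- The successor makes the cutoff positive, as `hasLength` requires.
support : BC∞ → ℕ
support w = suc (proj₁ (BC∞.bounded w))

∈BC-support : ∀ w → w ∈BC support w
∈BC-support w = ∈BC-mono {w = w} (ℕ.n≤1+n _) (proj₂ (BC∞.bounded w))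

∣_∣ₗ : BC∞ → ℕ
∣ w ∣ₗ = ℓ (support w) w

hasLength-∣∣ : ∀ w → HasLength w ∣ w ∣ₗ
hasLength-∣∣ w = hasLength (s≤s z≤n) w (∈BC-support w)

module _ (w : BC∞) (a : ℕ) where
  private
    N = support w ⊔ suc a
    N≥1 : N ≥ 1
    N≥1 = ℕ.≤-trans (s≤s z≤n) (ℕ.m≤m⊔n (support w) (suc a))
    w∈ : w ∈BC N
    w∈ = ∈BC-mono {w = w} (ℕ.m≤m⊔n (support w) (suc a)) (∈BC-support w)
    a<N : a < N
    a<N = ℕ.m≤n⊔m (support w) (suc a)
    lengths : ∀ {l m} → HasLength (w · s a) l → HasLength w m → ℓ N (w · s a) ≡ l × ℓ N w ≡ m
    lengths hl hm =
      HasLength-unique {w · s a} (hasLength N≥1 (w · s a) (∈BC-·s {w = w} w∈ a<N)) hl ,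
      HasLength-unique {w} (hasLength N≥1 w w∈) hm

  HasLength-desc : ∀ {l m} → Desc w a → HasLength (w · s a) l → HasLength w m → m ≡ suc l
  HasLength-desc d hl hm with e₁ , e₂ ← lengths hl hm =
    trans (sym e₂) (trans (ℓ-desc a<N w d) (cong suc e₁))

  HasLength-asc : ∀ {l m} → ¬ Desc w a → HasLength (w · s a) l → HasLength w m → l ≡ suc m
  HasLength-asc ¬d hl hm with e₁ , e₂ ← lengths hl hm =
    trans (sym e₁) (trans (ℓ-asc a<N w ¬d) (cong suc e₂))

  Desc⇒Descent : Desc w a → Descent w a
  Desc⇒Descent d = _ , _ , hasLength-∣∣ (w · s a) , hasLength-∣∣ w ,
    ℕ.≤-reflexive (sym (HasLength-desc d (hasLength-∣∣ (w · s a)) (hasLength-∣∣ w)))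

  Descent⇒Desc : Descent w a → Desc w a
  Descent⇒Desc (l , m , hl , hm , l<m) with desc? w a
  ... | yes d = d
  ... | no ¬d = contradiction (subst (m ≤_) (sym (HasLength-asc ¬d hl hm)) (ℕ.n≤1+n m)) (ℕ.<⇒≱ l<m)

  private
    ⟦∷ʳ⟧ : ∀ c → ⟦ c ∷ʳ a ⟧ ≋ ⟦ c ⟧ · s a
    ⟦∷ʳ⟧ c = ⟦⟧-++ c (a ∷ [])
    length-∷ʳ : ∀ (c : Word) → length (c ∷ʳ a) ≡ suc (length c)
    length-∷ʳ c = trans (List.length-++ c) (ℕ.+-comm _ 1)

  ∈R-∷ʳ⁺ : ∀ c → Desc w a → c ∈R (w · s a) → (c ∷ʳ a) ∈R w
  ∈R-∷ʳ⁺ c d (c≋ , hl) =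
    (λ i → trans (⟦∷ʳ⟧ c i) (trans (c≋ (s-map a i)) (·s-involutive w a i))) ,
    subst (HasLength w) (trans (HasLength-desc d hl (hasLength-∣∣ w)) (sym (length-∷ʳ c))) (hasLength-∣∣ w)

  -- If a were no descent, w s_a would be longer than w, although `c` is a word for it shorter than
  -- a reduced word of w. With `∈R-∷ʳ⁺` this is the recursion on last letters that the operators `T`
  -- reproduce.
  ∈R-∷ʳ⁻ : ∀ c → (c ∷ʳ a) ∈R w → Desc w a × c ∈R (w · s a)
  ∈R-∷ʳ⁻ c (ca≋ , hl) = d , c≋ ,
    subst (HasLength (w · s a))
      (ℕ.suc-injective (trans (sym (HasLength-desc d (hasLength-∣∣ (w · s a)) hl)) (length-∷ʳ c)))
      (hasLength-∣∣ (w · s a))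
    where
    c≋ : ⟦ c ⟧ ≋ w · s a
    c≋ i = trans (sym (trans (⟦∷ʳ⟧ c (s-map a i)) (·s-involutive ⟦ c ⟧ a i))) (ca≋ (s-map a i))
    d : Desc w a
    d with desc? w a
    ... | yes d = d
    ... | no ¬d = contradiction
      (subst (_≤ length c) (trans (HasLength-asc ¬d (hasLength-∣∣ (w · s a)) hl) (cong suc (length-∷ʳ c)))
        (proj₂ (hasLength-∣∣ (w · s a)) c c≋))
      (ℕ.<⇒≱ (ℕ.m≤n⇒m≤1+n ℕ.≤-refl))

∈R-letters : ∀ {n w} → n ≥ 1 → w ∈BC n → ∀ {c} → c ∈R w → All (_< n) c
∈R-letters {n} {w} n≥1 w∈ {c} = go {c} {w} (reverseView c) w∈
  where
  go : ∀ {c w} → Reverse c → w ∈BC n → c ∈R w → All (_< n) c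
  go [] w∈ c∈ = []
  go {w = w} (c ∶ rc ∶ʳ a) w∈ c∈ with d , c∈′ ← ∈R-∷ʳ⁻ w a c c∈ =
    All.++⁺ (go {c} {w · s a} rc (∈BC-·s {w = w} w∈ (desc⇒< {w = w} w∈ n≥1 d)) c∈′)
      (desc⇒< {w = w} w∈ n≥1 d ∷ [])

infix 4 _≋?_ _∈R?_

_≋?_ : ∀ u v → Dec (u ≋ v)
u ≋? v with ℕ.allUpTo? (λ k → window u k ℤ.≟ window v k) (support u ⊔ support v)
... | no ¬e = no λ u≋v → ¬e λ _ → u≋v _
... | yes e = yes λ { (ℤ.+ zero) → trans (to-0 u) (sym (to-0 v))
                    ; +[1+ k ]   → go k
                    ; -[1+ k ]   → trans (BC∞.odd u +[1+ k ]) (trans (cong ℤ.-_ (go k)) (sym (BC∞.odd v +[1+ k ]))) }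
  where
  go : ∀ k → window u k ≡ window v k
  go k with k ℕ.<? support u ⊔ support v
  ... | yes q = e q
  ... | no ¬q = trans (∈BC-support u _ (s≤s (ℕ.m⊔n≤o⇒m≤o (support u) (support v) (ℕ.≮⇒≥ ¬q))))
    (sym (∈BC-support v _ (s≤s (ℕ.m⊔n≤o⇒n≤o (support u) (support v) (ℕ.≮⇒≥ ¬q)))))

_∈R?_ : ∀ c w → Dec (c ∈R w)
c ∈R? w = Dec.map′ (λ (c≋ , e) → c≋ , subst (HasLength w) e (hasLength-∣∣ w))
                   (λ (c≋ , hl) → c≋ , HasLength-unique {w} (hasLength-∣∣ w) hl)
                   ((⟦ c ⟧ ≋? w) Dec.×-dec (∣ w ∣ₗ ℕ.≟ length c))

module _ {a b : Word} {w : BC∞} (ab∈ : (a ++ b) ∈R w) where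

  private
    minimal : ∀ c d → ⟦ c ⟧ · ⟦ d ⟧ ≋ ⟦ a ⟧ · ⟦ b ⟧ → length a + length b ≤ length c + length d
    minimal c d e = subst₂ _≤_ (List.length-++ a {b}) (List.length-++ c {d})
      (proj₂ (proj₂ ab∈) (c ++ d) λ i → trans (⟦⟧-++ c d i) (trans (e i)
        (trans (sym (⟦⟧-++ a b i)) (proj₁ ab∈ i))))

  -- A shorter word for this factor, followed by `b`, would be a shorter word for w.
  prefix-∈R : a ∈R ⟦ a ⟧
  prefix-∈R = (λ i → refl) , (a , (λ i → refl) , refl) ,
    λ c c≋ → ℕ.+-cancelʳ-≤ (length b) _ _ (minimal c b (λ i → c≋ (to ⟦ b ⟧ i)))

  suffix-∈R : b ∈R ⟦ b ⟧
  suffix-∈R = (λ i → refl) , (b , (λ i → refl) , refl) ,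
    λ c c≋ → ℕ.+-cancelˡ-≤ (length a) _ _ (minimal a c (λ i → cong (to ⟦ a ⟧) (c≋ i)))

stutter-∉R : ∀ a i b {w} → ¬ (a ++ i ∷ i ∷ b) ∈R w
stutter-∉R a i b {w} (e , _ , l≤) = ℕ.<⇒≱
  (subst₂ _<_ (sym (List.length-++ a {b})) (sym (List.length-++ a {i ∷ i ∷ b}))
    (ℕ.+-monoʳ-< (length a) (s≤s (ℕ.n≤1+n _))))
  (l≤ (a ++ b) λ k → trans (⟦⟧-++ a b k)
    (trans (cong (to ⟦ a ⟧) (sym (s-involutive i (to ⟦ b ⟧ k)))) (trans (sym (⟦⟧-++ a (i ∷ i ∷ b) k)) (e k))))

-- Membership in S_n provides some word without s_0, but every reduced word must be shown to avoid
-- it. Positivity of the window excludes 0 as last letter and survives removal of any other last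
-- letter.
PreservesSigns : BC∞ → Set
PreservesSigns w = ∀ k → 0ℤ ℤ.< window w k

⟦⟧-preservesSigns : ∀ {b} → All (1 ≤_) b → PreservesSigns ⟦ b ⟧
⟦⟧-preservesSigns [] k = +<+ (s≤s z≤n)
⟦⟧-preservesSigns {suc a ∷ b} (_ ∷ b≥1) k with window ⟦ b ⟧ k | ⟦⟧-preservesSigns b≥1 k
... | +[1+ _ ] | _ = +<+ (s≤s z≤n)
... | ℤ.+ zero | +<+ ()

∈R-letters≥1 : ∀ {w} → PreservesSigns w → ∀ {b} → b ∈R w → All (1 ≤_) b
∈R-letters≥1 {w} w⁺ {b} = go {b} {w} (reverseView b) w⁺
  where
  go : ∀ {b w} → Reverse b → PreservesSigns w → b ∈R w → All (1 ≤_) b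
  go [] w⁺ b∈ = []
  go {w = w} (b ∶ rb ∶ʳ zero) w⁺ b∈ = contradiction (proj₁ (∈R-∷ʳ⁻ w zero b b∈)) (ℤ.<-asym (w⁺ 0))
  go {w = w} (b ∶ rb ∶ʳ suc a) w⁺ b∈ =
    All.++⁺ (go {b} {w · s (suc a)} rb (λ k → w⁺ (swap a k)) (proj₂ (∈R-∷ʳ⁻ w (suc a) b b∈))) (s≤s z≤n ∷ [])

∈S⇒PreservesSigns : ∀ {v n} → v ∈S n → PreservesSigns v
∈S⇒PreservesSigns (a , a∈ , a≋) k = subst (0ℤ ℤ.<_) (a≋ _) (⟦⟧-preservesSigns (All.map proj₁ a∈) k)

⟦⟧-∈BC : ∀ {n c} → All (_< n) c → ⟦ c ⟧ ∈BC n
⟦⟧-∈BC [] i q = refl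
⟦⟧-∈BC {c = a ∷ c} (a<n ∷ c<n) i q =
  trans (cong (s-map a) (⟦⟧-∈BC c<n i q)) (s-fixes a i (ℕ.≤-<-trans a<n q))

∈BC-resp : ∀ {n u v} → u ≋ v → u ∈BC n → v ∈BC n
∈BC-resp u≋v u∈ i q = trans (sym (u≋v i)) (u∈ i q)

∈R-resp : ∀ {u v c} → u ≋ v → c ∈R u → c ∈R v
∈R-resp {u} {v} u≋v (c≋ , hl) = (λ i → trans (c≋ i) (u≋v i)) , HasLength-resp {u} {v} u≋v hl

reducedWordOf : ∀ w → ∃ λ c → c ∈R w
reducedWordOf w with (c , c≋ , ∣c∣) , _ ← hasLength-∣∣ w = c , c≋ , subst (HasLength w) (sym ∣c∣) (hasLength-∣∣ w)

-- A word a ++ b reduced for w is the same as a length-additive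
-- factorization w = u v with reduced words for both factors.
∈R-++⁺ : ∀ {u v w l m a b} → u · v ≋ w → HasLength u l → HasLength v m → HasLength w (l + m) →
         a ∈R u → b ∈R v → (a ++ b) ∈R w
∈R-++⁺ {u} {v} {w} {l} {m} {a} {b} uv≋w hu hv hw (a≋ , ha) (b≋ , hb) =
  (λ i → trans (⟦⟧-++ a b i) (trans (a≋ _) (trans (cong (to u) (b≋ i)) (uv≋w i)))) ,
  subst (HasLength w) (trans (cong₂ _+_ (HasLength-unique {u} hu ha) (HasLength-unique {v} hv hb)) (sym (List.length-++ a {b}))) hw

-- Sums over subsets of boxes

module _ {V : Set} where
  module Ring = CommutativeRing (polyRing V)
  module RingP = RingProperties Ring.ring
  module Solver = SemiringSolver Ring.commutativeSemiring
  module ≈-Reasoning = SetoidReasoning Ring.setoid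
open ≈-Reasoning

≡⇒≈ : ∀ {V} {f g : Poly V} → f ≡ g → f ≈ g
≡⇒≈ refl = ≈-refl

gate : ∀ {V} {P : Set} → Dec P → Poly V → Poly V
gate (yes _) f = f
gate (no _)  f = con 0ℚ

module _ {V : Set} where

  gate-yes : ∀ {P : Set} (P? : Dec P) {f : Poly V} → P → gate P? f ≈ f
  gate-yes (yes _) _ = ≈-refl
  gate-yes (no ¬q) q = contradiction q ¬q

  gate-no : ∀ {P : Set} (P? : Dec P) {f : Poly V} → ¬ P → gate P? f ≈ con 0ℚ
  gate-no (yes q) ¬q = contradiction q ¬q
  gate-no (no _)  _  = ≈-refl

  gate-cong : ∀ {P : Set} (P? : Dec P) {f g : Poly V} → (P → f ≈ g) → gate P? f ≈ gate P? g
  gate-cong (yes q) f≈g = f≈g q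
  gate-cong (no _)  _   = ≈-refl

  gate-⇔ : ∀ {P Q : Set} (P? : Dec P) (Q? : Dec Q) {f : Poly V} → (P → Q) → (Q → P) → gate P? f ≈ gate Q? f
  gate-⇔ (yes q) Q? to _ = ≈-sym (gate-yes Q? (to q))
  gate-⇔ (no ¬q) Q? _ from = ≈-sym (gate-no Q? (¬q ∘ from))

  gate-⊗ : ∀ {P : Set} (P? : Dec P) (f g : Poly V) → f ⊗ gate P? g ≈ gate P? (f ⊗ g)
  gate-⊗ (yes _) f g = ≈-refl
  gate-⊗ (no _)  f g = Ring.zeroʳ f

  sumOver : ∀ {A : Set} → List A → (A → Poly V) → Poly V
  sumOver xs f = ∑ (map f xs)

  module _ {A : Set} where

    sumOver-cong-All : ∀ {xs : List A} {f g} → All (λ a → f a ≈ g a) xs → sumOver xs f ≈ sumOver xs g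
    sumOver-cong-All []         = ≈-refl
    sumOver-cong-All (eq ∷ eqs) = ⊕-cong eq (sumOver-cong-All eqs)

    sumOver-cong : ∀ (xs : List A) {f g} → (∀ a → f a ≈ g a) → sumOver xs f ≈ sumOver xs g
    sumOver-cong xs eq = sumOver-cong-All (All.universal eq xs)

    sumOver-++ : ∀ (xs ys : List A) f → sumOver (xs ++ ys) f ≈ sumOver xs f ⊕ sumOver ys f
    sumOver-++ []       ys f = ≈-sym (⊕-idˡ _)
    sumOver-++ (a ∷ xs) ys f = ≈-trans (⊕-cong ≈-refl (sumOver-++ xs ys f)) (≈-sym (⊕-assoc _ _ _))

    sumOver-⊕ : ∀ (xs : List A) f g → sumOver xs (λ a → f a ⊕ g a) ≈ sumOver xs f ⊕ sumOver xs g
    sumOver-⊕ []       f g = ≈-sym (⊕-idˡ _)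
    sumOver-⊕ (a ∷ xs) f g = ≈-trans (⊕-cong ≈-refl (sumOver-⊕ xs f g))
      (solve 4 (λ a b c d → (a :+ b) :+ (c :+ d) := (a :+ c) :+ (b :+ d)) ≈-refl _ _ _ _)
      where open Solver

    sumOver-⊗ : ∀ (xs : List A) c f → c ⊗ sumOver xs f ≈ sumOver xs (λ a → c ⊗ f a)
    sumOver-⊗ []       c f = Ring.zeroʳ c
    sumOver-⊗ (a ∷ xs) c f = ≈-trans (distribˡ _ _ _) (⊕-cong ≈-refl (sumOver-⊗ xs c f))

    sumOver-0 : ∀ (xs : List A) {f} → (∀ a → f a ≈ con 0ℚ) → sumOver xs f ≈ con 0ℚ
    sumOver-0 []       eq = ≈-refl
    sumOver-0 (a ∷ xs) eq = ≈-trans (⊕-cong (eq a) (sumOver-0 xs eq)) (⊕-idˡ _)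

    sumOver-filter : ∀ {P : A → Set} (P? : ∀ a → Dec (P a)) xs f →
                     sumOver (filter P? xs) f ≈ sumOver xs (λ a → gate (P? a) (f a))
    sumOver-filter P? []       f = ≈-refl
    sumOver-filter P? (a ∷ xs) f with P? a
    ... | yes _ = ⊕-cong ≈-refl (sumOver-filter P? xs f)
    ... | no  _ = ≈-trans (sumOver-filter P? xs f) (≈-sym (⊕-idˡ _))

    sumOver-gate : ∀ {P : Set} (P? : Dec P) (xs : List A) f →
                   sumOver xs (λ a → gate P? (f a)) ≈ gate P? (sumOver xs f)
    sumOver-gate (yes _) xs f = ≈-refl
    sumOver-gate (no _)  xs f = sumOver-0 xs (λ _ → ≈-refl)

  sumOver-map : ∀ {A B : Set} (g : A → B) xs f → sumOver (map g xs) f ≡ sumOver xs (f ∘ g)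
  sumOver-map g xs f = cong ∑ (sym (List.map-∘ xs))

  sumOver-concatMap : ∀ {A B : Set} (g : A → List B) xs f →
                      sumOver (concatMap g xs) f ≈ sumOver xs (λ a → sumOver (g a) f)
  sumOver-concatMap g []       f = ≈-refl
  sumOver-concatMap g (a ∷ xs) f = ≈-trans (sumOver-++ (g a) _ f) (⊕-cong ≈-refl (sumOver-concatMap g xs f))

  sumOver-swap : ∀ {A B : Set} (xs : List A) (ys : List B) (f : A → B → Poly V) →
                 sumOver xs (λ a → sumOver ys (f a)) ≈ sumOver ys (λ b → sumOver xs (λ a → f a b))
  sumOver-swap []       ys f = ≈-sym (sumOver-0 ys (λ _ → ≈-refl))
  sumOver-swap (a ∷ xs) ys f =
    ≈-trans (⊕-cong ≈-refl (sumOver-swap xs ys f)) (≈-sym (sumOver-⊕ ys _ _))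

  ∏-++ : ∀ {A : Set} (h : A → Poly V) xs ys → ∏ (map h (xs ++ ys)) ≈ ∏ (map h xs) ⊗ ∏ (map h ys)
  ∏-++ h []       ys = ≈-sym (⊗-idˡ _)
  ∏-++ h (a ∷ xs) ys = ≈-trans (⊗-cong ≈-refl (∏-++ h xs ys)) (≈-sym (⊗-assoc _ _ _))

subsets : ∀ {A : Set} → List A → List (List A)
subsets []       = [] ∷ []
subsets (a ∷ as) = subsets as ++ map (a ∷_) (subsets as)

sumOver-subsets-∷ : ∀ {V A : Set} (a : A) as (f : List A → Poly V) →
  sumOver (subsets (a ∷ as)) f ≈ sumOver (subsets as) (λ D → f D ⊕ f (a ∷ D))
sumOver-subsets-∷ a as f = ≈-trans (sumOver-++ (subsets as) _ f)
  (≈-trans (⊕-cong ≈-refl (≡⇒≈ (sumOver-map (a ∷_) (subsets as) f))) (≈-sym (sumOver-⊕ (subsets as) _ _)))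

sumOver-subsets-++ : ∀ {V A : Set} (as bs : List A) (f : List A → Poly V) →
  sumOver (subsets (as ++ bs)) f ≈ sumOver (subsets as) (λ D → sumOver (subsets bs) (λ E → f (D ++ E)))
sumOver-subsets-++ []       bs f = ≈-sym (≈-trans (⊕-comm _ _) (⊕-idˡ _))
sumOver-subsets-++ (a ∷ as) bs f = begin
  sumOver (subsets (a ∷ as ++ bs)) f
    ≈⟨ sumOver-subsets-∷ a (as ++ bs) f ⟩
  sumOver (subsets (as ++ bs)) (λ D → f D ⊕ f (a ∷ D))
    ≈⟨ sumOver-subsets-++ as bs (λ D → f D ⊕ f (a ∷ D)) ⟩
  sumOver (subsets as) (λ D → sumOver (subsets bs) (λ E → f (D ++ E) ⊕ f (a ∷ D ++ E)))
    ≈⟨ sumOver-cong (subsets as) (λ D → sumOver-⊕ (subsets bs) _ _) ⟩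
  sumOver (subsets as) (λ D → g D ⊕ g (a ∷ D))
    ≈⟨ sumOver-subsets-∷ a as g ⟨
  sumOver (subsets (a ∷ as)) g ∎
  where g = λ D → sumOver (subsets bs) (λ E → f (D ++ E))

sumOver-subsets-∷ʳ : ∀ {V A : Set} (as : List A) b (f : List A → Poly V) →
  sumOver (subsets (as ∷ʳ b)) f ≈ sumOver (subsets as) (λ D → f D ⊕ f (D ∷ʳ b))
sumOver-subsets-∷ʳ as b f = ≈-trans (sumOver-subsets-++ as (b ∷ []) f)
  (sumOver-cong (subsets as) λ D → ⊕-cong (≡⇒≈ (cong f (List.++-identityʳ D))) (≈-trans (⊕-comm _ _) (⊕-idˡ _)))

-- Right multiplication of ∑_w X(w) u_w by 1 + t u_a in the nilCoxeter algebra.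
T : ∀ {V} → ℕ → Poly V → (BC∞ → Poly V) → BC∞ → Poly V
T a t X w = X w ⊕ gate (desc? w a) (t ⊗ X (w · s a))

infix 4 _≈[_]_
_≈[_]_ : ∀ {V} → (BC∞ → Poly V) → ℕ → (BC∞ → Poly V) → Set
X ≈[ n ] Y = ∀ w → w ∈BC n → X w ≈ Y w

-- The second summand is present only at descents, which are below n on BC_n, so `w · s a` stays in
-- BC_n for every letter a that matters.
T-cong : ∀ {V n} {X Y : BC∞ → Poly V} → n ≥ 1 → ∀ a {t t′} → t ≈ t′ → X ≈[ n ] Y → T a t X ≈[ n ] T a t′ Y
T-cong n≥1 a t≈t′ X≈Y w w∈ = ⊕-cong (X≈Y w w∈) (gate-cong (desc? w a) λ d →
  ⊗-cong t≈t′ (X≈Y (w · s a) (∈BC-·s {w = w} w∈ (desc⇒< {w = w} w∈ n≥1 d))))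

-- The quadratic term drops out because w s_0 has no descent at 0 when w has one.
T₀-twice : ∀ {V} (y : Poly V) X w → T 0 y (T 0 y X) w ≈ T 0 (con (ℤ.+ 2 ℚ./ 1) ⊗ y) X w
T₀-twice y X w with desc? w 0
... | no _  = ≈-trans (⊕-assoc _ _ _) (⊕-cong ≈-refl (⊕-idˡ _))
... | yes d = ≈-trans (⊕-cong ≈-refl (⊗-cong ≈-refl
    (≈-trans (⊕-cong ≈-refl (gate-no (desc? (w · s 0) 0) (desc-·s w 0 d)))
             (≈-trans (⊕-comm _ _) (⊕-idˡ _)))))
  (≈-trans (⊕-assoc _ _ _) (⊕-cong ≈-refl (≈-sym
    (≈-trans (⊗-cong (≈-trans (⊗-cong (con-+ 1ℚ 1ℚ) ≈-refl) (≈-trans (Ring.distribʳ _ _ _) (⊕-cong (⊗-idˡ _) (⊗-idˡ _)))) ≈-refl)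
      (Ring.distribʳ _ _ _)))))

monomialOf : List Box → Poly XZ
monomialOf D = ∏ (map (λ b → var (variableOf b)) D)

reducedSum : List Box → BC∞ → Poly XZ
reducedSum L w = sumOver (subsets L) (λ D → gate (map letter D ∈R? w) (monomialOf D))

-- Multiplication is on the right, so the box read first acts first; hence the left fold.
star : List Box → (BC∞ → Poly XZ) → BC∞ → Poly XZ
star L X = foldl (λ X b → T (letter b) (var (variableOf b)) X) X L

star-cong : ∀ {n} → n ≥ 1 → ∀ L {X Y} → X ≈[ n ] Y → star L X ≈[ n ] star L Y
star-cong n≥1 []      X≈Y = X≈Y
star-cong n≥1 (b ∷ L) X≈Y = star-cong n≥1 L (T-cong n≥1 (letter b) ≈-refl X≈Y)

star-++ : ∀ L M X → star (L ++ M) X ≡ star M (star L X)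
star-++ L M X = List.foldl-++ _ X L M

-- The coefficients of the unit of the nilCoxeter algebra.
δ : BC∞ → Poly XZ
δ w = gate (w ≋? ι) (con 1ℚ)

-- The product is expanded from its last factor: the last box is either left out, or it supplies the
-- last letter of a reduced word, which must then be a descent.
star-δ : ∀ L w → star L δ w ≈ reducedSum L w
star-δ L = go (reverseView L)
  where
  go : ∀ {L} → Reverse L → ∀ w → star L δ w ≈ reducedSum L w
  go [] w = ≈-trans
    (gate-⇔ (w ≋? ι) ([] ∈R? w)
      (λ w≋ι → (λ i → sym (w≋ι i)) , HasLength-resp {ι} {w} (λ i → sym (w≋ι i)) (([] , (λ i → refl) , refl) , λ _ _ → z≤n))
      (λ (ι≋w , _) i → sym (ι≋w i)))
    (≈-trans (≈-sym (⊕-idˡ _)) (⊕-comm _ _))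
  go (L ∶ rL ∶ʳ b) w = begin
    star (L ∷ʳ b) δ w
      ≡⟨ cong (λ X → X w) (List.foldl-∷ʳ _ δ b L) ⟩
    T a v (star L δ) w
      ≈⟨ ⊕-cong (go rL w) (gate-cong (desc? w a) (λ _ → ⊗-cong ≈-refl (go rL (w · s a)))) ⟩
    reducedSum L w ⊕ gate (desc? w a) (v ⊗ reducedSum L (w · s a))
      ≈⟨ ⊕-cong ≈-refl (gate-cong (desc? w a) (λ _ → sumOver-⊗ (subsets L) v _)) ⟩
    reducedSum L w ⊕ gate (desc? w a) (sumOver (subsets L) (λ D → v ⊗ gate (map letter D ∈R? w · s a) (monomialOf D)))
      ≈⟨ ⊕-cong ≈-refl (sumOver-gate (desc? w a) (subsets L) _) ⟨
    reducedSum L w ⊕ sumOver (subsets L) (λ D → gate (desc? w a) (v ⊗ gate (map letter D ∈R? w · s a) (monomialOf D)))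
      ≈⟨ ⊕-cong ≈-refl (sumOver-cong (subsets L) step) ⟩
    reducedSum L w ⊕ sumOver (subsets L) (λ D → gate (map letter (D ∷ʳ b) ∈R? w) (monomialOf (D ∷ʳ b)))
      ≈⟨ sumOver-⊕ (subsets L) _ _ ⟨
    sumOver (subsets L) (λ D → gate (map letter D ∈R? w) (monomialOf D) ⊕ gate (map letter (D ∷ʳ b) ∈R? w) (monomialOf (D ∷ʳ b)))
      ≈⟨ sumOver-subsets-∷ʳ L b _ ⟨
    reducedSum (L ∷ʳ b) w ∎
    where
    a = letter b
    v = var (variableOf b)
    ∷ʳ-map : ∀ D → map letter (D ∷ʳ b) ≡ map letter D ∷ʳ a
    ∷ʳ-map D = List.map-++ letter D (b ∷ [])
    monomial-∷ʳ : ∀ D → v ⊗ monomialOf D ≈ monomialOf (D ∷ʳ b)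
    monomial-∷ʳ D = ≈-trans (⊗-comm _ _) (≈-sym (≈-trans (∏-++ _ D (b ∷ []))
      (⊗-cong ≈-refl (≈-trans (⊗-comm _ _) (⊗-idˡ _)))))
    step : ∀ D → gate (desc? w a) (v ⊗ gate (map letter D ∈R? w · s a) (monomialOf D)) ≈
                 gate (map letter (D ∷ʳ b) ∈R? w) (monomialOf (D ∷ʳ b))
    step D with desc? w a
    ... | no ¬d = ≈-sym (gate-no (map letter (D ∷ʳ b) ∈R? w)
          (λ r → ¬d (proj₁ (∈R-∷ʳ⁻ w a (map letter D) (subst (_∈R w) (∷ʳ-map D) r)))))
    ... | yes d = ≈-trans (gate-⊗ (map letter D ∈R? w · s a) v _)
          (≈-trans (gate-cong (map letter D ∈R? w · s a) (λ _ → monomial-∷ʳ D))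
            (gate-⇔ (map letter D ∈R? w · s a) (map letter (D ∷ʳ b) ∈R? w)
              (λ r → subst (_∈R w) (sym (∷ʳ-map D)) (∈R-∷ʳ⁺ w a (map letter D) d r))
              (λ r → proj₂ (∈R-∷ʳ⁻ w a (map letter D) (subst (_∈R w) (∷ʳ-map D) r)))))

-- Schubert polynomials at a point

module _ {V W : Set} where

  substitute-resp : ∀ (τ : V → Poly W) {f g} → f ≈ g → substitute τ f ≈ substitute τ g
  substitute-resp τ ≈-refl            = ≈-refl
  substitute-resp τ (≈-sym e)         = ≈-sym (substitute-resp τ e)
  substitute-resp τ (≈-trans e e′)    = ≈-trans (substitute-resp τ e) (substitute-resp τ e′)
  substitute-resp τ (⊕-cong e e′)     = ⊕-cong (substitute-resp τ e) (substitute-resp τ e′)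
  substitute-resp τ (⊗-cong e e′)     = ⊗-cong (substitute-resp τ e) (substitute-resp τ e′)
  substitute-resp τ (⊖-cong e)        = ⊖-cong (substitute-resp τ e)
  substitute-resp τ (⊕-assoc f g h)   = ⊕-assoc _ _ _
  substitute-resp τ (⊕-comm f g)      = ⊕-comm _ _
  substitute-resp τ (⊕-idˡ f)         = ⊕-idˡ _
  substitute-resp τ (⊕-invˡ f)        = ⊕-invˡ _
  substitute-resp τ (⊗-assoc f g h)   = ⊗-assoc _ _ _
  substitute-resp τ (⊗-comm f g)      = ⊗-comm _ _
  substitute-resp τ (⊗-idˡ f)         = ⊗-idˡ _
  substitute-resp τ (distribˡ f g h)  = distribˡ _ _ _
  substitute-resp τ (con-+ a b)       = con-+ a b
  substitute-resp τ (con-* a b)       = con-* a b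

  substitute-cong : ∀ {τ τ′ : V → Poly W} → (∀ v → τ v ≈ τ′ v) → ∀ f → substitute τ f ≈ substitute τ′ f
  substitute-cong e (con q) = ≈-refl
  substitute-cong e (var v) = e v
  substitute-cong e (f ⊕ g) = ⊕-cong (substitute-cong e f) (substitute-cong e g)
  substitute-cong e (f ⊗ g) = ⊗-cong (substitute-cong e f) (substitute-cong e g)
  substitute-cong e (⊖ f)   = ⊖-cong (substitute-cong e f)

  substitute-^ : ∀ (τ : V → Poly W) f k → substitute τ (f ^ᵖ k) ≈ substitute τ f ^ᵖ k
  substitute-^ τ f zero    = ≈-refl
  substitute-^ τ f (suc k) = ⊗-cong ≈-refl (substitute-^ τ f k)

substitute-∘ : ∀ {U V W} (τ : V → Poly W) (σ : U → Poly V) f →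
               substitute τ (substitute σ f) ≈ substitute (substitute τ ∘ σ) f
substitute-∘ τ σ (con q) = ≈-refl
substitute-∘ τ σ (var v) = ≈-refl
substitute-∘ τ σ (f ⊕ g) = ⊕-cong (substitute-∘ τ σ f) (substitute-∘ τ σ g)
substitute-∘ τ σ (f ⊗ g) = ⊗-cong (substitute-∘ τ σ f) (substitute-∘ τ σ g)
substitute-∘ τ σ (⊖ f)   = ⊖-cong (substitute-∘ τ σ f)

-- A ring homomorphism to a field, through which nonzero factors are cancelled.
constantTerm : ∀ {V} → Poly V → ℚ
constantTerm (con q) = q
constantTerm (var v) = 0ℚ
constantTerm (f ⊕ g) = constantTerm f ℚ.+ constantTerm g
constantTerm (f ⊗ g) = constantTerm f ℚ.* constantTerm g
constantTerm (⊖ f)   = ℚ.- constantTerm f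

constantTerm-resp : ∀ {V} {f g : Poly V} → f ≈ g → constantTerm f ≡ constantTerm g
constantTerm-resp ≈-refl           = refl
constantTerm-resp (≈-sym e)        = sym (constantTerm-resp e)
constantTerm-resp (≈-trans e e′)   = trans (constantTerm-resp e) (constantTerm-resp e′)
constantTerm-resp (⊕-cong e e′)    = cong₂ ℚ._+_ (constantTerm-resp e) (constantTerm-resp e′)
constantTerm-resp (⊗-cong e e′)    = cong₂ ℚ._*_ (constantTerm-resp e) (constantTerm-resp e′)
constantTerm-resp (⊖-cong e)       = cong ℚ.-_ (constantTerm-resp e)
constantTerm-resp (⊕-assoc f g h)  = ℚ.+-assoc (constantTerm f) (constantTerm g) (constantTerm h)
constantTerm-resp (⊕-comm f g)     = ℚ.+-comm (constantTerm f) (constantTerm g)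
constantTerm-resp (⊕-idˡ f)        = ℚ.+-identityˡ (constantTerm f)
constantTerm-resp (⊕-invˡ f)       = ℚ.+-inverseˡ (constantTerm f)
constantTerm-resp (⊗-assoc f g h)  = ℚ.*-assoc (constantTerm f) (constantTerm g) (constantTerm h)
constantTerm-resp (⊗-comm f g)     = ℚ.*-comm (constantTerm f) (constantTerm g)
constantTerm-resp (⊗-idˡ f)        = ℚ.*-identityˡ (constantTerm f)
constantTerm-resp (distribˡ f g h) = ℚ.*-distribˡ-+ (constantTerm f) (constantTerm g) (constantTerm h)
constantTerm-resp (con-+ a b)      = refl
constantTerm-resp (con-* a b)      = refl

-- This bounds the variables of a representative and is not invariant under `_≈_`; only its
-- finiteness is used.
zBound : Poly PZ → ℕ
zBound (con q)     = 0
zBound (var (p m)) = 0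
zBound (var (z j)) = suc j
zBound (f ⊕ g)     = zBound f ⊔ zBound g
zBound (f ⊗ g)     = zBound f ⊔ zBound g
zBound (⊖ f)       = zBound f

module _ {V : Set} where

  pt : (π ζ : ℕ → Poly V) → PZ → Poly V
  pt π ζ (p m) = π m
  pt π ζ (z j) = ζ j

  substitute-local : ∀ π {ζ ζ′ : ℕ → Poly V} f → (∀ {j} → j < zBound f → ζ j ≈ ζ′ j) →
                     substitute (pt π ζ) f ≈ substitute (pt π ζ′) f
  substitute-local π (con q)     e = ≈-refl
  substitute-local π (var (p m)) e = ≈-refl
  substitute-local π (var (z j)) e = e ℕ.≤-refl
  substitute-local π (f ⊕ g)     e = ⊕-cong
    (substitute-local π f (λ j< → e (ℕ.≤-trans j< (ℕ.m≤m⊔n (zBound f) (zBound g)))))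
    (substitute-local π g (λ j< → e (ℕ.≤-trans j< (ℕ.m≤n⊔m (zBound f) (zBound g)))))
  substitute-local π (f ⊗ g)     e = ⊗-cong
    (substitute-local π f (λ j< → e (ℕ.≤-trans j< (ℕ.m≤m⊔n (zBound f) (zBound g)))))
    (substitute-local π g (λ j< → e (ℕ.≤-trans j< (ℕ.m≤n⊔m (zBound f) (zBound g)))))
  substitute-local π (⊖ f)       e = ⊖-cong (substitute-local π f e)

  update : ℕ → Poly V → (ℕ → Poly V) → ℕ → Poly V
  update zero    y ζ zero    = y
  update zero    y ζ (suc k) = ζ (suc k)
  update (suc j) y ζ zero    = ζ 0
  update (suc j) y ζ (suc k) = update j y (ζ ∘ suc) k

  update-at : ∀ j y ζ → update j y ζ j ≡ y
  update-at zero    y ζ = refl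
  update-at (suc j) y ζ = update-at j y (ζ ∘ suc)

  update-≢ : ∀ j y ζ {k} → k ≢ j → update j y ζ k ≡ ζ k
  update-≢ zero    y ζ {zero}  k≢j = contradiction refl k≢j
  update-≢ zero    y ζ {suc k} k≢j = refl
  update-≢ (suc j) y ζ {zero}  k≢j = refl
  update-≢ (suc j) y ζ {suc k} k≢j = update-≢ j y (ζ ∘ suc) (k≢j ∘ cong suc)

  update-swap : ∀ j y ζ k → update j y ζ (swap j k) ≡ update (suc j) y (ζ ∘ swap j) k
  update-swap zero    y ζ zero          = refl
  update-swap zero    y ζ (suc zero)    = refl
  update-swap zero    y ζ (suc (suc k)) = refl
  update-swap (suc j) y ζ zero          = refl
  update-swap (suc j) y ζ (suc k)       = update-swap j y (ζ ∘ suc) k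

  update-swap′ : ∀ j y ζ k → update (suc j) y ζ (swap j k) ≡ update j y (ζ ∘ swap j) k
  update-swap′ zero    y ζ zero          = refl
  update-swap′ zero    y ζ (suc zero)    = refl
  update-swap′ zero    y ζ (suc (suc k)) = refl
  update-swap′ (suc j) y ζ zero          = refl
  update-swap′ (suc j) y ζ (suc k)       = update-swap′ j y (ζ ∘ suc) k

  update-cong : ∀ j {y ζ ζ′} → (∀ k → ζ k ≈ ζ′ k) → ∀ k → update j y ζ k ≈ update j y ζ′ k
  update-cong zero    e zero    = ≈-refl
  update-cong zero    e (suc k) = e (suc k)
  update-cong (suc j) e zero    = e 0
  update-cong (suc j) e (suc k) = update-cong j (e ∘ suc) k

  swap-equal : ∀ j (ζ : ℕ → Poly V) → ζ j ≈ ζ (suc j) → ∀ k → ζ (swap j k) ≈ ζ k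
  swap-equal zero    ζ e zero          = ≈-sym e
  swap-equal zero    ζ e (suc zero)    = e
  swap-equal zero    ζ e (suc (suc k)) = ≈-refl
  swap-equal (suc j) ζ e zero          = ≈-refl
  swap-equal (suc j) ζ e (suc k)       = swap-equal j (ζ ∘ suc) e k

  negateFirst : (ℕ → Poly V) → ℕ → Poly V
  negateFirst ζ zero    = ⊖ ζ 0
  negateFirst ζ (suc k) = ζ (suc k)

  module _ (F : (ℕ → Poly V) → Poly V) (m B : ℕ)
    (local : ∀ {ζ ζ′} → (∀ {j} → j < B → ζ j ≈ ζ′ j) → F ζ ≈ F ζ′)
    (symmetric : ∀ {a} ζ → m ≤ a → F (ζ ∘ swap a) ≈ F ζ) where

    private
      F-cong : ∀ {ζ ζ′} → (∀ j → ζ j ≈ ζ′ j) → F ζ ≈ F ζ′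
      F-cong e = local (λ _ → e _)

      -- By symmetry the updated position can be pushed beyond B.
      update-irrelevant : ∀ d {j} → m ≤ j → B ≤ j + d → ∀ y ζ → F (update j y ζ) ≈ F ζ
      update-irrelevant zero {j} m≤j B≤ y ζ = local λ {k} k<B →
        ≡⇒≈ (update-≢ j y ζ (ℕ.<⇒≢ (ℕ.<-≤-trans k<B (subst (B ≤_) (ℕ.+-identityʳ j) B≤))))
      update-irrelevant (suc d) {j} m≤j B≤ y ζ = begin
        F (update j y ζ)                    ≈⟨ symmetric (update j y ζ) m≤j ⟨
        F (update j y ζ ∘ swap j)           ≈⟨ F-cong (λ k → ≡⇒≈ (update-swap j y ζ k)) ⟩
        F (update (suc j) y (ζ ∘ swap j))   ≈⟨ update-irrelevant d (ℕ.m≤n⇒m≤1+n m≤j) (subst (B ≤_) (ℕ.+-suc j d) B≤) y (ζ ∘ swap j) ⟩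
        F (ζ ∘ swap j)                      ≈⟨ symmetric ζ m≤j ⟩
        F ζ ∎

      agree : ∀ d {j} → m ≤ j → B ≤ j + d → ∀ ζ ζ′ → (∀ {k} → k < j → ζ k ≈ ζ′ k) → F ζ ≈ F ζ′
      agree zero {j} m≤j B≤ ζ ζ′ e = local λ k<B → e (ℕ.<-≤-trans k<B (subst (B ≤_) (ℕ.+-identityʳ j) B≤))
      agree (suc d) {j} m≤j B≤ ζ ζ′ e = ≈-trans
        (≈-sym (update-irrelevant (suc d) m≤j B≤ (ζ′ j) ζ))
        (agree d (ℕ.m≤n⇒m≤1+n m≤j) (subst (B ≤_) (ℕ.+-suc j d) B≤) (update j (ζ′ j) ζ) ζ′ e′)
        where
        e′ : ∀ {k} → k < suc j → update j (ζ′ j) ζ k ≈ ζ′ k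
        e′ {k} k<1+j with k ℕ.≟ j
        ... | yes refl = ≡⇒≈ (update-at j (ζ′ j) ζ)
        ... | no k≢j   = ≈-trans (≡⇒≈ (update-≢ j (ζ′ j) ζ k≢j)) (e (ℕ.≤∧≢⇒< (ℕ.≤-pred k<1+j) k≢j))

    -- From position m on, the entries of ζ are replaced one by one by those of ζ′, each replacement
    -- being invisible to F. After at most B of them no entry that F reads differs.
    symmetric⇒independent : ∀ {ζ ζ′} → (∀ {k} → k < m → ζ k ≈ ζ′ k) → F ζ ≈ F ζ′
    symmetric⇒independent {ζ} {ζ′} = agree B ℕ.≤-refl (ℕ.m≤n+m B m) ζ ζ′

  cut : ℕ → (ℕ → Poly V) → ℕ → Poly V
  cut zero    ζ k       = con 0ℚ
  cut (suc i) ζ zero    = ζ 0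
  cut (suc i) ζ (suc k) = cut i (ζ ∘ suc) k

  cut-< : ∀ i ζ {k} → k < i → cut i ζ k ≡ ζ k
  cut-< (suc i) ζ {zero}  _       = refl
  cut-< (suc i) ζ {suc k} (s≤s q) = cut-< i (ζ ∘ suc) q

  cut-≥ : ∀ i ζ {k} → i ≤ k → cut i ζ k ≡ con 0ℚ
  cut-≥ zero    ζ         _       = refl
  cut-≥ (suc i) ζ {suc k} (s≤s q) = cut-≥ i (ζ ∘ suc) q

  update-cut : ∀ i ζ k → update i (ζ i) (cut i ζ) k ≡ cut (suc i) ζ k
  update-cut zero    ζ zero    = refl
  update-cut zero    ζ (suc k) = refl
  update-cut (suc i) ζ zero    = refl
  update-cut (suc i) ζ (suc k) = update-cut i (ζ ∘ suc) k

  powers : Poly V → ℕ → Poly V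
  powers y m = y ^ᵖ suc (2 * m)

module _ {V : Set} where

  ⊕-idʳ : (f : Poly V) → f ⊕ con 0ℚ ≈ f
  ⊕-idʳ f = ≈-trans (⊕-comm _ _) (⊕-idˡ f)

  ⊖-⊝ : (f g : Poly V) → ⊖ (f ⊝ g) ≈ g ⊝ f
  ⊖-⊝ f g = ≈-trans (≈-sym (RingP.-‿+-comm f (⊖ g)))
    (≈-trans (⊕-cong ≈-refl (RingP.-‿involutive g)) (⊕-comm _ _))

  -- The divided difference equation solved for the reflected polynomial h, so that no division
  -- occurs.
  difference-quotient : {f g d h : Poly V} → g ⊗ d ≈ f ⊝ h → h ≈ f ⊕ (⊖ d ⊗ g)
  difference-quotient {f} {g} {d} {h} e = ≈-sym (begin
    f ⊕ (⊖ d ⊗ g)     ≈⟨ ⊕-cong ≈-refl (RingP.-‿distribˡ-* d g) ⟨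
    f ⊕ (⊖ (d ⊗ g))   ≈⟨ ⊕-cong ≈-refl (⊖-cong (≈-trans (⊗-comm d g) e)) ⟩
    f ⊕ (⊖ (f ⊝ h))   ≈⟨ ⊕-cong ≈-refl (≈-sym (RingP.-‿+-comm f (⊖ h))) ⟩
    f ⊕ (⊖ f ⊕ ⊖ ⊖ h) ≈⟨ ⊕-cong ≈-refl (⊕-cong ≈-refl (RingP.-‿involutive h)) ⟩
    f ⊕ (⊖ f ⊕ h)     ≈⟨ ⊕-assoc _ _ _ ⟨
    (f ⊝ f) ⊕ h       ≈⟨ ⊕-cong (Ring.-‿inverseʳ f) ≈-refl ⟩
    con 0ℚ ⊕ h        ≈⟨ ⊕-idˡ h ⟩
    h ∎)

  T-congᵗ : ∀ a {t t′ : Poly V} X w → t ≈ t′ → T a t X w ≈ T a t′ X w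
  T-congᵗ a X w e = ⊕-cong ≈-refl (gate-cong (desc? w a) λ _ → ⊗-cong e ≈-refl)

module Evaluation (ℭ : BC∞ → Poly PZ) (isℭ : IsSchubertFamily ℭ) {V : Set} where

  open IsSchubertFamily isℭ

  C : (π ζ : ℕ → Poly V) → BC∞ → Poly V
  C π ζ w = substitute (pt π ζ) (ℭ w)

  C-cong : ∀ {π π′ ζ ζ′} → (∀ m → π m ≈ π′ m) → (∀ j → ζ j ≈ ζ′ j) → ∀ w → C π ζ w ≈ C π′ ζ′ w
  C-cong eπ eζ w = substitute-cong (λ { (p m) → eπ m ; (z j) → eζ j }) (ℭ w)

  act-T : ∀ (τ : PZ → Poly V) a w → substitute τ (act a (ℭ w)) ≈
          T a (⊖ substitute τ (denominator a)) (λ u → substitute τ (ℭ u)) w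
  act-T τ a w with desc? w a
  ... | yes d = difference-quotient (substitute-resp τ (descent w a (Desc⇒Descent w a d)))
  ... | no ¬d = ≈-trans
    (difference-quotient (substitute-resp τ (non-descent w a (λ D → ¬d (Descent⇒Desc w a D)))))
    (⊕-cong ≈-refl (Ring.zeroʳ _))

  -- A reflected polynomial evaluated at a point is the polynomial evaluated at the reflected point.
  C-swap : ∀ π ζ a w → C π (ζ ∘ swap a) w ≈ T (suc a) (ζ (suc a) ⊝ ζ a) (C π ζ) w
  C-swap π ζ a w = begin
    C π (ζ ∘ swap a) w
      ≈⟨ substitute-cong (λ { (p m) → ≈-refl ; (z j) → ≈-refl }) (ℭ w) ⟨
    _
      ≈⟨ substitute-∘ (pt π ζ) _ (ℭ w) ⟨
    substitute (pt π ζ) (act (suc a) (ℭ w))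
      ≈⟨ act-T (pt π ζ) (suc a) w ⟩
    T (suc a) (⊖ (ζ a ⊝ ζ (suc a))) (C π ζ) w
      ≈⟨ T-congᵗ (suc a) (C π ζ) w (⊖-⊝ _ _) ⟩
    T (suc a) (ζ (suc a) ⊝ ζ a) (C π ζ) w ∎

  C-negate : ∀ π ζ w → C (λ m → π m ⊕ powers (ζ 0) m) (negateFirst ζ) w ≈
                       T 0 (con (ℤ.+ 2 ℚ./ 1) ⊗ ζ 0) (C π ζ) w
  C-negate π ζ w = begin
    C (λ m → π m ⊕ powers (ζ 0) m) (negateFirst ζ) w
      ≈⟨ substitute-cong (λ { (p m)       → ⊕-cong ≈-refl (substitute-^ (pt π ζ) (var (z 0)) (suc (2 * m)))
                            ; (z zero)    → ≈-refl
                            ; (z (suc j)) → ≈-refl }) (ℭ w) ⟨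
    _
      ≈⟨ substitute-∘ (pt π ζ) _ (ℭ w) ⟨
    substitute (pt π ζ) (act 0 (ℭ w))
      ≈⟨ act-T (pt π ζ) 0 w ⟩
    T 0 (⊖ ⊖ (con (ℤ.+ 2 ℚ./ 1) ⊗ ζ 0)) (C π ζ) w
      ≈⟨ T-congᵗ 0 (C π ζ) w (RingP.-‿involutive (con (ℤ.+ 2 ℚ./ 1) ⊗ ζ 0)) ⟩
    T 0 (con (ℤ.+ 2 ℚ./ 1) ⊗ ζ 0) (C π ζ) w ∎

  -- Elements of BC_(m+1) have no descents beyond m, so their values are symmetric in all positions
  -- from m on; as a polynomial involves finitely many variables, it involves none of these.
  C-independent : ∀ {m π ζ ζ′} → (∀ {k} → k < m → ζ k ≈ ζ′ k) → C π ζ ≈[ suc m ] C π ζ′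
  C-independent {m} {π} e w w∈ = symmetric⇒independent (λ ζ → C π ζ w) m (zBound (ℭ w))
    (substitute-local π (ℭ w))
    (λ {a} ζ m≤a → ≈-trans (C-swap π ζ a w) (≈-trans
      (⊕-cong ≈-refl (gate-no (desc? w (suc a)) (λ d → ℕ.<⇒≱ (desc⇒< {w = w} w∈ (s≤s z≤n) d) (s≤s m≤a))))
      (⊕-idʳ _)))
    e

  -- Moving a value y through positions where ζ vanishes.
  C-shift-left : ∀ π ζ j y w → ζ j ≈ con 0ℚ → ζ (suc j) ≈ con 0ℚ →
                 C π (update j y ζ) w ≈ T (suc j) y (C π (update (suc j) y ζ)) w
  C-shift-left π ζ j y w ζj ζj+ = begin
    C π (update j y ζ) w
      ≈⟨ C-cong (λ _ → ≈-refl) (λ k → ≈-sym (≈-trans (≡⇒≈ (update-swap′ j y ζ k)) (update-cong j (swap-equal j ζ (≈-trans ζj (≈-sym ζj+))) k))) w ⟩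
    C π (update (suc j) y ζ ∘ swap j) w
      ≈⟨ C-swap π (update (suc j) y ζ) j w ⟩
    T (suc j) (update (suc j) y ζ (suc j) ⊝ update (suc j) y ζ j) (C π (update (suc j) y ζ)) w
      ≈⟨ T-congᵗ (suc j) (C π (update (suc j) y ζ)) w (≈-trans (⊕-cong (≡⇒≈ (update-at (suc j) y ζ))
           (⊖-cong (≈-trans (≡⇒≈ (update-≢ (suc j) y ζ (ℕ.<⇒≢ ℕ.≤-refl))) ζj)))
           (≈-trans (⊕-cong ≈-refl RingP.-0#≈0#) (⊕-idʳ y))) ⟩
    T (suc j) y (C π (update (suc j) y ζ)) w ∎

  -- The opposite sign and the opposite direction cancel, so the vertical part of a block carries
  -- the same variable as the horizontal one.
  C-shift-right : ∀ π ζ j y w → ζ j ≈ con 0ℚ → ζ (suc j) ≈ con 0ℚ →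
                  C π (update (suc j) (⊖ y) ζ) w ≈ T (suc j) y (C π (update j (⊖ y) ζ)) w
  C-shift-right π ζ j y w ζj ζj+ = begin
    C π (update (suc j) (⊖ y) ζ) w
      ≈⟨ C-cong (λ _ → ≈-refl) (λ k → ≈-sym (≈-trans (≡⇒≈ (update-swap j (⊖ y) ζ k)) (update-cong (suc j) (swap-equal j ζ (≈-trans ζj (≈-sym ζj+))) k))) w ⟩
    C π (update j (⊖ y) ζ ∘ swap j) w
      ≈⟨ C-swap π (update j (⊖ y) ζ) j w ⟩
    T (suc j) (update j (⊖ y) ζ (suc j) ⊝ update j (⊖ y) ζ j) (C π (update j (⊖ y) ζ)) w
      ≈⟨ T-congᵗ (suc j) (C π (update j (⊖ y) ζ)) w (≈-trans
           (⊕-cong (≈-trans (≡⇒≈ (update-≢ j (⊖ y) ζ ℕ.1+n≢n)) ζj+)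
             (⊖-cong (≡⇒≈ (update-at j (⊖ y) ζ))))
           (≈-trans (⊕-idˡ _) (RingP.-‿involutive y))) ⟩
    T (suc j) y (C π (update j (⊖ y) ζ)) w ∎

-- With m = n - 1, this and `Γ-block` are the pieces to which `base (suc m) k` unfolds.
row : ℕ → ℕ → List Box
row m i = map (staircase i) (downFrom (m ∸ i))

Γ-block : ℕ → ℕ → List Box
Γ-block n e = map (horizontal e) (downFrom n) ++ map (vertical e) (upTo n)

module Decomposition (ℭ : BC∞ → Poly PZ) (isℭ : IsSchubertFamily ℭ) (m : ℕ) where

  open Evaluation ℭ isℭ {XZ}

  private
    n = suc m
    n≥1 : n ≥ 1
    n≥1 = s≤s z≤n

  ≈[]-trans : ∀ {X Y Z : BC∞ → Poly XZ} → X ≈[ n ] Y → Y ≈[ n ] Z → X ≈[ n ] Z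
  ≈[]-trans e e′ w w∈ = ≈-trans (e w w∈) (e′ w w∈)

  zs : ℕ → Poly XZ
  zs j = var (z j)

  -- The farthest move is the innermost factor and has the largest letter, in accordance with
  -- reading a row from right to left.
  row-prefix : ∀ π i d → C π (update i (zs i) (cut i zs)) ≈[ n ]
               star (map (staircase i) (downFrom d)) (C π (update (i + d) (zs i) (cut i zs)))
  row-prefix π i zero w w∈ = ≡⇒≈ (cong (λ j → C π (update j (zs i) (cut i zs)) w) (sym (ℕ.+-identityʳ i)))
  row-prefix π i (suc d) = ≈[]-trans (row-prefix π i d)
    (star-cong n≥1 (map (staircase i) (downFrom d)) λ w _ →
      ≈-trans (C-shift-left π (cut i zs) (i + d) (zs i) w
                (≡⇒≈ (cut-≥ i zs (ℕ.m≤m+n i d))) (≡⇒≈ (cut-≥ i zs (ℕ.m≤n⇒m≤1+n (ℕ.m≤m+n i d)))))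
              (≡⇒≈ (cong (λ j → T (suc (i + d)) (zs i) (C π (update j (zs i) (cut i zs))) w) (sym (ℕ.+-suc i d)))))

  row-factor : ∀ π i → i ≤ m → C π (cut (suc i) zs) ≈[ n ] star (row m i) (C π (cut i zs))
  row-factor π i i≤m = ≈[]-trans
    (λ w _ → C-cong (λ _ → ≈-refl) (λ k → ≈-sym (≡⇒≈ (update-cut i zs k))) w)
    (≈[]-trans (row-prefix π i (m ∸ i))
      -- The value z_i has arrived at position m, which is invisible on BC_n.
      (star-cong n≥1 (row m i) (C-independent λ {k} k<m →
        ≡⇒≈ (update-≢ _ (zs i) (cut i zs) (λ e → ℕ.<⇒≢ k<m (trans e (ℕ.m+[n∸m]≡n i≤m)))))))

  staircase-factor : ∀ π r → r ≤ m → C π (cut r zs) ≈[ n ] star (concatMap (row m) (upTo r)) (C π (cut 0 zs))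
  staircase-factor π zero    _   w w∈ = ≈-refl
  staircase-factor π (suc r) r<m w w∈ = ≈-trans
    (≈[]-trans (row-factor π r (ℕ.<⇒≤ r<m)) (star-cong n≥1 (row m r) (staircase-factor π r (ℕ.<⇒≤ r<m))) w w∈)
    (≡⇒≈ (cong (λ X → X w) (trans (sym (star-++ (concatMap (row m) (upTo r)) (row m r) _))
      (cong (λ L → star L (C π (cut 0 zs))) (trans
        (cong (concatMap (row m) (upTo r) ++_) (sym (List.++-identityʳ (row m r))))
        (trans (sym (List.concatMap-++ (row m) (upTo r) (r ∷ []))) (cong (concatMap (row m)) (List.upTo-∷ʳ r))))))))

  O : ℕ → Poly XZ
  O _ = con 0ℚ

  module _ (π : ℕ → Poly XZ) (e : ℕ) where

    private
      y = var (x e)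
      π′ : ℕ → Poly XZ
      π′ j = π j ⊕ powers y j

    horizontal-factor : ∀ d → C π (update 0 y O) ≈[ n ]
                        star (map (horizontal e) (applyDownFrom suc d)) (C π (update d y O))
    horizontal-factor zero    w w∈ = ≈-refl
    horizontal-factor (suc d) = ≈[]-trans (horizontal-factor d)
      (star-cong n≥1 (map (horizontal e) (applyDownFrom suc d)) λ w _ →
        C-shift-left π O d y w ≈-refl ≈-refl)

    -- The sign change accounts for the two boxes of index 0, the last of the horizontal and the
    -- first of the vertical part.
    flip-factor : C π′ (update 0 (⊖ y) O) ≈[ n ] T 0 y (T 0 y (C π (update 0 y O)))
    flip-factor w w∈ = begin
      C π′ (update 0 (⊖ y) O) w
        ≈⟨ C-cong (λ _ → ≈-refl) (λ { zero → ≈-refl ; (suc k) → ≈-refl }) w ⟩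
      C π′ (negateFirst (update 0 y O)) w
        ≈⟨ C-negate π (update 0 y O) w ⟩
      T 0 (con (ℤ.+ 2 ℚ./ 1) ⊗ y) (C π (update 0 y O)) w
        ≈⟨ T₀-twice y (C π (update 0 y O)) w ⟨
      T 0 y (T 0 y (C π (update 0 y O))) w ∎

    vertical-factor : ∀ d → C π′ (update d (⊖ y) O) ≈[ n ]
                      star (map (vertical e) (applyUpTo suc d)) (C π′ (update 0 (⊖ y) O))
    vertical-factor zero    w w∈ = ≈-refl
    vertical-factor (suc d) w w∈ = ≈-trans
      (C-shift-right π′ O d y w ≈-refl ≈-refl)
      (≈-trans (T-cong n≥1 (suc d) ≈-refl (vertical-factor d) w w∈)
        (≡⇒≈ (cong (λ X → X w) (trans (sym (List.foldl-∷ʳ _ _ (vertical e (suc d)) (map (vertical e) (applyUpTo suc d))))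
          (cong (λ L → star L (C π′ (update 0 (⊖ y) O)))
            (trans (sym (List.map-++ (vertical e) (applyUpTo suc d) (suc d ∷ [])))
                   (cong (map (vertical e)) (List.applyUpTo-∷ʳ suc d))))))))

    -- Both y and -y can be erased at position m, so the only lasting effect of the round trip is
    -- the shift of the power sums from π to π′.
    Γ-factor : C π′ O ≈[ n ] star (Γ-block n e) (C π O)
    Γ-factor = ≈[]-trans
      (C-independent λ {k} k<m → ≈-sym (≡⇒≈ (update-≢ m (⊖ y) O (ℕ.<⇒≢ k<m))))
      (≈[]-trans (vertical-factor m)
      (≈[]-trans (star-cong n≥1 vs (≈[]-trans flip-factor
         (T-cong n≥1 0 ≈-refl (T-cong n≥1 0 ≈-refl (≈[]-trans (horizontal-factor m)
           (star-cong n≥1 hs (C-independent λ {k} k<m → ≡⇒≈ (update-≢ m y O (ℕ.<⇒≢ k<m)))))))))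
      λ w _ → ≡⇒≈ (cong (λ X → X w) blocks)))
      where
      hs vs : List Box
      hs = map (horizontal e) (applyDownFrom suc m)
      vs = map (vertical e) (applyUpTo suc m)
      blocks : star vs (T 0 y (T 0 y (star hs (C π O)))) ≡ star (Γ-block n e) (C π O)
      blocks = sym (trans (star-++ (map (horizontal e) (downFrom n)) (map (vertical e) (upTo n)) (C π O))
        (cong (λ X → star vs (T 0 y X)) (trans
          (cong (λ L → star (map (horizontal e) L) (C π O)) (sym (List.downFrom-∷ʳ m)))
          (trans (cong (λ L → star L (C π O)) (List.map-++ (horizontal e) (applyDownFrom suc m) (0 ∷ [])))
                 (star-++ hs (horizontal e 0 ∷ []) (C π O))))))

  powerSums : ℕ → ℕ → Poly XZ
  powerSums k j = ∑ (map (λ i → powers (var (x i)) j) (upTo k))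

  -- The block read first is the innermost factor, so the remaining blocks start from power sums
  -- that it has already shifted; this forces an arbitrary π.
  Γs-factor : ∀ k π → C (λ j → π j ⊕ powerSums k j) O ≈[ n ] star (concatMap (Γ-block n) (downFrom k)) (C π O)
  Γs-factor zero    π w w∈ = C-cong (λ j → ⊕-idʳ (π j)) (λ _ → ≈-refl) w
  Γs-factor (suc k) π = ≈[]-trans
    (λ w _ → C-cong (λ j → ≈-trans (⊕-cong ≈-refl (split j)) (≈-sym (⊕-assoc _ _ _))) (λ _ → ≈-refl) w)
    (≈[]-trans (Γs-factor k (λ j → π j ⊕ powers (var (x k)) j))
    (≈[]-trans (star-cong n≥1 (concatMap (Γ-block n) (downFrom k)) (Γ-factor π k))
      λ w _ → ≡⇒≈ (cong (λ X → X w) (sym (star-++ (Γ-block n k) (concatMap (Γ-block n) (downFrom k)) (C π O))))))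
    where
    split : ∀ j → powerSums (suc k) j ≈ powers (var (x k)) j ⊕ powerSums k j
    split j = ≈-trans (≡⇒≈ (cong (λ is → sumOver is f) (sym (List.upTo-∷ʳ k))))
      (≈-trans (sumOver-++ (upTo k) (k ∷ []) f) (≈-trans (⊕-comm _ _) (⊕-cong (⊕-idʳ _) ≈-refl)))
      where f = λ i → powers (var (x i)) j

  base-factor : ∀ k → (λ w → truncate k (ℭ w)) ≈[ n ] star (base n k) (C O O)
  base-factor k = ≈[]-trans
    (λ w _ → substitute-cong (λ { (p j) → ≈-sym (⊕-idˡ _) ; (z j) → ≈-refl }) (ℭ w))
    (≈[]-trans (C-independent λ k<m → ≈-sym (≡⇒≈ (cut-< m zs k<m)))
    (≈[]-trans (staircase-factor (λ j → O j ⊕ powerSums k j) m ℕ.≤-refl)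
    (≈[]-trans (star-cong n≥1 (concatMap (row m) (upTo m)) (Γs-factor k O))
      λ w _ → ≡⇒≈ (cong (λ X → X w)
        (sym (star-++ (concatMap (Γ-block n) (downFrom k)) (concatMap (row m) (upTo m)) (C O O)))))))

-- Points at which no denominator vanishes; the condition is invariant
-- under the action of BC∞.
Generic : ∀ {V} → (ℕ → Poly V) → Set
Generic ζ = (∀ j → constantTerm (ζ j) ≢ 0ℚ) ×
            (∀ {j k} → ℚ.∣ constantTerm (ζ j) ∣ ≡ ℚ.∣ constantTerm (ζ k) ∣ → j ≡ k)

-- Explicit numerators and denominators let genericity be read off the numerators.
naturals : ∀ {V} → ℕ → Poly V
naturals j = con (mkℚ (ℤ.+ suc j) 0 (Coprime.sym (Coprime.1-coprimeTo (suc j))))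

naturals-generic : ∀ {V} → Generic (naturals {V})
naturals-generic = (λ j ()) , λ e → ℕ.suc-injective (ℤ.+-injective (cong ℚ.numerator e))

generic-swap : ∀ {V} {ζ : ℕ → Poly V} a → Generic ζ → Generic (ζ ∘ swap a)
generic-swap a (≢0 , inj) = (λ j → ≢0 (swap a j)) , λ {j} {k} e →
  trans (sym (swap-involutive a j)) (trans (cong (swap a) (inj e)) (swap-involutive a k))

-- Negating an entry could make it equal to another one, which is why `Generic` compares absolute
-- values.
generic-negateFirst : ∀ {V} {ζ : ℕ → Poly V} → Generic ζ → Generic (negateFirst ζ)
generic-negateFirst {V} {ζ} (≢0 , inj) =
  (λ { zero e → ≢0 0 (ℚ.neg-injective e) ; (suc k) → ≢0 (suc k) }) ,
  λ {j} {k} e → inj (trans (sym (abs j)) (trans e (abs k)))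
  where
  abs : ∀ j → ℚ.∣ constantTerm (negateFirst ζ j) ∣ ≡ ℚ.∣ constantTerm (ζ j) ∣
  abs zero    = ℚ.∣-p∣≡∣p∣ (constantTerm (ζ 0))
  abs (suc j) = refl

*-cancel-≢0 : ∀ {a b} → a ≢ 0ℚ → a ℚ.* b ≡ 0ℚ → b ≡ 0ℚ
*-cancel-≢0 {a} {b} a≢0 ab≡0 =
  trans (sym (ℚ.*-identityˡ b)) (trans (cong (ℚ._* b) (sym (ℚ.*-inverseˡ a)))
    (trans (ℚ.*-assoc (ℚ.1/ a) a b) (trans (cong (ℚ.1/ a ℚ.*_) ab≡0) (ℚ.*-zeroʳ (ℚ.1/ a)))))
  where instance _ = ℚ.≢-nonZero a≢0

+-cancel-0 : ∀ {a b} → a ≡ a ℚ.+ b → b ≡ 0ℚ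
+-cancel-0 {a} {b} e = trans (sym (ℚ.+-identityˡ b)) (trans (cong (ℚ._+ b) (sym (ℚ.+-inverseˡ a)))
  (trans (ℚ.+-assoc (ℚ.- a) a b) (trans (cong (ℚ.- a ℚ.+_) (sym e)) (ℚ.+-inverseˡ a))))

simpleReflection : ∀ {V} → ℕ → (π ζ : ℕ → Poly V) → (ℕ → Poly V) × (ℕ → Poly V)
simpleReflection zero    π ζ = (λ m → π m ⊕ powers (ζ 0) m) , negateFirst ζ
simpleReflection (suc a) π ζ = π , ζ ∘ swap a

-- The negative of `denominator a`, evaluated at the point.
root : ∀ {V} → ℕ → (ℕ → Poly V) → Poly V
root zero    ζ = con (ℤ.+ 2 ℚ./ 1) ⊗ ζ 0
root (suc a) ζ = ζ (suc a) ⊝ ζ a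

generic-simpleReflection : ∀ {V} a (π : ℕ → Poly V) {ζ} → Generic ζ → Generic (proj₂ (simpleReflection a π ζ))
generic-simpleReflection zero    π {ζ} = generic-negateFirst {ζ = ζ}
generic-simpleReflection (suc a) π {ζ} = generic-swap {ζ = ζ} a

generic-root : ∀ {V} a {ζ : ℕ → Poly V} → Generic ζ → constantTerm (root a ζ) ≢ 0ℚ
generic-root zero    (≢0 , _) e = ≢0 0 (*-cancel-≢0 {ℤ.+ 2 ℚ./ 1} (λ ()) e)
generic-root (suc a) (_ , inj) e = ℕ.1+n≢n (inj (cong ℚ.∣_∣ (ℚ+.x∙y⁻¹≈ε⇒x≈y _ _ e)))
  where module ℚ+ = GroupProperties ℚ.+-0-group

ι-or-descent : ∀ w → w ≋ ι ⊎ ∃ (Desc w)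
ι-or-descent w with c , c∈ ← reducedWordOf w = go (reverseView c) c∈
  where
  go : ∀ {c} → Reverse c → c ∈R w → w ≋ ι ⊎ ∃ (Desc w)
  go [] c∈           = inj₁ λ i → sym (proj₁ c∈ i)
  go (c ∶ _ ∶ʳ a) c∈ = inj₂ (a , proj₁ (∈R-∷ʳ⁻ w a c c∈))

sum-deg≡0 : ∀ vs → sum (map deg vs) ≡ 0 → vs ≡ []
sum-deg≡0 []         _  = refl
sum-deg≡0 (p _ ∷ vs) ()
sum-deg≡0 (z _ ∷ vs) ()

module ConstantTerms (ℭ : BC∞ → Poly PZ) (isℭ : IsSchubertFamily ℭ) {V : Set} where

  open IsSchubertFamily isℭ
  open Evaluation ℭ isℭ {V}

  O′ : ℕ → Poly V
  O′ _ = con 0ℚ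

  value : (π ζ : ℕ → Poly V) → BC∞ → ℚ
  value π ζ w = constantTerm (C π ζ w)

  C-simpleReflection : ∀ a π ζ w → C (proj₁ (simpleReflection a π ζ)) (proj₂ (simpleReflection a π ζ)) w ≈
                       T a (root a ζ) (C π ζ) w
  C-simpleReflection zero    = C-negate
  C-simpleReflection (suc a) π ζ = C-swap π ζ a

  C-ι : ∀ π ζ {w} → w ≋ ι → C π ζ w ≈ con 1ℚ
  C-ι π ζ {w} w≋ι = substitute-resp (pt π ζ) (≈-trans (well-defined {w} {ι} w≋ι) identity)

  -- The reflection adds to the value at w the root times the value at w s_a; at a generic point the
  -- root has nonzero constant term and cancels.
  value-descent : ∀ {a} π ζ w → Generic ζ → Desc w a →
                  value π ζ w ≡ value (proj₁ (simpleReflection a π ζ)) (proj₂ (simpleReflection a π ζ)) w →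
                  value π ζ (w · s a) ≡ 0ℚ
  value-descent {a} π ζ w gen d e = *-cancel-≢0 (generic-root a {ζ} gen) (+-cancel-0 (trans e
    (constantTerm-resp (≈-trans (C-simpleReflection a π ζ w) (⊕-cong ≈-refl (gate-yes (desc? w a) d))))))

  -- Along a reduced word, vanishing at all generic points passes down to
  -- the identity, where the value is 1.
  nonvanishing : ∀ w → ¬ (∀ π ζ → Generic ζ → value π ζ w ≡ 0ℚ)
  nonvanishing w with c , c∈ ← reducedWordOf w = go (reverseView c) w c∈
    where
    go : ∀ {c} → Reverse c → ∀ w → c ∈R w → ¬ (∀ π ζ → Generic ζ → value π ζ w ≡ 0ℚ)
    go [] w c∈ v≡0 = case trans (sym (constantTerm-resp (C-ι O′ naturals {w} (λ i → sym (proj₁ c∈ i)))))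
                                (v≡0 O′ naturals (naturals-generic {V})) of λ ()
    go (c ∶ rc ∶ʳ a) w c∈ v≡0 with d , c∈′ ← ∈R-∷ʳ⁻ w a c c∈ = go rc (w · s a) c∈′ λ π ζ gen →
      value-descent {a} π ζ w gen d (trans (v≡0 π ζ gen)
        (sym (v≡0 (proj₁ (simpleReflection a π ζ)) (proj₂ (simpleReflection a π ζ)) (generic-simpleReflection a π {ζ} gen))))

  C-0 : ∀ w → C O′ O′ w ≈ gate (w ≋? ι) (con 1ℚ)
  C-0 w with w ≋? ι
  ... | yes w≋ι = C-ι O′ O′ {w} w≋ι
  ... | no w≄ι with ι-or-descent w
  ...   | inj₁ w≋ι = contradiction w≋ι w≄ι
  ...   | inj₂ (a , d) with homogeneous w
  -- A constant has the same value at a point and at its reflection, so `value-descent` applies at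
  -- every generic point.
  ...     | zero , ts , degs , ℭ≈ = ⊥-elim (nonvanishing (w · s a) λ π ζ gen →
            value-descent {a} π ζ w gen d (constantTerm-resp (constant π _ ζ _)))
    where
    constant : ∀ π π′ ζ ζ′ → C π ζ w ≈ C π′ ζ′ w
    constant π π′ ζ ζ′ = ≈-trans (substitute-resp (pt π ζ) ℭ≈)
      (≈-trans (terms ts degs) (≈-sym (substitute-resp (pt π′ ζ′) ℭ≈)))
      where
      terms : ∀ ts → All (λ t → sum (map deg (proj₂ t)) ≡ 0) ts →
              substitute (pt π ζ) (∑ (map (λ t → con (proj₁ t) ⊗ ∏ (map var (proj₂ t))) ts)) ≈
              substitute (pt π′ ζ′) (∑ (map (λ t → con (proj₁ t) ⊗ ∏ (map var (proj₂ t))) ts))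
      terms [] [] = ≈-refl
      terms ((c , vs) ∷ ts) (e ∷ es) with refl ← sum-deg≡0 vs e = ⊕-cong ≈-refl (terms ts es)
  ...     | suc d′ , ts , degs , ℭ≈ = ≈-trans (substitute-resp (pt O′ O′) ℭ≈) (terms ts degs)
    where
    terms : ∀ ts → All (λ t → sum (map deg (proj₂ t)) ≡ suc d′) ts →
            substitute (pt O′ O′) (∑ (map (λ t → con (proj₁ t) ⊗ ∏ (map var (proj₂ t))) ts)) ≈ con 0ℚ
    terms [] [] = ≈-refl
    terms ((c , p _ ∷ vs) ∷ ts) (_ ∷ es) =
      ≈-trans (⊕-cong (≈-trans (⊗-cong ≈-refl (Ring.zeroˡ _)) (Ring.zeroʳ _)) (terms ts es)) (⊕-idˡ _)
    terms ((c , z _ ∷ vs) ∷ ts) (_ ∷ es) =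
      ≈-trans (⊕-cong (≈-trans (⊗-cong ≈-refl (Ring.zeroˡ _)) (Ring.zeroʳ _)) (terms ts es)) (⊕-idˡ _)

truncate-ℭ : ∀ ℭ → IsSchubertFamily ℭ → ∀ {n} → n ≥ 1 → ∀ w → w ∈BC n → ∀ k →
             truncate k (ℭ w) ≈ reducedSum (base n k) w
truncate-ℭ ℭ isℭ {suc m} n≥1 w w∈ k = begin
  truncate k (ℭ w)                  ≈⟨ Decomposition.base-factor ℭ isℭ m k w w∈ ⟩
  star (base (suc m) k) _ w         ≈⟨ star-cong n≥1 (base (suc m) k) (λ u _ → ConstantTerms.C-0 ℭ isℭ u) w w∈ ⟩
  star (base (suc m) k) δ w         ≈⟨ star-δ (base (suc m) k) w ⟩
  reducedSum (base (suc m) k) w ∎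

-- The staircase block

AllPairs-mapAll : ∀ {A : Set} {R S : A → A → Set} {Q : A → Set} →
                  (∀ {a b} → Q a → Q b → R a b → S a b) → ∀ {as} → All Q as → AllPairs R as → AllPairs S as
AllPairs-mapAll f []         []         = []
AllPairs-mapAll f (qa ∷ qas) (ra ∷ ras) =
  All.zipWith (λ (qb , rab) → f qa qb rab) (qas , ra) ∷ AllPairs-mapAll f qas ras

-- Monomials are lists up to permutation and admissible sequences are sorted, so each admissible
-- monomial comes from exactly one sequence; sums over monomials become sums over sequences.
↭-ascending : ∀ {is js} → Linked _≤_ is → Linked _≤_ js → is ↭ js → is ≡ js
↭-ascending is↗ js↗ is↭js =
  Pointwise.Pointwise-≡⇒≡ (↗↭↗⇒≋ ℕ.≤-totalOrder is↗ js↗ (↭⇒↭ₛ is↭js))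

↭-descending : ∀ {is js} → Linked (flip _≤_) is → Linked (flip _≤_) js → is ↭ js → is ≡ js
↭-descending is↘ js↘ is↭js =
  Pointwise.Pointwise-≡⇒≡ (↗↭↗⇒≋ (Flip.totalOrder ℕ.≤-totalOrder) is↘ js↘ (↭⇒↭ₛ is↭js))

module Subsets {A : Set} where

  []∈subsets : (as : List A) → [] ∈ subsets as
  []∈subsets []       = here refl
  []∈subsets (a ∷ as) = ∈-++⁺ˡ ([]∈subsets as)

  subsets-All : ∀ {Q : A → Set} {as} → All Q as → All (All Q) (subsets as)
  subsets-All []         = [] ∷ []
  subsets-All (qa ∷ qas) = All.++⁺ (subsets-All qas) (All.map⁺ (All.map (qa ∷_) (subsets-All qas)))

  subsets-AllPairs : ∀ {R : A → A → Set} {as} → AllPairs R as → All (AllPairs R) (subsets as)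
  subsets-AllPairs []         = [] ∷ []
  subsets-AllPairs (ra ∷ ras) = All.++⁺ (subsets-AllPairs ras)
    (All.map⁺ (All.zipWith (λ (q , r) → q ∷ r) (subsets-All ra , subsets-AllPairs ras)))

  subsets-unique : ∀ {as : List A} → Unique as → Unique (subsets as)
  subsets-unique []                 = [] ∷ []
  subsets-unique {a ∷ as} (a∉ ∷ as!) = Unique.++⁺ (subsets-unique as!) (Unique.map⁺ List.∷-injectiveʳ (subsets-unique as!))
    λ { {D} (D∈ , D∈′) → disjoint D∈ (∈-map⁻ (a ∷_) D∈′) }
    where
    disjoint : ∀ {D} → D ∈ subsets as → ¬ ∃ λ E → E ∈ subsets as × D ≡ a ∷ E
    disjoint D∈ (E , _ , refl) = All.head (All.lookup (subsets-All a∉) D∈) refl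

  module _ {_≺_ : A → A → Set} (≺-irrefl : ∀ {a} → ¬ a ≺ a) (≺-asym : ∀ {a b} → a ≺ b → ¬ b ≺ a) where

    sorted-∈subsets : ∀ {as D} → AllPairs _≺_ as → AllPairs _≺_ D → All (_∈ as) D → D ∈ subsets as
    sorted-∈subsets {as} {[]} _ _ _ = []∈subsets as
    sorted-∈subsets {a ∷ as} {d ∷ D} (a≺ ∷ as↗) (d≺ ∷ D↗) (here refl ∷ D⊆) =
      ∈-++⁺ʳ (subsets as) (∈-map⁺ (d ∷_) (sorted-∈subsets as↗ D↗
        (All.zipWith (λ { (d≺e , here refl) → contradiction d≺e ≺-irrefl ; (_ , there e∈) → e∈ }) (d≺ , D⊆))))
    sorted-∈subsets {a ∷ as} {d ∷ D} (a≺ ∷ as↗) (d≺ ∷ D↗) (there d∈ ∷ D⊆) =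
      ∈-++⁺ˡ (sorted-∈subsets as↗ (d≺ ∷ D↗) (d∈ ∷
        All.zipWith (λ { (d≺e , here refl) → contradiction d≺e (≺-asym (All.lookup a≺ d∈)) ; (_ , there e∈) → e∈ }) (d≺ , D⊆)))
open Subsets

rowOf : Box → ℕ
rowOf (staircase i _)  = i
rowOf (horizontal _ _) = 0
rowOf (vertical _ _)   = 0

-- The reading order of the staircase.
infix 4 _≺_
data _≺_ (b c : Box) : Set where
  next-row : rowOf b < rowOf c → b ≺ c
  same-row : rowOf b ≡ rowOf c → letter c < letter b → b ≺ c

≺-irrefl : ∀ {b} → ¬ b ≺ b
≺-irrefl (next-row q)   = ℕ.<-irrefl refl q
≺-irrefl (same-row _ q) = ℕ.<-irrefl refl q

≺-trans : ∀ {b c d} → b ≺ c → c ≺ d → b ≺ d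
≺-trans (next-row q)   (next-row r)    = next-row (ℕ.<-trans q r)
≺-trans (next-row q)   (same-row e _)  = next-row (subst (_ <_) e q)
≺-trans (same-row e _) (next-row r)    = next-row (subst (_< _) (sym e) r)
≺-trans (same-row e q) (same-row e′ r) = same-row (trans e e′) (ℕ.<-trans r q)

≺-asym : ∀ {b c} → b ≺ c → ¬ c ≺ b
≺-asym b≺c c≺b = ≺-irrefl (≺-trans b≺c c≺b)

module Staircase (m : ℕ) where

  stairs : List Box
  stairs = concatMap (row m) (upTo m)

  InStaircase : Box → Set
  InStaircase b = ∃₂ λ i j → b ≡ staircase i j × i + j < m

  stairs-InStaircase : All InStaircase stairs
  stairs-InStaircase = All.concat⁺ (All.map⁺ (All.applyUpTo⁺₁ _ m λ {i} i<m →
    All.map⁺ (All.applyDownFrom⁺₁ _ (m ∸ i) λ {j} j< →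
      i , j , refl , subst (i + j <_) (ℕ.m+[n∸m]≡n (ℕ.<⇒≤ i<m)) (ℕ.+-monoʳ-< i j<))))

  ∈-stairs : ∀ {i j} → i + j < m → staircase i j ∈ stairs
  ∈-stairs {i} {j} q = ∈-concatMap⁺ (row m) (Any.map (λ { refl →
      ∈-map⁺ (staircase i) (∈-downFrom⁺ (ℕ.m+n≤o⇒m≤o∸n (suc j) (subst (_≤ m) (cong suc (ℕ.+-comm i j)) q))) })
    (∈-upTo⁺ (ℕ.≤-<-trans (ℕ.m≤m+n i j) q)))

  stairs-sorted : AllPairs _≺_ stairs
  stairs-sorted = AllPairs.concat⁺
    (All.map⁺ (All.applyUpTo⁺₁ _ m λ {i} _ →
      AllPairs.map⁺ (AllPairs.applyDownFrom⁺₁ _ (m ∸ i) λ k<j _ → same-row refl (s≤s (ℕ.+-monoʳ-< i k<j)))))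
    (AllPairs.map⁺ (AllPairs.applyUpTo⁺₁ _ m λ {i} {j} i<j _ →
      All.map⁺ (All.applyDownFrom⁺₂ _ (m ∸ i) λ _ → All.map⁺ (All.applyDownFrom⁺₂ _ (m ∸ j) λ _ → next-row i<j))))

  -- Along the reading order the rows increase weakly, and within a row the letters decrease
  -- strictly: these are the conditions of z-admissibility.
  zPair : List Box → Word × List ℕ
  zPair D = map letter D , map rowOf D

  zPairs : List (Word × List ℕ)
  zPairs = map zPair (subsets stairs)

  monomialOf-stairs : ∀ {D} → All InStaircase D → monomialOf D ≈ z^ (map rowOf D)
  monomialOf-stairs []                         = ≈-refl
  monomialOf-stairs ((i , j , refl , _) ∷ D⊆) = ⊗-cong ≈-refl (monomialOf-stairs D⊆)

  sumOver-stairs : ∀ (g : Word → Poly XZ) → sumOver (subsets stairs) (λ D → monomialOf D ⊗ g (map letter D)) ≈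
                   sumOver zPairs (λ (b , js) → z^ js ⊗ g b)
  sumOver-stairs g = ≈-trans
    (sumOver-cong-All (All.map (λ D⊆ → ⊗-cong (monomialOf-stairs D⊆) ≈-refl) (subsets-All stairs-InStaircase)))
    (≡⇒≈ (sym (sumOver-map zPair (subsets stairs) _)))

  zip-zPair : ∀ D → zip (map rowOf D) (map letter D) ≡ map (λ b → rowOf b , letter b) D
  zip-zPair []      = refl
  zip-zPair (b ∷ D) = cong (_ ∷_) (zip-zPair D)

  zPair-admissible : ∀ {D} → All InStaircase D → AllPairs _≺_ D → zAdmissible (map letter D) (map rowOf D)
  zPair-admissible {D} D⊆ D↗ =
    pointwise D⊆ ,
    Linked.map⁺ (Linked.map (λ { (next-row q) → ℕ.<⇒≤ q ; (same-row e _) → ℕ.≤-reflexive e }) (Linked.AllPairs⇒Linked D↗)) ,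
    subst (Linked _) (sym (zip-zPair D))
      (Linked.map⁺ (Linked.map (λ { (next-row q) e → contradiction e (ℕ.<⇒≢ q) ; (same-row _ q) _ → q }) (Linked.AllPairs⇒Linked D↗)))
    where
    pointwise : ∀ {D} → All InStaircase D → Pointwise _<_ (map rowOf D) (map letter D)
    pointwise []                        = []
    pointwise ((i , j , refl , _) ∷ D⊆) = s≤s (ℕ.m≤m+n i j) ∷ pointwise D⊆

  zPairs-sound : All (λ (b , js) → zAdmissible b js × All (λ a → 1 ≤ a × a < suc m) b) zPairs
  zPairs-sound = All.map⁺ (All.zipWith
    (λ (D⊆ , D↗) → zPair-admissible D⊆ D↗ , All.map⁺ (All.map (λ { (i , j , refl , q) → s≤s z≤n , s≤s q }) D⊆))
    (subsets-All stairs-InStaircase , subsets-AllPairs stairs-sorted))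

  private
    boxes : ∀ {b js} → All (_< suc m) b → Pointwise _<_ js b → ∃ λ D → (b , js) ≡ zPair D × All (_∈ stairs) D
    boxes [] [] = [] , refl , []
    boxes {suc a ∷ b} {j ∷ js} (s≤s a<m ∷ b<n) (s≤s j≤a ∷ js<b) with D , e , D⊆ ← boxes b<n js<b =
      -- In row j the letter a + 1 stands in column a - j.
      staircase j (a ∸ j) ∷ D ,
      cong₂ _,_ (cong₂ _∷_ (cong suc (sym (ℕ.m+[n∸m]≡n j≤a))) (cong proj₁ e)) (cong (j ∷_) (cong proj₂ e)) ,
      ∈-stairs (subst (_< m) (sym (ℕ.m+[n∸m]≡n j≤a)) a<m) ∷ D⊆
    combine : ∀ {b c} → rowOf b ≤ rowOf c → (rowOf b ≡ rowOf c → letter b > letter c) → b ≺ c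
    combine {b} {c} q r with rowOf b ℕ.≟ rowOf c
    ... | yes e = same-row e (r e)
    ... | no ¬e = next-row (ℕ.≤∧≢⇒< q ¬e)

  zPairs-complete : ∀ {b js} → All (_< suc m) b → zAdmissible b js → (b , js) ∈ zPairs
  zPairs-complete {b} {js} b<n (js<b , js↗ , ties) with D , refl , D⊆ ← boxes b<n js<b =
    ∈-map⁺ zPair (sorted-∈subsets ≺-irrefl ≺-asym stairs-sorted
      (Linked.Linked⇒AllPairs ≺-trans (Linked.zipWith (λ (q , r) → combine q r)
        (Linked.map⁻ js↗ , Linked.map⁻ (subst (Linked _) (zip-zPair D) ties))))
      D⊆)

  zPair-injective : ∀ {D E} → All InStaircase D → All InStaircase E → zPair D ≡ zPair E → D ≡ E
  zPair-injective [] [] _ = refl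
  zPair-injective ((i , j , refl , _) ∷ D⊆) ((k , l , refl , _) ∷ E⊆) e
    with refl ← List.∷-injectiveˡ (cong proj₂ e)
    with refl ← ℕ.+-cancelˡ-≡ i j l (ℕ.suc-injective (List.∷-injectiveˡ (cong proj₁ e)))
    = cong (staircase i j ∷_) (zPair-injective D⊆ E⊆
        (cong₂ _,_ (List.∷-injectiveʳ (cong proj₁ e)) (List.∷-injectiveʳ (cong proj₂ e))))

  zPairs-unique : Unique zPairs
  zPairs-unique = AllPairs.map⁺ (AllPairs-mapAll (λ D⊆ E⊆ D≢E e → D≢E (zPair-injective D⊆ E⊆ e))
    (subsets-All stairs-InStaircase)
    (subsets-unique (AllPairs.map (λ { b≺c refl → ≺-irrefl b≺c }) stairs-sorted)))

-- The Γ-blocks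

NoPeak : Word → Set
NoPeak a = ∀ i → ¬ Peak a i

NoStutter : Word → Set
NoStutter = Linked _≢_

noPeak-∷ : ∀ {n v} → All (_≤ n) v → NoPeak v → NoPeak (n ∷ v)
noPeak-∷ (b≤n ∷ _) _    _ (here n<b _) = ℕ.<⇒≱ n<b b≤n
noPeak-∷ _         flat _ (there q)    = flat _ q

noPeak-∷ʳ : ∀ {n v} → All (_< n) v → NoPeak v → NoPeak (v ∷ʳ n)
noPeak-∷ʳ {v = []}            _                 _    _ (there ())
noPeak-∷ʳ {v = _ ∷ []}        _                 _    _ (there (there ()))
noPeak-∷ʳ {v = _ ∷ _ ∷ []}    (_ ∷ b<n ∷ [])    _    _ (here _ b>n) = ℕ.<-asym b<n b>n
noPeak-∷ʳ {v = _ ∷ _ ∷ _ ∷ _} _                 flat _ (here q r)   = flat _ (here q r)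
noPeak-∷ʳ {v = _ ∷ _ ∷ _}     (_ ∷ v<n)         flat _ (there q)    = noPeak-∷ʳ v<n (λ i r → flat _ (there r)) _ q

Peak-++ : ∀ {a i} b → Peak a i → Peak (a ++ b) i
Peak-++ b (here q r) = here q r
Peak-++ b (there q)  = there (Peak-++ b q)

Peak-shift : ∀ v {a i} → Peak a i → Peak (v ++ a) (length v + i)
Peak-shift []      q = q
Peak-shift (_ ∷ v) q = there (Peak-shift v q)

Peak-≥2 : ∀ {a i} → Peak a i → 2 ≤ i
Peak-≥2 (here _ _) = ℕ.≤-refl
Peak-≥2 (there q)  = ℕ.m≤n⇒m≤1+n (Peak-≥2 q)

Flat-≥2 : ∀ {js i} → Flat js i → 2 ≤ i
Flat-≥2 here      = ℕ.≤-refl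
Flat-≥2 (there q) = ℕ.m≤n⇒m≤1+n (Flat-≥2 q)

module _ {A : Set} {R : A → A → Set} where

  Linked-++⁻ˡ : ∀ as {bs} → Linked R (as ++ bs) → Linked R as
  Linked-++⁻ˡ []           _       = []
  Linked-++⁻ˡ (a ∷ [])     _       = [-]
  Linked-++⁻ˡ (a ∷ b ∷ as) (r ∷ l) = r ∷ Linked-++⁻ˡ (b ∷ as) l

  Linked-++⁻ʳ : ∀ as {bs} → Linked R (as ++ bs) → Linked R bs
  Linked-++⁻ʳ []       l = l
  Linked-++⁻ʳ (a ∷ as) l = Linked-++⁻ʳ as (Linked.tail l)

-- The words read off a Γ-block of size suc n, grouped by the word v that
-- the boxes of index less than n contribute.
expand : ℕ → Word → List Word
expand n []        = [] ∷ (n ∷ []) ∷ []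
expand n v@(_ ∷ _) = v ∷ (n ∷ v) ∷ (v ∷ʳ n) ∷ (n ∷ v ∷ʳ n) ∷ []

-- The words that first strictly decrease and then strictly increase. They are built from the inside
-- out, since the largest letter can only stand at an end.
valleys : ℕ → List Word
valleys zero    = [] ∷ []
valleys (suc n) = concatMap (expand n) (valleys n)

valleys-sound : ∀ n → All (λ v → All (_< n) v × NoPeak v) (valleys n)
valleys-sound zero    = ([] , λ _ ()) ∷ []
valleys-sound (suc n) = All.concat⁺ (All.map⁺ (All.map step (valleys-sound n)))
  where
  step : ∀ {v} → All (_< n) v × NoPeak v → All (λ v → All (_< suc n) v × NoPeak v) (expand n v)
  step {[]} _ = ([] , λ _ ()) ∷ (ℕ.≤-refl ∷ [] , λ { _ (there ()) }) ∷ []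
  step {v@(_ ∷ _)} (v<n , flat) =
    (v≤n , flat) ∷
    (ℕ.≤-refl ∷ v≤n , noPeak-∷ (All.map ℕ.<⇒≤ v<n) flat) ∷
    (vn≤n , noPeak-∷ʳ v<n flat) ∷
    (ℕ.≤-refl ∷ vn≤n , noPeak-∷ (All.map ℕ.≤-pred vn≤n) (noPeak-∷ʳ v<n flat)) ∷ []
    where
    v≤n : All (_< suc n) v
    v≤n = All.map ℕ.m<n⇒m<1+n v<n
    vn≤n : All (_< suc n) (v ∷ʳ n)
    vn≤n = All.++⁺ v≤n (ℕ.≤-refl ∷ [])

-- An interior n would exceed both neighbours, which differ from it, and so be a peak.
split-last : ∀ {n e} v → All (_< suc n) (e ∷ v) → e ≢ n → NoPeak (e ∷ v) → NoStutter (e ∷ v) →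
             All (_< n) (e ∷ v) ⊎ ∃ λ u → v ≡ u ∷ʳ n × All (_< n) (e ∷ u)
split-last [] (e≤n ∷ _) e≢n _ _ = inj₁ (ℕ.≤∧≢⇒< (ℕ.≤-pred e≤n) e≢n ∷ [])
split-last {n} (b ∷ v) (e≤n ∷ b≤n ∷ v≤n) e≢n flat (e≢b ∷ v≢) with b ℕ.≟ n
split-last {n} (b ∷ []) (e≤n ∷ _) e≢n flat _ | yes refl = inj₂ ([] , refl , ℕ.≤∧≢⇒< (ℕ.≤-pred e≤n) e≢n ∷ [])
split-last {n} (b ∷ c ∷ v) (e≤n ∷ b≤n ∷ c≤n ∷ v≤n) e≢n flat (e≢b ∷ b≢c ∷ v≢) | yes refl =
  ⊥-elim (flat 2 (here (ℕ.≤∧≢⇒< (ℕ.≤-pred e≤n) e≢n) (ℕ.≤∧≢⇒< (ℕ.≤-pred c≤n) (b≢c ∘ sym))))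
... | no b≢n with split-last v (b≤n ∷ v≤n) b≢n (λ i q → flat (suc i) (there q)) v≢
...   | inj₁ bv<n              = inj₁ (ℕ.≤∧≢⇒< (ℕ.≤-pred e≤n) e≢n ∷ bv<n)
...   | inj₂ (u , refl , bu<n) = inj₂ (b ∷ u , refl , ℕ.≤∧≢⇒< (ℕ.≤-pred e≤n) e≢n ∷ bu<n)

valleys-complete : ∀ n v → All (_< n) v → NoPeak v → NoStutter v → v ∈ valleys n
valleys-complete zero    []      _         _    _  = here refl
valleys-complete zero    (_ ∷ _) (() ∷ _)
valleys-complete (suc n) v v≤n flat v≢ = go v v≤n flat v≢
  where
  from-core : ∀ u {v} → All (_< n) u → NoPeak u → NoStutter u → v ∈ expand n u → v ∈ valleys (suc n)
  from-core u u<n flat u≢ v∈ = ∈-concatMap⁺ (expand n) (Any.map (λ { refl → v∈ }) (valleys-complete n u u<n flat u≢))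

  go : ∀ v → All (_< suc n) v → NoPeak v → NoStutter v → v ∈ valleys (suc n)
  go [] _ flat v≢ = from-core [] [] flat v≢ (here refl)
  go (e ∷ v) v≤n flat v≢ with e ℕ.≟ n
  ... | no e≢n with split-last v v≤n e≢n flat v≢
  ...   | inj₁ v<n              = from-core (e ∷ v) v<n flat v≢ (here refl)
  ...   | inj₂ (u , refl , u<n) = from-core (e ∷ u) u<n (λ i q → flat i (Peak-++ _ q)) (Linked-++⁻ˡ (e ∷ u) v≢)
                                    (there (there (here refl)))
  go (e ∷ []) v≤n flat v≢ | yes refl = from-core [] [] (λ _ ()) [] (there (here refl))
  go (e ∷ b ∷ v) (_ ∷ v≤n) flat (e≢b ∷ v≢) | yes refl with split-last v v≤n (e≢b ∘ sym) (λ i q → flat (suc i) (there q)) v≢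
  ...   | inj₁ v<n              = from-core (b ∷ v) v<n (λ i q → flat (suc i) (there q)) v≢ (there (here refl))
  ...   | inj₂ (u , refl , u<n) = from-core (b ∷ u) u<n (λ i q → flat (suc i) (there (Peak-++ _ q))) (Linked-++⁻ˡ (b ∷ u) v≢)
                                    (there (there (there (here refl))))

-- Deleting n recovers the inner word, so different inner words have disjoint expansions.
expand-core : ∀ {n v} → All (_< n) v → All (λ u → filter (ℕ._<? n) u ≡ v) (expand n v)
expand-core {n} {[]} _ = refl ∷ List.filter-reject (ℕ._<? n) (ℕ.<-irrefl refl) ∷ []
expand-core {n} {v@(_ ∷ _)} v<n =
  all-v ∷ trans n-reject all-v ∷ vn ∷ trans n-reject vn ∷ []
  where
  all-v : filter (ℕ._<? n) v ≡ v
  all-v = List.filter-all (ℕ._<? n) v<n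
  n-reject : ∀ {u} → filter (ℕ._<? n) (n ∷ u) ≡ filter (ℕ._<? n) u
  n-reject = List.filter-reject (ℕ._<? n) (ℕ.<-irrefl refl)
  vn : filter (ℕ._<? n) (v ∷ʳ n) ≡ v
  vn = trans (List.filter-++ (ℕ._<? n) v (n ∷ [])) (trans (cong₂ _++_ all-v n-reject) (List.++-identityʳ v))

expand-unique : ∀ {n v} → All (_< n) v → Unique (expand n v)
expand-unique {v = []} _ = ((λ ()) ∷ []) ∷ [] ∷ []
expand-unique {n} {v@(e ∷ _)} (e<n ∷ _) =
  ((λ q → e≢n (List.∷-injectiveˡ q)) ∷ longer v ∷ (λ q → e≢n (List.∷-injectiveˡ q)) ∷ []) ∷
  ((λ q → e≢n (sym (List.∷-injectiveˡ q))) ∷ (λ q → longer v (List.∷-injectiveʳ q)) ∷ []) ∷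
  ((λ q → e≢n (List.∷-injectiveˡ q)) ∷ []) ∷
  [] ∷ []
  where
  e≢n : e ≢ n
  e≢n = ℕ.<⇒≢ e<n
  longer : ∀ u → u ≢ u ∷ʳ n
  longer u q = case List.++-identityʳ-unique u q of λ ()

concatMap-unique : ∀ {A B : Set} {f : A → List B} {as} → All (Unique ∘ f) as →
                   AllPairs (λ a a′ → ∀ {b} → b ∈ f a → ¬ b ∈ f a′) as → Unique (concatMap f as)
concatMap-unique us ds = Unique.concat⁺ (All.map⁺ us) (AllPairs.map⁺ (AllPairs.map (λ d {_} (b∈ , b∈′) → d b∈ b∈′) ds))

valleys-unique : ∀ n → Unique (valleys n)
valleys-unique zero    = [] ∷ []
valleys-unique (suc n) = concatMap-unique
  (All.map (expand-unique ∘ proj₁) (valleys-sound n))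
  (AllPairs-mapAll (λ { (u<n , _) (v<n , _) u≢v b∈u b∈v → u≢v
      (trans (sym (All.lookup (expand-core u<n) b∈u)) (All.lookup (expand-core v<n) b∈v)) })
    (valleys-sound n) (valleys-unique n))

-- What remains of reducedness when a block is treated inside a longer word: `g` stands for the
-- contribution of everything outside the block.
Vanishing : (Word → Poly XZ) → Set
Vanishing g = ∀ a i b → g (a ++ i ∷ i ∷ b) ≈ con 0ℚ

two : Poly XZ
two = con (ℤ.+ 2 ℚ./ 1)

two-⊗ : ∀ f → two ⊗ f ≈ f ⊕ f
two-⊗ f = ≈-trans (⊗-cong (con-+ 1ℚ 1ℚ) ≈-refl) (≈-trans (Ring.distribʳ _ _ _) (⊕-cong (⊗-idˡ _) (⊗-idˡ _)))

⊗-idʳ : ∀ {V} (f : Poly V) → f ⊗ con 1ℚ ≈ f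
⊗-idʳ f = ≈-trans (⊗-comm _ _) (⊗-idˡ f)

-- The smallest letter of a nonempty valley can be read off the horizontal
-- or the vertical part of the block.
multiplicity : Word → Poly XZ
multiplicity []      = con 1ℚ
multiplicity (_ ∷ _) = two

power : Poly XZ → Word → Poly XZ
power y v = ∏ (map (λ _ → y) v)

power-∷ʳ : ∀ y v {n} → power y (v ∷ʳ n) ≈ y ⊗ power y v
power-∷ʳ y v = ≈-trans (∏-++ (λ _ → y) v _) (≈-trans (⊗-comm _ _) (⊗-cong (⊗-idʳ y) ≈-refl))

-- The boxes of the largest index are the first and the last of the block. The four ways of choosing
-- them wrap the inner word and are absorbed into `g`, hence the quantification over all vanishing
-- `g`.
blockSum : ∀ n e g → Vanishing g →
  sumOver (subsets (Γ-block n e)) (λ D → monomialOf D ⊗ g (map letter D)) ≈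
  sumOver (valleys n) (λ v → multiplicity v ⊗ power (var (x e)) v ⊗ g v)
blockSum zero e g _ = ⊕-cong (⊗-cong (≈-sym (⊗-idˡ _)) ≈-refl) ≈-refl
blockSum (suc n) e g vanishing = begin
  sumOver (subsets (Γ-block (suc n) e)) F
    ≡⟨ cong (λ L → sumOver (subsets L) F) (cong (h ∷_) (trans
         (cong (λ L → map (horizontal e) (downFrom n) ++ L)
           (trans (cong (map (vertical e)) (sym (List.upTo-∷ʳ n))) (List.map-++ (vertical e) (upTo n) (n ∷ []))))
         (sym (List.++-assoc (map (horizontal e) (downFrom n)) (map (vertical e) (upTo n)) (u ∷ []))))) ⟩
  sumOver (subsets ((h ∷ Γ-block n e) ∷ʳ u)) F
    ≈⟨ sumOver-subsets-∷ʳ (h ∷ Γ-block n e) u F ⟩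
  sumOver (subsets (h ∷ Γ-block n e)) (λ D → F D ⊕ F (D ∷ʳ u))
    ≈⟨ sumOver-subsets-∷ h (Γ-block n e) _ ⟩
  sumOver (subsets (Γ-block n e)) (λ D → (F D ⊕ F (D ∷ʳ u)) ⊕ (F (h ∷ D) ⊕ F (h ∷ D ∷ʳ u)))
    ≈⟨ sumOver-cong (subsets (Γ-block n e)) regroup ⟩
  sumOver (subsets (Γ-block n e)) (λ D → monomialOf D ⊗ g′ (map letter D))
    ≈⟨ blockSum n e g′ vanishing′ ⟩
  sumOver (valleys n) (λ v → multiplicity v ⊗ power y v ⊗ g′ v)
    ≈⟨ sumOver-cong (valleys n) expanded ⟨
  sumOver (valleys n) (λ v → sumOver (expand n v) G)
    ≈⟨ sumOver-concatMap (expand n) (valleys n) G ⟨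
  sumOver (valleys (suc n)) G ∎
  where
  y = var (x e)
  h = horizontal e n
  u = vertical e n
  F : List Box → Poly XZ
  F D = monomialOf D ⊗ g (map letter D)
  G : Word → Poly XZ
  G v = multiplicity v ⊗ power y v ⊗ g v
  g′ : Word → Poly XZ
  g′ c = (g c ⊕ y ⊗ g (c ∷ʳ n)) ⊕ (y ⊗ g (n ∷ c) ⊕ y ⊗ (y ⊗ g (n ∷ c ∷ʳ n)))

  vanishing′ : Vanishing g′
  vanishing′ a i b = ≈-trans (⊕-cong
    (⊕-cong (vanishing a i b) (zero-⊗ (≈-trans (≡⇒≈ (cong g (assoc a))) (vanishing a i (b ∷ʳ n)))))
    (⊕-cong (zero-⊗ (vanishing (n ∷ a) i b))
            (zero-⊗ (zero-⊗ (≈-trans (≡⇒≈ (cong g (assoc (n ∷ a)))) (vanishing (n ∷ a) i (b ∷ʳ n)))))))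
    (≈-trans (⊕-cong (⊕-idˡ _) (⊕-idˡ _)) (⊕-idˡ _))
    where
    assoc : ∀ a → (a ++ i ∷ i ∷ b) ∷ʳ n ≡ a ++ i ∷ i ∷ b ∷ʳ n
    assoc a = List.++-assoc a (i ∷ i ∷ b) (n ∷ [])
    zero-⊗ : ∀ {f} → f ≈ con 0ℚ → y ⊗ f ≈ con 0ℚ
    zero-⊗ f≈0 = ≈-trans (⊗-cong ≈-refl f≈0) (Ring.zeroʳ y)

  open Solver {XZ} using (solve; _:+_; _:*_; _:=_)

  regroup : ∀ D → (F D ⊕ F (D ∷ʳ u)) ⊕ (F (h ∷ D) ⊕ F (h ∷ D ∷ʳ u)) ≈ monomialOf D ⊗ g′ (map letter D)
  regroup D = ≈-trans
    (⊕-cong (⊕-cong ≈-refl (⊗-cong mon-∷ʳ (≡⇒≈ (cong g (List.map-++ letter D (u ∷ []))))))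
            (⊕-cong ≈-refl (⊗-cong (⊗-cong ≈-refl mon-∷ʳ) (≡⇒≈ (cong (λ c → g (n ∷ c)) (List.map-++ letter D (u ∷ [])))))))
    (solve 6 (λ M y a b c d → (M :* a :+ M :* y :* b) :+ (y :* M :* c :+ y :* (M :* y) :* d)
        := M :* ((a :+ y :* b) :+ (y :* c :+ y :* (y :* d)))) ≈-refl
      (monomialOf D) y (g c) (g (c ∷ʳ n)) (g (n ∷ c)) (g (n ∷ c ∷ʳ n)))
    where
    c = map letter D
    mon-∷ʳ : monomialOf (D ∷ʳ u) ≈ monomialOf D ⊗ y
    mon-∷ʳ = ≈-trans (∏-++ _ D (u ∷ [])) (⊗-cong ≈-refl (⊗-idʳ y))

  expanded : ∀ v → sumOver (expand n v) G ≈ multiplicity v ⊗ power y v ⊗ g′ v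
  -- Around the empty word either single box gives the word n, whence the factor two, and both boxes
  -- give n n, where `g` vanishes.
  expanded [] = begin
    con 1ℚ ⊗ con 1ℚ ⊗ g [] ⊕ (two ⊗ (y ⊗ con 1ℚ) ⊗ gₙ ⊕ con 0ℚ)
      ≈⟨ ⊕-cong (⊗-cong (⊗-idˡ _) ≈-refl) (≈-trans (⊕-idʳ _) (≈-trans (⊗-assoc _ _ _) (≈-trans (two-⊗ _)
           (⊕-cong (⊗-cong (⊗-idʳ y) ≈-refl) (⊗-cong (⊗-idʳ y) ≈-refl))))) ⟩
    con 1ℚ ⊗ g [] ⊕ (y ⊗ gₙ ⊕ y ⊗ gₙ)
      ≈⟨ ⊕-cong (⊗-idˡ _) ≈-refl ⟩
    g [] ⊕ (y ⊗ gₙ ⊕ y ⊗ gₙ)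
      ≈⟨ ⊕-assoc _ _ _ ⟨
    (g [] ⊕ y ⊗ gₙ) ⊕ y ⊗ gₙ
      ≈⟨ ⊕-cong ≈-refl (≈-trans (⊕-cong ≈-refl (≈-trans (⊗-cong ≈-refl (≈-trans (⊗-cong ≈-refl (vanishing [] n [])) (Ring.zeroʳ y))) (Ring.zeroʳ y))) (⊕-idʳ _)) ⟨
    g′ []
      ≈⟨ ⊗-idˡ _ ⟨
    con 1ℚ ⊗ g′ []
      ≈⟨ ⊗-cong (⊗-idˡ _) ≈-refl ⟨
    con 1ℚ ⊗ con 1ℚ ⊗ g′ [] ∎
    where gₙ = g (n ∷ [])
  expanded v@(_ ∷ _) = ≈-trans
    (⊕-cong ≈-refl (⊕-cong ≈-refl (⊕-cong (⊗-cong (⊗-cong ≈-refl (power-∷ʳ y v)) ≈-refl)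
      (≈-trans (⊕-idʳ _) (⊗-cong (⊗-cong ≈-refl (⊗-cong ≈-refl (power-∷ʳ y v))) ≈-refl)))))
    (solve 7 (λ t P y a b c d → t :* P :* a :+ (t :* (y :* P) :* c :+ (t :* (y :* P) :* b :+ t :* (y :* (y :* P)) :* d))
        := t :* P :* ((a :+ y :* b) :+ (y :* c :+ y :* (y :* d)))) ≈-refl
      two (power y v) y (g v) (g (v ∷ʳ n)) (g (n ∷ v)) (g (n ∷ v ∷ʳ n)))

Peak-tail : ∀ {e a i} → 2 ≤ i → Peak (e ∷ a) (suc i) → Peak a i
Peak-tail (s≤s ()) (here _ _)
Peak-tail _        (there q) = q

-- Three equal neighbours cannot straddle the border, as the entries of `js` are below k; so they
-- lie over `v`, which has no peak, or over `a`.
noPeak-Peak-Flat : ∀ v {k js a i} → NoPeak v → All (_< k) js → (∀ i → Flat js i → ¬ Peak a i) →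
                   Flat (replicate (length v) k ++ js) i → ¬ Peak (v ++ a) i
noPeak-Peak-Flat [] _ _ admissible f q = admissible _ f q
noPeak-Peak-Flat (_ ∷ []) _ (k<k ∷ _) _ here _ = ℕ.<-irrefl refl k<k
noPeak-Peak-Flat (_ ∷ []) flat js<k admissible (there f) q =
  noPeak-Peak-Flat [] (λ _ ()) js<k admissible f (Peak-tail (Flat-≥2 f) q)
noPeak-Peak-Flat (_ ∷ _ ∷ []) _ (k<k ∷ _) _ here _ = ℕ.<-irrefl refl k<k
noPeak-Peak-Flat (_ ∷ v@(_ ∷ [])) flat js<k admissible (there f) q =
  noPeak-Peak-Flat v (λ i r → flat (suc i) (there r)) js<k admissible f (Peak-tail (Flat-≥2 f) q)
noPeak-Peak-Flat (_ ∷ _ ∷ _ ∷ _) flat _ _ here (here q r) = flat 2 (here q r)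
noPeak-Peak-Flat (_ ∷ _ ∷ _ ∷ _) _ _ _ here (there q) = case Peak-≥2 q of λ { (s≤s ()) }
noPeak-Peak-Flat (_ ∷ v@(_ ∷ _ ∷ _)) flat js<k admissible (there f) q =
  noPeak-Peak-Flat v (λ i r → flat (suc i) (there r)) js<k admissible f (Peak-tail (Flat-≥2 f) q)

Peak⇒Flat : ∀ {v i} k js → Peak v i → Flat (replicate (length v) k ++ js) i
Peak⇒Flat k js (here _ _) = here
Peak⇒Flat k js (there q)  = there (Peak⇒Flat k js q)

Flat-shift : ∀ is {js i} → Flat js i → Flat (is ++ js) (length is + i)
Flat-shift []       f = f
Flat-shift (_ ∷ is) f = there (Flat-shift is f)

replicate-descending : ∀ r {k js} → All (_< k) js → Linked (λ j j′ → j′ ≤ j) js →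
                       Linked (λ j j′ → j′ ≤ j) (replicate r k ++ js)
replicate-descending zero          _          l = l
replicate-descending (suc zero)    []         l = [-]
replicate-descending (suc zero)    (j<k ∷ _)  l = ℕ.<⇒≤ j<k ∷ l
replicate-descending (suc (suc r)) js<k       l = ℕ.≤-refl ∷ replicate-descending (suc r) js<k l

-- The largest index k fills a prefix of a weakly decreasing sequence, and admissibility says that
-- the corresponding prefix of the word has no peak.
xPairs : ℕ → ℕ → List (Word × List ℕ)
xPairs n zero    = ([] , []) ∷ []
xPairs n (suc k) = concatMap (λ v → map (λ (a , js) → v ++ a , replicate (length v) k ++ js) (xPairs n k)) (valleys n)

xPairs-sound : ∀ n k → All (λ (a , js) → xAdmissible a js × All (_< k) js) (xPairs n k)
xPairs-sound n zero    = ((refl , [] , λ _ ()) , []) ∷ []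
xPairs-sound n (suc k) = All.concat⁺ (All.map⁺ (All.map (λ {v} (_ , flat) →
  All.map⁺ (All.map (λ { {a , js} ((len , js↘ , admissible) , js<k) →
    ( trans (List.length-++ (replicate (length v) k))
        (trans (cong₂ _+_ (List.length-replicate (length v)) len) (sym (List.length-++ v)))
    , replicate-descending (length v) js<k js↘
    , λ i → noPeak-Peak-Flat v flat js<k admissible) ,
    All.++⁺ (All.replicate⁺ (length v) ℕ.≤-refl) (All.map ℕ.m<n⇒m<1+n js<k) }) (xPairs-sound n k)))
  (valleys-sound n)))

leading : ∀ {k js} → Linked (λ j j′ → j′ ≤ j) js → All (_< suc k) js →
          ∃₂ λ r js′ → js ≡ replicate r k ++ js′ × All (_< k) js′
leading {js = []} _ _ = 0 , [] , refl , []
leading {k} {j ∷ js} l (j≤k ∷ js≤k) with j ℕ.≟ k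
... | yes refl with r , js′ , refl , js′<k ← leading (Linked.tail l) js≤k = suc r , js′ , refl , js′<k
... | no j≢k = 0 , j ∷ js , refl , j<k ∷ below l
  where
  j<k : j < k
  j<k = ℕ.≤∧≢⇒< (ℕ.≤-pred j≤k) j≢k
  below : ∀ {js} → Linked (λ j j′ → j′ ≤ j) (j ∷ js) → All (_< k) js
  below l = All.map (λ q → ℕ.≤-<-trans q j<k) (AllPairs.head (Linked.Linked⇒AllPairs (λ q r → ℕ.≤-trans r q) l))

split-length : ∀ r (a : Word) {l} → r + l ≡ length a → ∃₂ λ v a′ → a ≡ v ++ a′ × length v ≡ r × l ≡ length a′
split-length zero    a       e = [] , a , refl , refl , e
split-length (suc r) (c ∷ a) e with v , a′ , refl , ∣v∣ , ∣a′∣ ← split-length r a (ℕ.suc-injective e) =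
  c ∷ v , a′ , refl , cong suc ∣v∣ , ∣a′∣

xPairs-complete : ∀ n k {a js} → All (_< n) a → NoStutter a → xAdmissible a js → All (_< k) js → (a , js) ∈ xPairs n k
xPairs-complete n zero {[]} {[]} _ _ _ _ = here refl
xPairs-complete n zero {_} {_ ∷ _} _ _ _ (() ∷ _)
xPairs-complete n zero {_ ∷ _} {[]} _ _ (() , _) _
xPairs-complete n (suc k) {a} {js} a<n a≢ (len , js↘ , admissible) js≤k
  with r , js′ , refl , js′<k ← leading js↘ js≤k
  with v , a′ , refl , refl , len′ ← split-length r a (trans (sym (trans (List.length-++ (replicate r k))
         (cong (_+ length js′) (List.length-replicate r)))) len)
  = ∈-concatMap⁺ _ (Any.map (λ { refl → ∈-map⁺ _ (xPairs-complete n k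
        (All.++⁻ʳ v a<n) (Linked-++⁻ʳ v a≢)
        ( len′
        , Linked-++⁻ʳ (replicate (length v) k) js↘
        , λ i f q → admissible (length v + i)
            (subst (λ l → Flat (replicate (length v) k ++ js′) (l + i)) (List.length-replicate (length v))
              (Flat-shift (replicate (length v) k) f))
            (Peak-shift v q))
        js′<k) })
      (valleys-complete n v (All.++⁻ˡ v a<n) (λ i q → admissible i (Peak⇒Flat k js′ q) (Peak-++ a′ q)) (Linked-++⁻ˡ v a≢)))

replicate-injective : ∀ r r′ {k js js′} → All (_< k) js → All (_< k) js′ →
                      replicate r k ++ js ≡ replicate r′ k ++ js′ → r ≡ r′
replicate-injective zero    zero     _         _ _ = refl
replicate-injective zero    (suc r′) (j<k ∷ _) _ e = contradiction (List.∷-injectiveˡ e) (ℕ.<⇒≢ j<k)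
replicate-injective (suc r) zero     _ (j<k ∷ _) e = contradiction (sym (List.∷-injectiveˡ e)) (ℕ.<⇒≢ j<k)
replicate-injective (suc r) (suc r′) js<k js′<k  e = cong suc (replicate-injective r r′ js<k js′<k (List.∷-injectiveʳ e))

++-prefix-injective : ∀ (v v′ : Word) {a a′} → length v ≡ length v′ → v ++ a ≡ v′ ++ a′ → v ≡ v′
++-prefix-injective []      []        _ _ = refl
++-prefix-injective (_ ∷ v) (_ ∷ v′) l e =
  cong₂ _∷_ (List.∷-injectiveˡ e) (++-prefix-injective v v′ (ℕ.suc-injective l) (List.∷-injectiveʳ e))

-- The multiplicity of the largest index gives the length of the valley, and the word then gives the
-- valley itself.
xPairs-unique : ∀ n k → Unique (xPairs n k)
xPairs-unique n zero    = [] ∷ []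
xPairs-unique n (suc k) = concatMap-unique
  (All.universal (λ v → Unique.map⁺ (λ {(a , js)} {(a′ , js′)} e → cong₂ _,_
      (List.++-cancelˡ v a a′ (cong proj₁ e))
      (List.++-cancelˡ (replicate (length v) k) js js′ (cong proj₂ e)))
    (xPairs-unique n k)) (valleys n))
  (AllPairs.map (λ {v} {v′} v≢v′ {_} b∈ b∈′ → disjoint v≢v′ (∈-map⁻ _ b∈) (∈-map⁻ _ b∈′)) (valleys-unique n))
  where
  disjoint : ∀ {v v′ b} → v ≢ v′ →
    (∃ λ (aj : Word × List ℕ) → aj ∈ xPairs n k × b ≡ (v ++ proj₁ aj , replicate (length v) k ++ proj₂ aj)) →
    ¬ (∃ λ (aj : Word × List ℕ) → aj ∈ xPairs n k × b ≡ (v′ ++ proj₁ aj , replicate (length v′) k ++ proj₂ aj))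
  disjoint {v} {v′} v≢v′ (aj , aj∈ , refl) (aj′ , aj′∈ , e) = v≢v′ (++-prefix-injective v v′
    (replicate-injective (length v) (length v′)
      (proj₂ (All.lookup (xPairs-sound n k) aj∈)) (proj₂ (All.lookup (xPairs-sound n k) aj′∈)) (cong proj₂ e))
    (cong proj₁ e))

deduplicate-replicate : ∀ r {k js} → All (_< k) js →
  deduplicate ℕ._≟_ (k ∷ replicate r k ++ js) ≡ k ∷ deduplicate ℕ._≟_ js
deduplicate-replicate zero {k} js<k =
  cong (k ∷_) (List.filter-all (λ j → ¬? (k ℕ.≟ j)) (All.deduplicate⁺ ℕ._≟_ (All.map (λ j<k e → ℕ.<⇒≢ j<k (sym e)) js<k)))
deduplicate-replicate (suc r) {k} {js} js<k = cong (k ∷_) (trans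
  (cong (filter ≢k?) (deduplicate-replicate r js<k))
  (trans (List.filter-reject ≢k? (λ k≢k → k≢k refl))
    (List.filter-all ≢k? (All.deduplicate⁺ ℕ._≟_ (All.map (λ j<k e → ℕ.<⇒≢ j<k (sym e)) js<k)))))
  where ≢k? = λ j → ¬? (k ℕ.≟ j)

xWeight : List ℕ → Poly XZ
xWeight js = two ^ᵖ #variables js ⊗ x^ js

power-replicate : ∀ v k → power (var (x k)) v ≡ x^ (replicate (length v) k)
power-replicate []      k = refl
power-replicate (_ ∷ v) k = cong (var (x k) ⊗_) (power-replicate v k)

-- A nonempty valley brings one new variable and one factor two; this is the source of the power of
-- 2 in the theorem.
xWeight-replicate : ∀ v {k js} → All (_< k) js →
  multiplicity v ⊗ power (var (x k)) v ⊗ xWeight js ≈ xWeight (replicate (length v) k ++ js)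
xWeight-replicate [] _ = ≈-trans (⊗-cong (⊗-idˡ _) ≈-refl) (⊗-idˡ _)
xWeight-replicate (e ∷ v) {k} {js} js<k = begin
  two ⊗ power y (e ∷ v) ⊗ (two ^ᵖ #variables js ⊗ x^ js)
    ≈⟨ solve 4 (λ t P T X → t :* P :* (T :* X) := (t :* T) :* (P :* X)) ≈-refl _ _ _ _ ⟩
  two ^ᵖ suc (#variables js) ⊗ (power y (e ∷ v) ⊗ x^ js)
    ≈⟨ ⊗-cong (≡⇒≈ (cong (λ d → two ^ᵖ length d) (sym (deduplicate-replicate (length v) js<k))))
              (⊗-cong (≡⇒≈ (power-replicate (e ∷ v) k)) ≈-refl) ⟩
  two ^ᵖ #variables (replicate (length (e ∷ v)) k ++ js) ⊗ (x^ (replicate (length (e ∷ v)) k) ⊗ x^ js)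
    ≈⟨ ⊗-cong ≈-refl (∏-++ (λ i → var (x i)) (replicate (length (e ∷ v)) k) js) ⟨
  xWeight (replicate (length (e ∷ v)) k ++ js) ∎
  where
  open Solver {XZ} using (solve; _:*_; _:=_)
  y = var (x k)

ΓsSum : ∀ n k g → Vanishing g →
  sumOver (subsets (concatMap (Γ-block n) (downFrom k))) (λ D → monomialOf D ⊗ g (map letter D)) ≈
  sumOver (xPairs n k) (λ (a , js) → xWeight js ⊗ g a)
ΓsSum n zero    g _ = ⊕-cong (⊗-cong (≈-sym (⊗-idˡ _)) ≈-refl) ≈-refl
ΓsSum n (suc k) g vanishing = begin
  sumOver (subsets (Γ-block n k ++ Γs)) (λ D → monomialOf D ⊗ g (map letter D))
    ≈⟨ sumOver-subsets-++ (Γ-block n k) Γs _ ⟩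
  sumOver (subsets (Γ-block n k)) (λ D → sumOver (subsets Γs) (λ E → monomialOf (D ++ E) ⊗ g (map letter (D ++ E))))
    ≈⟨ sumOver-cong (subsets (Γ-block n k)) (λ D → ≈-trans
         (sumOver-cong (subsets Γs) (λ E → ≈-trans
           (⊗-cong (∏-++ _ D E) (≡⇒≈ (cong g (List.map-++ letter D E)))) (⊗-assoc _ _ _)))
         (≈-sym (sumOver-⊗ (subsets Γs) (monomialOf D) _))) ⟩
  sumOver (subsets (Γ-block n k)) (λ D → monomialOf D ⊗ G (map letter D))
    ≈⟨ blockSum n k G (λ a i b → sumOver-0 (subsets Γs) λ E → ≈-trans
         (⊗-cong ≈-refl (≈-trans (≡⇒≈ (cong g (List.++-assoc a (i ∷ i ∷ b) (map letter E)))) (vanishing a i (b ++ map letter E))))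
         (Ring.zeroʳ _)) ⟩
  sumOver (valleys n) (λ v → multiplicity v ⊗ power (var (x k)) v ⊗ G v)
    ≈⟨ sumOver-cong (valleys n) (λ v → ⊗-cong ≈-refl (ΓsSum n k (λ c → g (v ++ c))
         (λ a i b → ≈-trans (≡⇒≈ (cong g (sym (List.++-assoc v a (i ∷ i ∷ b))))) (vanishing (v ++ a) i b)))) ⟩
  sumOver (valleys n) (λ v → multiplicity v ⊗ power (var (x k)) v ⊗ sumOver (xPairs n k) (λ (a , js) → xWeight js ⊗ g (v ++ a)))
    ≈⟨ sumOver-cong (valleys n) (λ v → ≈-trans (sumOver-⊗ (xPairs n k) _ _)
         (≈-trans (sumOver-cong-All (All.map (λ (_ , js<k) → ≈-trans (≈-sym (⊗-assoc _ _ _))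
             (⊗-cong (xWeight-replicate v js<k) ≈-refl)) (xPairs-sound n k)))
           (≡⇒≈ (sym (sumOver-map _ (xPairs n k) _))))) ⟩
  sumOver (valleys n) (λ v → sumOver (map (λ (a , js) → v ++ a , replicate (length v) k ++ js) (xPairs n k))
    (λ (a , js) → xWeight js ⊗ g a))
    ≈⟨ sumOver-concatMap _ (valleys n) _ ⟨
  sumOver (xPairs n (suc k)) (λ (a , js) → xWeight js ⊗ g a) ∎
  where
  Γs = concatMap (Γ-block n) (downFrom k)
  G : Word → Poly XZ
  G c = sumOver (subsets Γs) (λ E → monomialOf E ⊗ g (c ++ map letter E))

-- Factorizations of w

module _ {V : Set} {A : Set} {Q : A → Set} (Q? : ∀ a → Dec (Q a)) (f : Poly V) where

  sumOver-none : ∀ {as} → All (¬_ ∘ Q) as → sumOver as (λ a → gate (Q? a) f) ≈ con 0ℚ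
  sumOver-none []         = ≈-refl
  sumOver-none (¬q ∷ ¬qs) = ≈-trans (⊕-cong (gate-no (Q? _) ¬q) (sumOver-none ¬qs)) (⊕-idˡ _)

  sumOver-single : ∀ {as} → AllPairs (λ a b → ¬ (Q a × Q b)) as → Any Q as → sumOver as (λ a → gate (Q? a) f) ≈ f
  sumOver-single (¬qs ∷ _) (here q) =
    ≈-trans (⊕-cong (gate-yes (Q? _) q) (sumOver-none (All.map (λ ¬qq q′ → ¬qq (q , q′)) ¬qs))) (⊕-idʳ _)
  sumOver-single (¬qs ∷ ps) (there qs) =
    ≈-trans (⊕-cong (gate-no (Q? _) (λ q → let ¬qq , q′ = All.lookupAny ¬qs qs in ¬qq (q , q′))) (sumOver-single ps qs)) (⊕-idˡ _)

sumsTo : ∀ {V} {S : Setoid 0ℓ 0ℓ} {P : Setoid.Carrier S → Set} {F : Setoid.Carrier S → Poly V → Set} {t}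
         (as : List (Setoid.Carrier S)) → UniqueSetoid.Unique S as → (∀ a → P a ⇔ Membership._∈_ S a as) →
         (h : Setoid.Carrier S → Poly V) → (∀ a → P a → F a (h a)) → t ≈ sumOver as h → SumsTo S P F t
sumsTo {S = S} {P} {F} as as! P⇔∈ h Fh t≈ =
  as , as! , P⇔∈ , map h as , pointwise (All.tabulateₛ S λ {a} a∈ → Fh a (Equivalence.from (P⇔∈ a) a∈)) , t≈
  where
  pointwise : ∀ {as} → All (λ a → F a (h a)) as → Pointwise F as (map h as)
  pointwise []       = []
  pointwise (q ∷ qs) = q ∷ pointwise qs

-- Pipe dreams as sets of significant boxes

blank mark : ∀ b → Tile b
blank (staircase _ _)        = doubleElbow
blank (horizontal _ zero)    = singleElbow
blank (horizontal _ (suc _)) = doubleElbow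
blank (vertical _ zero)      = singleElbow
blank (vertical _ (suc _))   = doubleElbow
mark (staircase _ _)        = cross
mark (horizontal _ zero)    = faucetElbow
mark (horizontal _ (suc _)) = cross
mark (vertical _ zero)      = faucetElbow
mark (vertical _ (suc _))   = cross

blank-or-mark : ∀ b (t : Tile b) → t ≡ blank b ⊎ t ≡ mark b
blank-or-mark (staircase _ _)        doubleElbow = inj₁ refl
blank-or-mark (staircase _ _)        cross       = inj₂ refl
blank-or-mark (horizontal _ zero)    singleElbow = inj₁ refl
blank-or-mark (horizontal _ zero)    faucetElbow = inj₂ refl
blank-or-mark (horizontal _ (suc _)) doubleElbow = inj₁ refl
blank-or-mark (horizontal _ (suc _)) cross       = inj₂ refl
blank-or-mark (vertical _ zero)      singleElbow = inj₁ refl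
blank-or-mark (vertical _ zero)      faucetElbow = inj₂ refl
blank-or-mark (vertical _ (suc _))   doubleElbow = inj₁ refl
blank-or-mark (vertical _ (suc _))   cross       = inj₂ refl

significance-blank : ∀ b → significance b (blank b) ≡ insignificant
significance-blank (staircase _ _)        = refl
significance-blank (horizontal _ zero)    = refl
significance-blank (horizontal _ (suc _)) = refl
significance-blank (vertical _ zero)      = refl
significance-blank (vertical _ (suc _))   = refl

significance-mark : ∀ b → significance b (mark b) ≡ significant
significance-mark (staircase _ _)        = refl
significance-mark (horizontal _ zero)    = refl
significance-mark (horizontal _ (suc _)) = refl
significance-mark (vertical _ zero)      = refl
significance-mark (vertical _ (suc _))   = refl

-- The order agrees with that of `subsets`, so the significant boxes of all fillings form that very
-- list.
fillings : ∀ bs → List (All Tile bs)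
fillings []       = [] ∷ []
fillings (b ∷ bs) = map (blank b ∷_) (fillings bs) ++ map (mark b ∷_) (fillings bs)

∈-fillings : ∀ {bs} (D : All Tile bs) → D ∈ fillings bs
∈-fillings []                = here refl
∈-fillings (_∷_ {x = b} t D) with blank-or-mark b t
... | inj₁ refl = ∈-++⁺ˡ (∈-map⁺ (blank b ∷_) (∈-fillings D))
... | inj₂ refl = ∈-++⁺ʳ _ (∈-map⁺ (mark b ∷_) (∈-fillings D))

∷-injectiveʳ : ∀ {b bs} {t t′ : Tile b} {D D′ : All Tile bs} → _≡_ {A = All Tile (b ∷ bs)} (t ∷ D) (t′ ∷ D′) → D ≡ D′
∷-injectiveʳ refl = refl

fillings-unique : ∀ bs → Unique (fillings bs)
fillings-unique []       = [] ∷ []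
fillings-unique (b ∷ bs) = Unique.++⁺ (Unique.map⁺ ∷-injectiveʳ (fillings-unique bs)) (Unique.map⁺ ∷-injectiveʳ (fillings-unique bs))
  λ (D∈ , D∈′) → disjoint (∈-map⁻ _ D∈) (∈-map⁻ _ D∈′)
  where
  disjoint : ∀ {D} → (∃ λ E → E ∈ fillings bs × D ≡ blank b ∷ E) → ¬ (∃ λ E → E ∈ fillings bs × D ≡ mark b ∷ E)
  disjoint (_ , _ , refl) (_ , _ , e) = case trans (sym (significance-blank b))
    (trans (cong (λ D → significance b (All.head D)) e) (significance-mark b)) of λ ()

significantBoxes-fillings : ∀ bs → map significantBoxes (fillings bs) ≡ subsets bs
significantBoxes-fillings []       = refl
significantBoxes-fillings (b ∷ bs) = trans (List.map-++ significantBoxes (map (blank b ∷_) (fillings bs)) _) (cong₂ _++_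
  (trans (sym (List.map-∘ (fillings bs))) (trans (List.map-cong skip (fillings bs)) ih))
  (trans (sym (List.map-∘ (fillings bs))) (trans (List.map-cong take (fillings bs)) (trans (List.map-∘ (fillings bs)) (cong (map (b ∷_)) ih)))))
  where
  ih = significantBoxes-fillings bs
  skip : ∀ D → significantBoxes (blank b ∷ D) ≡ significantBoxes D
  skip D rewrite significance-blank b = refl
  take : ∀ D → significantBoxes (mark b ∷ D) ≡ b ∷ significantBoxes D
  take D rewrite significance-mark b = refl

pipeDreamSum : ∀ n k w → PipeDreamSum n k w (reducedSum (base n k) w)
pipeDreamSum n k w = sumsTo {S = setoid (PipeDream n k)} dreams (Unique.filter⁺ reduced? (fillings-unique (base n k)))
  (λ D → mk⇔ (∈-filter⁺ reduced? (∈-fillings D)) (λ D∈ → proj₂ (∈-filter⁻ reduced? {xs = fillings (base n k)} D∈)))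
  (monomial {n} {k}) (λ _ _ → ≈-refl)
  (≈-sym (≈-trans (sumOver-filter reduced? (fillings (base n k)) (monomial {n} {k})) (≡⇒≈ (trans
    (sym (sumOver-map significantBoxes (fillings (base n k)) f))
    (cong (λ Ds → sumOver Ds f) (significantBoxes-fillings (base n k)))))))
  where
  reduced? : ∀ (D : PipeDream n k) → Dec (word {n} {k} D ∈R w)
  reduced? D = word {n} {k} D ∈R? w
  dreams : List (PipeDream n k)
  dreams = filter reduced? (fillings (base n k))
  f : List Box → Poly XZ
  f D = gate (map letter D ∈R? w) (monomialOf D)

-- Admissible monomials and length-additive factorizations

reduced⇒NoStutter : ∀ {a w} → a ∈R w → NoStutter a
reduced⇒NoStutter {[]}        _  = []
reduced⇒NoStutter {_ ∷ []}    _  = [-]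
reduced⇒NoStutter {i ∷ j ∷ a} {w} a∈ =
  (λ { refl → stutter-∉R [] i a {w} a∈ }) ∷ reduced⇒NoStutter {w = ⟦ j ∷ a ⟧} (suffix-∈R {i ∷ []} {j ∷ a} {w} a∈)

words : ℕ → ℕ → List Word
words n zero    = [] ∷ []
words n (suc l) = [] ∷ concatMap (λ a → map (a ∷_) (words n l)) (upTo n)

∈-words : ∀ n {l} c → All (_< n) c → length c ≤ l → c ∈ words n l
∈-words n {zero}  []      _           _       = here refl
∈-words n {suc l} []      _           _       = here refl
∈-words n {suc l} (a ∷ c) (a<n ∷ c<n) (s≤s q) = there (∈-concatMap⁺ _
  (Any.map (λ { refl → ∈-map⁺ (a ∷_) (∈-words n c c<n q) }) (∈-upTo⁺ a<n)))

BC-decSetoid : DecSetoid 0ℓ 0ℓ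
BC-decSetoid = record
  { isDecEquivalence = record { isEquivalence = Setoid.isEquivalence BC-setoid ; _≟_ = _≋?_ } }

BC²-setoid WordMonomial-setoid : Setoid 0ℓ 0ℓ
BC²-setoid          = ×-setoid BC-setoid BC-setoid
WordMonomial-setoid = ×-setoid (setoid Word) (↭-setoid {A = ℕ})

open DecSetoid (×-decSetoid BC-decSetoid BC-decSetoid) using () renaming (_≟_ to _≋²?_)
open Membership BC²-setoid using () renaming (_∈_ to _∈²_)
open Membership WordMonomial-setoid using () renaming (_∈_ to _∈ʷᵐ_)

module Admissible (m : ℕ) (w : BC∞) (w∈ : w ∈BC suc m) (k : ℕ) where

  open Staircase m

  private
    n = suc m
    n≥1 : n ≥ 1
    n≥1 = s≤s z≤n
    X = xPairs n k
    Z = zPairs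

  Factorization : BC∞ × BC∞ → Set
  Factorization (u , v) = u · v ≋ w × (∃ λ l → ∃ λ m → HasLength u l × HasLength v m × HasLength w (l + m)) × v ∈S n

  term : Word × List ℕ → Word × List ℕ → Poly XZ
  term (_ , α) (_ , β) = two ^ᵖ #variables α ⊗ x^ α ⊗ z^ β

  gatedTerm : Word × List ℕ → Word × List ℕ → Poly XZ
  gatedTerm aα@(a , _) bβ@(b , _) = gate ((a ++ b) ∈R? w) (term aα bβ)

  reducedSum-pairs : reducedSum (base n k) w ≈ sumOver X (λ aα → sumOver Z (gatedTerm aα))
  reducedSum-pairs = begin
    sumOver (subsets (Γs ++ stairs)) (λ D → gate (map letter D ∈R? w) (monomialOf D))
      ≈⟨ sumOver-subsets-++ Γs stairs _ ⟩
    sumOver (subsets Γs) (λ D → sumOver (subsets stairs) (λ E → gate (map letter (D ++ E) ∈R? w) (monomialOf (D ++ E))))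
      ≈⟨ sumOver-cong (subsets Γs) (λ D → ≈-trans (sumOver-cong (subsets stairs) (split D)) (≈-sym (sumOver-⊗ (subsets stairs) (monomialOf D) _))) ⟩
    sumOver (subsets Γs) (λ D → monomialOf D ⊗ g (map letter D))
      ≈⟨ ΓsSum n k g (λ a i b → sumOver-0 (subsets stairs) λ E → ≈-trans
           (⊗-cong ≈-refl (gate-no (((a ++ i ∷ i ∷ b) ++ map letter E) ∈R? w)
             (λ r → stutter-∉R a i (b ++ map letter E) {w} (subst (_∈R w) (List.++-assoc a (i ∷ i ∷ b) (map letter E)) r))))
           (Ring.zeroʳ _)) ⟩
    sumOver X (λ (a , α) → xWeight α ⊗ g a)
      ≈⟨ sumOver-cong X (λ (a , α) → ≈-trans
           (⊗-cong ≈-refl (sumOver-stairs (λ b → gate ((a ++ b) ∈R? w) (con 1ℚ))))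
           (≈-trans (sumOver-⊗ Z (xWeight α) _) (sumOver-cong Z (λ (b , β) → collect (a ++ b) (xWeight α) (z^ β))))) ⟩
    sumOver X (λ aα → sumOver Z (gatedTerm aα)) ∎
    where
    Γs = concatMap (Γ-block n) (downFrom k)
    g : Word → Poly XZ
    g a = sumOver (subsets stairs) (λ E → monomialOf E ⊗ gate ((a ++ map letter E) ∈R? w) (con 1ℚ))
    collect : ∀ c (f h : Poly XZ) → f ⊗ (h ⊗ gate (c ∈R? w) (con 1ℚ)) ≈ gate (c ∈R? w) (f ⊗ h)
    collect c f h = ≈-trans (⊗-cong ≈-refl (≈-trans (gate-⊗ (c ∈R? w) h _) (gate-cong (c ∈R? w) (λ _ → ⊗-idʳ h))))
                            (gate-⊗ (c ∈R? w) f h)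
    split : ∀ D E → gate (map letter (D ++ E) ∈R? w) (monomialOf (D ++ E)) ≈
                    monomialOf D ⊗ (monomialOf E ⊗ gate ((map letter D ++ map letter E) ∈R? w) (con 1ℚ))
    split D E = ≈-trans (≡⇒≈ (cong (λ c → gate (c ∈R? w) (monomialOf (D ++ E))) (List.map-++ letter D E)))
      (≈-trans (gate-cong ((map letter D ++ map letter E) ∈R? w) (λ _ → ∏-++ _ D E))
               (≈-sym (collect (map letter D ++ map letter E) (monomialOf D) (monomialOf E))))

  evaluate : Word × Word → BC∞ × BC∞
  evaluate (a , b) = ⟦ a ⟧ , ⟦ b ⟧

  Splitting : Word × Word → Set
  Splitting (a , b) = (a ++ b) ∈R w × All (1 ≤_) b

  splitting? : ∀ ab → Dec (Splitting ab)
  splitting? (a , b) = ((a ++ b) ∈R? w) Dec.×-dec All.all? (1 ℕ.≤?_) b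

  splittings : List (Word × Word)
  splittings = filter splitting? (cartesianProduct (words n ∣ w ∣ₗ) (words n ∣ w ∣ₗ))

  -- Group elements are functions, so factorizations are enumerated through pairs of words and then
  -- stripped of repetitions; positive letters in the right word put its value in S_n.
  factorizations : List (BC∞ × BC∞)
  factorizations = deduplicate _≋²?_ (map evaluate splittings)

  factorizations-unique : UniqueSetoid.Unique BC²-setoid factorizations
  factorizations-unique = UniqueDecSetoid.deduplicate-! (×-decSetoid BC-decSetoid BC-decSetoid) (map evaluate splittings)

  splitting⇒factorization : ∀ {a b u v} → Splitting (a , b) → u ≋ ⟦ a ⟧ → v ≋ ⟦ b ⟧ → Factorization (u , v)
  splitting⇒factorization {a} {b} {u} {v} (ab∈ , b≥1) u≋ v≋ =
    (λ i → trans (u≋ (to v i)) (trans (cong (to ⟦ a ⟧) (v≋ i)) (trans (sym (⟦⟧-++ a b i)) (proj₁ ab∈ i)))) ,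
    (length a , length b ,
      HasLength-resp {⟦ a ⟧} {u} (λ i → sym (u≋ i)) (proj₂ (prefix-∈R {a} {b} {w} ab∈)) ,
      HasLength-resp {⟦ b ⟧} {v} (λ i → sym (v≋ i)) (proj₂ (suffix-∈R {a} {b} {w} ab∈)) ,
      subst (HasLength w) (List.length-++ a {b}) (proj₂ ab∈)) ,
    b , All.zip (b≥1 , All.++⁻ʳ a (∈R-letters {n} {w} n≥1 w∈ ab∈)) , λ i → sym (v≋ i)

  module _ {u v : BC∞} (fac : Factorization (u , v)) where

    right-∈BC : v ∈BC n
    right-∈BC = let c , c∈ , c≋ = proj₂ (proj₂ fac) in ∈BC-resp {n} {⟦ c ⟧} {v} c≋ (⟦⟧-∈BC (All.map proj₂ c∈))

    left-∈BC : u ∈BC n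
    left-∈BC i q = trans (cong (to u) (sym (right-∈BC i q))) (trans (proj₁ fac i) (w∈ i q))

    factorization-++ : ∀ {a b} → a ∈R u → b ∈R v → (a ++ b) ∈R w
    factorization-++ {a} {b} a∈ b∈ = let uv≋w , (_ , _ , hu , hv , hw) , _ = fac in
      ∈R-++⁺ {u} {v} {w} {a = a} {b = b} uv≋w hu hv hw a∈ b∈

    right-letters : ∀ {b} → b ∈R v → All (_< n) b
    right-letters {b} = ∈R-letters {n} {v} n≥1 right-∈BC {b}

  ∈-factorizations : ∀ {a b} → Splitting (a , b) → (⟦ a ⟧ , ⟦ b ⟧) ∈² factorizations
  ∈-factorizations {a} {b} sp@(ab∈ , _) = MembershipP.∈-deduplicate⁺ BC²-setoid _≋²?_
    (λ {c} {d} {e} e≈d c≈d → Setoid.trans BC²-setoid {c} {d} {e} c≈d (Setoid.sym BC²-setoid {e} {d} e≈d)) {map evaluate splittings} {⟦ a ⟧ , ⟦ b ⟧}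
    (Any.map⁺ {f = evaluate} (Any.map (λ { refl → (λ _ → refl) , (λ _ → refl) }) (∈-filter⁺ splitting?
      (∈-cartesianProduct⁺ (∈-words n a (All.++⁻ˡ a ab<n) (ℕ.≤-trans (ℕ.m≤m+n _ _) ∣ab∣≤))
                           (∈-words n b (All.++⁻ʳ a ab<n) (ℕ.≤-trans (ℕ.m≤n+m _ (length a)) ∣ab∣≤)))
      sp)))
    where
    ab<n : All (_< n) (a ++ b)
    ab<n = ∈R-letters {n} {w} n≥1 w∈ ab∈
    ∣ab∣≤ : length a + length b ≤ ∣ w ∣ₗ
    ∣ab∣≤ = ℕ.≤-reflexive (trans (sym (List.length-++ a {b})) (HasLength-unique {w} (proj₂ ab∈) (hasLength-∣∣ w)))

  factorizations-complete : ∀ uv → Factorization uv ⇔ uv ∈² factorizations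
  factorizations-complete (u , v) = mk⇔ complete sound
    where
    complete : Factorization (u , v) → (u , v) ∈² factorizations
    complete fac with a , a∈ ← reducedWordOf u | b , b∈ ← reducedWordOf v =
      MembershipP.∈-resp-≈ BC²-setoid {factorizations} {⟦ a ⟧ , ⟦ b ⟧} {u , v} (proj₁ a∈ , proj₁ b∈)
        (∈-factorizations {a} {b} (factorization-++ {u} {v} fac {a} {b} a∈ b∈ ,
          ∈R-letters≥1 {v} (∈S⇒PreservesSigns {v} {n} (proj₂ (proj₂ fac))) b∈))
    sound : (u , v) ∈² factorizations → Factorization (u , v)
    sound uv∈ with find (Any.map⁻ {f = evaluate} (MembershipP.∈-deduplicate⁻ BC²-setoid _≋²?_ (map evaluate splittings) {u , v} uv∈))
    ... | (a , b) , ab∈ , u≋ , v≋ = splitting⇒factorization {a} {b} {u} {v} (proj₂ (∈-filter⁻ splitting? {xs = cartesianProduct (words n ∣ w ∣ₗ) (words n ∣ w ∣ₗ)} ab∈)) u≋ v≋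

  innerZ : BC∞ → List (Word × List ℕ)
  innerZ v = filter (λ (b , _) → b ∈R? v) Z

  innerX : BC∞ → List (Word × List ℕ)
  innerX u = filter (λ (a , _) → a ∈R? u) X

  sum-innerZ : ∀ {u v} → Factorization (u , v) → ∀ aα →
    SumsTo WordMonomial-setoid (λ (b , β) → b ∈R v × β ∈𝒜z b) (λ bβ → term aα bβ ≈_) (sumOver (innerZ v) (term aα))
  sum-innerZ {u} {v} fac aα = sumsTo {S = WordMonomial-setoid} (innerZ v)
    (AllPairs.filter⁺ (λ (b , _) → b ∈R? v) (AllPairs-mapAll
      (λ { ((_ , js↗ , _) , _) ((_ , js′↗ , _) , _) ≢ (refl , js↭js′) → ≢ (cong (_ ,_) (↭-ascending js↗ js′↗ js↭js′)) })
      zPairs-sound zPairs-unique))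
    (λ (b , β) → mk⇔ complete sound)
    (term aα) (λ _ _ → ≈-refl) ≈-refl
    where
    complete : ∀ {b β} → b ∈R v × β ∈𝒜z b → (b , β) ∈ʷᵐ innerZ v
    complete {b} (b∈ , js , adm , β↭js) = Any.map (λ { refl → refl , β↭js })
      (∈-filter⁺ (λ (b , _) → b ∈R? v) (zPairs-complete (right-letters {u} {v} fac {b} b∈) adm) b∈)
    sound : ∀ {b β} → (b , β) ∈ʷᵐ innerZ v → b ∈R v × β ∈𝒜z b
    sound bβ∈ with find bβ∈
    ... | (b , js) , bjs∈ , refl , β↭js with ∈-filter⁻ (λ (b , _) → b ∈R? v) {xs = Z} bjs∈
    ...   | bjs∈Z , b∈ = b∈ , js , proj₁ (All.lookup zPairs-sound bjs∈Z) , β↭js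

  sum-innerX : ∀ {u v} → Factorization (u , v) →
    SumsTo WordMonomial-setoid (λ (a , α) → a ∈R u × α ∈𝒜x a × All (_< k) α)
      (λ aα → SumsTo WordMonomial-setoid (λ (b , β) → b ∈R v × β ∈𝒜z b) (λ bβ → term aα bβ ≈_))
      (sumOver (innerX u) (λ aα → sumOver (innerZ v) (term aα)))
  sum-innerX {u} {v} fac = sumsTo {S = WordMonomial-setoid} (innerX u)
    (AllPairs.filter⁺ (λ (a , _) → a ∈R? u) (AllPairs-mapAll
      (λ { ((_ , js↘ , _) , _) ((_ , js′↘ , _) , _) ≢ (refl , js↭js′) → ≢ (cong (_ ,_) (↭-descending js↘ js′↘ js↭js′)) })
      (xPairs-sound n k) (xPairs-unique n k)))
    (λ (a , α) → mk⇔ complete sound)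
    (λ aα → sumOver (innerZ v) (term aα)) (λ aα _ → sum-innerZ {u} {v} fac aα) ≈-refl
    where
    complete : ∀ {a α} → a ∈R u × α ∈𝒜x a × All (_< k) α → (a , α) ∈ʷᵐ innerX u
    complete {a} (a∈ , (js , adm , α↭js) , α<k) = Any.map (λ { refl → refl , α↭js })
      -- Valleys have no equal neighbours, so the list catches an admissible pair only because its
      -- word is reduced.
      (∈-filter⁺ (λ (a , _) → a ∈R? u) (xPairs-complete n k (∈R-letters {n} {u} n≥1 (left-∈BC {u} {v} fac) a∈)
        (reduced⇒NoStutter {a} {u} a∈) adm (All-resp-↭ α↭js α<k)) a∈)
    sound : ∀ {a α} → (a , α) ∈ʷᵐ innerX u → a ∈R u × α ∈𝒜x a × All (_< k) α
    sound aα∈ with find aα∈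
    ... | (a , js) , ajs∈ , refl , α↭js with ∈-filter⁻ (λ (a , _) → a ∈R? u) {xs = X} ajs∈
    ...   | ajs∈X , a∈ with All.lookup (xPairs-sound n k) ajs∈X
    ...     | adm , js<k = a∈ , (js , adm , α↭js) , All-resp-↭ (↭-sym α↭js) js<k

  Factors : Word → Word → BC∞ × BC∞ → Set
  Factors a b (u , v) = a ∈R u × b ∈R v

  factors? : ∀ a b uv → Dec (Factors a b uv)
  factors? a b (u , v) = (a ∈R? u) Dec.×-dec (b ∈R? v)

  -- Each pair of words whose concatenation is reduced for w belongs to
  -- exactly one factorization of w, and the other pairs to none.
  sum-factorizations : ∀ a b → All (1 ≤_) b → ∀ (f : Poly XZ) →
    sumOver factorizations (λ uv → gate (factors? a b uv) f) ≈ gate ((a ++ b) ∈R? w) f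
  sum-factorizations a b b≥1 f with (a ++ b) ∈R? w
  ... | yes ab∈ = sumOver-single (factors? a b) f
        (AllPairs.map (λ ≄ ((a∈u , b∈v) , (a∈u′ , b∈v′)) → ≄
            ((λ i → trans (sym (proj₁ a∈u i)) (proj₁ a∈u′ i)) , (λ i → trans (sym (proj₁ b∈v i)) (proj₁ b∈v′ i))))
          factorizations-unique)
        (Any.map (λ {uv} (a≋u , b≋v) → ∈R-resp {⟦ a ⟧} {proj₁ uv} {a} a≋u (prefix-∈R {a} {b} {w} ab∈) ,
                                       ∈R-resp {⟦ b ⟧} {proj₂ uv} {b} b≋v (suffix-∈R {a} {b} {w} ab∈))
          (∈-factorizations {a} {b} (ab∈ , b≥1)))
  ... | no ab∉ = sumOver-none (factors? a b) f (All.tabulateₛ BC²-setoid λ {uv} uv∈ (a∈ , b∈) →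
        ab∉ (factorization-++ {proj₁ uv} {proj₂ uv} (Equivalence.from (factorizations-complete uv) uv∈) {a} {b} a∈ b∈))

  pairs-factorizations : sumOver X (λ aα → sumOver Z (gatedTerm aα)) ≈
    sumOver factorizations (λ (u , v) → sumOver (innerX u) (λ aα → sumOver (innerZ v) (term aα)))
  pairs-factorizations = ≈-sym (begin
    sumOver factorizations (λ (u , v) → sumOver (innerX u) (λ aα → sumOver (innerZ v) (term aα)))
      ≈⟨ sumOver-cong factorizations (λ (u , v) → ≈-trans (sumOver-filter (λ (a , _) → a ∈R? u) X _)
           (sumOver-cong X (λ (a , α) → ≈-trans
             (gate-cong (a ∈R? u) (λ _ → sumOver-filter (λ (b , _) → b ∈R? v) Z _))
             (≈-trans (≈-sym (sumOver-gate (a ∈R? u) Z _))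
               (sumOver-cong Z (λ (b , β) → gate-× (a ∈R? u) (b ∈R? v))))))) ⟩
    sumOver factorizations (λ uv → sumOver X (λ aα → sumOver Z (gated uv aα)))
      ≈⟨ sumOver-swap factorizations X (λ uv aα → sumOver Z (gated uv aα)) ⟩
    sumOver X (λ aα → sumOver factorizations (λ uv → sumOver Z (gated uv aα)))
      ≈⟨ sumOver-cong X (λ aα → sumOver-swap factorizations Z (λ uv → gated uv aα)) ⟩
    sumOver X (λ aα → sumOver Z (λ bβ → sumOver factorizations (λ uv → gated uv aα bβ)))
      ≈⟨ sumOver-cong X (λ { aα@(a , _) → sumOver-cong-All (All.map
           (λ { {bβ@(b , _)} (_ , b∈) → sum-factorizations a b (All.map proj₁ b∈) (term aα bβ) }) zPairs-sound) }) ⟩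
    sumOver X (λ aα → sumOver Z (gatedTerm aα)) ∎)
    where
    gated : BC∞ × BC∞ → Word × List ℕ → Word × List ℕ → Poly XZ
    gated uv aα@(a , _) bβ@(b , _) = gate (factors? a b uv) (term aα bβ)
    gate-× : ∀ {P Q : Set} (P? : Dec P) (Q? : Dec Q) {f : Poly XZ} → gate P? (gate Q? f) ≈ gate (P? Dec.×-dec Q?) f
    gate-× (yes _) (yes _) = ≈-refl
    gate-× (yes _) (no _)  = ≈-refl
    gate-× (no _)  _       = ≈-refl

  admissibleSum : AdmissibleSum n k w (reducedSum (base n k) w)
  admissibleSum = sumsTo {S = BC²-setoid} factorizations factorizations-unique factorizations-complete
    (λ (u , v) → sumOver (innerX u) (λ aα → sumOver (innerZ v) (term aα)))
    (λ _ → sum-innerX)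
    (≈-trans reducedSum-pairs pairs-factorizations)

theorem3p4 : (n : ℕ) → n ≥ 1 → (w : BC∞) → w ∈BC n → (k : ℕ) →
    ∃ λ t → PipeDreamSum n k w t × AdmissibleSum n k w t ×
    ((ℭ : BC∞ → Poly PZ) → IsSchubertFamily ℭ → truncate k (ℭ w) ≈ t)
theorem3p4 n@(suc m) n≥1 w w∈ k =
  reducedSum (base n k) w ,
  pipeDreamSum n k w ,
  Admissible.admissibleSum m w w∈ k ,
  λ ℭ isℭ → truncate-ℭ ℭ isℭ n≥1 w w∈ k
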